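{- Let $n$ be a power of $2$ and let $\mu$ be a distribution over $[n]$. For any $\epsilon,\delta$ and $s$, the Persistent Sampler algorithm with parameters $\epsilon,\delta,s$ (defined in the context), using conditional sample access to $\mu$, is a $(\delta,s)$-explicit persistent sampler for the $(\epsilon,\frac{\delta}{s\log n})$-condensation of $\mu$. It uses a total of $2^5\cdot\epsilon^{ -4}\log^5 n\cdot\log(s\delta^{ -1}\log n)$ adaptive conditional samples from $\mu$ to output a sample.
   Context: $[n]=\{1,\ldots,n\}$, $\epsilon,\delta\in(0,1)$, $s$ a positive integer. A conditional sample from $\mu$ with a nonempty set $A\subseteq[n]$ is an element $j\in A$ drawn with probability $\mu(j)/\mu(A)$ if $\mu(A)>0$, and uniformly from $A$ if $\mu(A)=0$, independently of all previous samples. Explicit persistent sampler: given a distribution over distributions $\mathcal M$, a $(\delta,s)$-explicit persistent sampler for $\mathcal M$ is an algorithm that can be run up to $s$ times (storing information between runs) and that in every run returns a pair $(i,\eta)$, such that with probability at least $1-\delta$ the $i$'s of all $s$ runs are independent samples of a single distribution $\tilde\mu$ that in itself was drawn according to $\mathcal M$, and every output pair $(i,\eta)$ satisfies $\eta=\tilde\mu(i)$. Tree notation: $T$ is a full balanced binary tree with $n$ leaves labeled by $[n]$, $U$ is the set of its non-leaf nodes, and for $u\in U$, $L(u)$ (resp. $R(u)$) is the set of leaves that are descendants of the left (resp. right) child of $u$. Write $r_u=\frac{\mu(L(u))}{\mu(L(u))+\mu(R(u))}$, with the value $\frac12$ used when the denominator is $0$. Reconstituted distribution: for $\alpha:U\to[0,1]$,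 the reconstituted distribution $\tilde\mu$ according to $\alpha$ is defined for $i\in[n]$ by taking the root-to-leaf path $u_1,\ldots,u_{\log n+1}=i$, setting $p_j=\alpha(u_j)$ if $i\in L(u_j)$ and $p_j=1-\alpha(u_j)$ otherwise ($1\le j\le\log n$), and letting $\tilde\mu(i)=\prod_{j=1}^{\log n}p_j$. $(\epsilon',\delta')$-Ratio Estimator: on $u\in U$, take $t=2\epsilon'^{ -2}\log(\delta'^{ -1})$ conditional samples from $\mu$ with the set $L(u)\cup R(u)$, and return the fraction of the samples that lie in $L(u)$. $(\epsilon,\delta')$-condensation of $\mu$: the distribution over distributions obtained by the following process. Independently for every $u\in U$, let $\alpha(u)$ be the (random) result of the $\left(\left(\frac{\epsilon}{2\log n}\right)^2,\delta'\right)$-Ratio Estimator on $u$, conditioned on this result being at distance at most $\left(\frac{\epsilon}{2\log n}\right)^2$ from $r_u$; the drawn distribution $\tilde\mu$ is the reconstituted distribution according to $\alpha$. Persistent Sampler with parameters $\epsilon,\delta,s$: on the initial run, fix $T$ to be a full balanced binary tree with $n$ leaves labeled by $[n]$, with root $w$ and set of non-leaf nodes $U$, and with $\alpha$ unset everywhere on $U$. On every run, set $u_1=w$ and for $l=1,\ldots,\log n$: (a) if $\alpha(u_l)$ is not yet set, set it to the result of the $\left(\left(\frac{\epsilon}{2\log n}\right)^2,\frac{\delta}{s\log n}\right)$-Ratio Estimator on $u_l$, run independently of prior runs; (b) independently of prior choices and without sampling from $\mu$, with probability $\alpha(u_l)$ let $u_{l+1}$ be the left child of $u_l$ and $p_l=\alpha(u_l)$,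 and with probability $1-\alpha(u_l)$ let $u_{l+1}$ be the right child of $u_l$ and $p_l=1-\alpha(u_l)$. Then return $(i,\eta)$, where $i$ is the label of the leaf $u_{\log n+1}$ and $\eta=\prod_{l=1}^{\log n}p_l$. Logarithms of $n$ counting tree levels are in base $2$.
   Formalization: The Ratio Estimator's sample size t is rounded up to an integer, so a first run uses between N and N+log n samples (N the stated total) and any run at most N+log n; conditioning on a null event, where the condensation is undefined, has no effect. -}

module Defs where

open import Algebra.Bundles using (CommutativeRing)
open import Algebra.Structures using (IsCommutativeRing)
import Algebra.Properties.Semiring.Exp as Exp
import Algebra.Properties.Semiring.Mult as Mult
import Algebra.Properties.Semiring.Sum as Sum
open import Data.Bool.Base using (Bool; true; false; if_then_else_; _∧_)
open import Data.Fin.Base using (Fin)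
open import Data.Fin.Subset using (Subset; Nonempty; ∣_∣; _∪_; _∈_)
open import Data.Fin.Subset.Properties using (_∈?_; x∈p∪q⁺)
open import Data.List.Base as List using (List; []; _∷_)
open import Data.List.Relation.Unary.All using (All)
open import Data.Maybe.Base using (Maybe; just; nothing)
open import Data.Nat.Base using (ℕ; zero; suc)
open import Data.Product.Base using (Σ; ∃; ∃-syntax; _×_; _,_; proj₁; proj₂)
open import Data.Sum.Base using (inj₁)
open import Data.Vec.Base as Vec using (Vec; []; _∷_)
open import Data.Vec.Properties using (lookup⇒[]=; lookup∘tabulate)
open import Function.Base using (_∘_)
open import Function.Bundles using (_↔_; Inverse)
open import Level using (0ℓ)
open import Relation.Binary.Structures using (IsDecTotalOrder)
open import Relation.Binary.PropositionalEquality
  using (_≡_; _≢_; refl; trans; cong)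
open import Relation.Nullary.Decidable using (yes; no; ⌊_⌋)

-- `_⁻¹` is total, with an unspecified value at 0#.
record OrderedField : Set₁ where
  infixl 6 _+_ _-_
  infixl 7 _*_ _/_
  infix  8 -_
  infix  9 _⁻¹
  infix  4 _≤_ _<_
  field
    ℝ                 : Set
    _+_ _*_           : ℝ → ℝ → ℝ
    -_ _⁻¹            : ℝ → ℝ
    0# 1#             : ℝ
    isCommutativeRing : IsCommutativeRing _≡_ _+_ _*_ -_ 0# 1#
    0≢1               : 0# ≢ 1#
    *-inverse         : ∀ x → x ≢ 0# → x * x ⁻¹ ≡ 1#
    _≤_               : ℝ → ℝ → Set
    isDecTotalOrder   : IsDecTotalOrder _≡_ _≤_
    +-monoʳ-≤         : ∀ x {y z} → y ≤ z → x + y ≤ x + z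
    *-nonNegative     : ∀ {x y} → 0# ≤ x → 0# ≤ y → 0# ≤ x * y

  commutativeRing : CommutativeRing 0ℓ 0ℓ
  commutativeRing = record { isCommutativeRing = isCommutativeRing }

  open CommutativeRing commutativeRing public using (semiring)
  open IsDecTotalOrder isDecTotalOrder public using (_≤?_; _≟_)
  open Exp semiring public using (_^_)
  open Sum semiring public using (sum)
  open Mult semiring using () renaming (_×_ to _·_)

  _-_ _/_ : ℝ → ℝ → ℝ
  x - y = x + - y
  x / y = x * y ⁻¹

  _<_ : ℝ → ℝ → Set
  x < y = x ≤ y × x ≢ y

  fromℕ : ℕ → ℝ
  fromℕ m = m · 1#

-- The axioms of a Dedekind-complete ordered field, which determine it up to
-- isomorphism. The order is decidable, as it is classically; this is what
-- allows a probability law to be defined by cases such as μ(A) > 0 or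
-- μ(A) = 0.
-- `archimedean` follows from `supremum` and is included to make ⌈_⌉
-- computable. `exp` is the only function satisfying `exp-+` and `1+x≤exp`,
-- so `log` is the natural logarithm on positive arguments (and unspecified
-- elsewhere).
record RealNumbers : Set₁ where
  field
    orderedField : OrderedField

  open OrderedField orderedField public

  UpperBound : (ℝ → Set) → ℝ → Set
  UpperBound P b = ∀ x → P x → x ≤ b

  field
    supremum    : ∀ (P : ℝ → Set) → ∃ P → ∃ (UpperBound P) →
                  ∃[ c ] UpperBound P c × (∀ b → UpperBound P b → c ≤ b)
    archimedean : ∀ x → ∃[ m ] x ≤ fromℕ m
    exp log     : ℝ → ℝ
    exp-+       : ∀ x y → exp (x + y) ≡ exp x * exp y
    1+x≤exp     : ∀ x → 1# + x ≤ exp x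
    exp-log     : ∀ x → 0# < x → exp (log x) ≡ x

  ⌈_⌉ : ℝ → ℕ
  ⌈ x ⌉ = search (proj₁ (archimedean x)) 0
    where
    search : ℕ → ℕ → ℕ
    search zero       m = m
    search (suc fuel) m = if ⌊ x ≤? fromℕ m ⌋ then m else search fuel (suc m)

  within : ℝ → ℝ → ℝ → Bool
  within η x y = ⌊ x - y ≤? η ⌋ ∧ ⌊ y - x ≤? η ⌋

data Side : Set where
  left right : Side

-- A leaf of the tree of depth k is the sequence of turns leading to it.
Leaf : ℕ → Set
Leaf = Vec Side

data Node : ℕ → Set where
  root  : ∀ {k} → Node (suc k)
  below : ∀ {k} → Side → Node k → Node (suc k)

-- A function on the non-leaf nodes, stored as the tree of its values.
data Labels (A : Set) : ℕ → Set where
  ∅    : Labels A 0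
  node : ∀ {k} → A → Labels A k → Labels A k → Labels A (suc k)

fill : ∀ {A : Set} {k} → A → Labels A k
fill {k = zero}  a = ∅
fill {k = suc k} a = node a (fill a) (fill a)

BalancedTree : ℕ → ℕ → Set
BalancedTree k n = Leaf k ↔ Fin n

-- On which side of the node the leaf hangs; nothing if it is not a descendant.
side : ∀ {k} → Node k → Leaf k → Maybe Side
side root                (d ∷ w) = just d
side (below left u)      (left ∷ w) = side u w
side (below left u)      (right ∷ w) = nothing
side (below right u)     (left ∷ w) = nothing
side (below right u)     (right ∷ w) = side u w

isLeft isRight : Maybe Side → Bool
isLeft (just left)   = true
isLeft (just right)  = false
isLeft nothing       = false
isRight (just left)  = false
isRight (just right) = true
isRight nothing      = false

leftLeaf : ∀ {k} (u : Node k) → ∃[ w ] side u w ≡ just left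
leftLeaf {suc k} root    = Vec.replicate (suc k) left , refl
leftLeaf (below left u)  = left ∷ proj₁ (leftLeaf u) , proj₂ (leftLeaf u)
leftLeaf (below right u) = right ∷ proj₁ (leftLeaf u) , proj₂ (leftLeaf u)

module _ {k n : ℕ} (T : BalancedTree k n) where
  open Inverse T

  L R : Node k → Subset n
  L u = Vec.tabulate (λ i → isLeft (side u (from i)))
  R u = Vec.tabulate (λ i → isRight (side u (from i)))

  L∪R-nonempty : ∀ u → Nonempty (L u ∪ R u)
  L∪R-nonempty u = to w , x∈p∪q⁺ {p = L u} {q = R u} (inj₁ to-w∈L)
    where
    w = proj₁ (leftLeaf u)
    to-w∈L : to w ∈ L u
    to-w∈L = lookup⇒[]= (to w) (L u)
      (trans (lookup∘tabulate _ (to w))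
      (trans (cong (isLeft ∘ side u) (strictlyInverseʳ w))
             (cong isLeft (proj₂ (leftLeaf u)))))

module OverReals (𝓡 : RealNumbers) where
  open RealNumbers 𝓡

  -- A law is a list of weighted outcomes; outcomes may be repeated, and laws
  -- are compared with _≈_ rather than _≡_.
  Law : Set → Set
  Law A = List (ℝ × A)

  Pr : ∀ {A : Set} → Law A → (A → Bool) → ℝ
  Pr []            E = 0#
  Pr ((w , a) ∷ d) E = (if E a then w else 0#) + Pr d E

  infix 4 _≈_
  _≈_ : ∀ {A : Set} → Law A → Law A → Set
  d ≈ e = ∀ E → Pr d E ≡ Pr e E

  IsProbability : ∀ {A : Set} → Law A → Set
  IsProbability d = All (λ wa → 0# ≤ proj₁ wa) d × Pr d (λ _ → true) ≡ 1#

  scale : ∀ {A : Set} → ℝ → Law A → Law A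
  scale c = List.map (λ (w , a) → c * w , a)

  pure : ∀ {A : Set} → A → Law A
  pure a = (1# , a) ∷ []

  infixl 1 _>>=_
  _>>=_ : ∀ {A B : Set} → Law A → (A → Law B) → Law B
  d >>= f = List.concatMap (λ (w , a) → scale w (f a)) d

  mapLaw : ∀ {A B : Set} → (A → B) → Law A → Law B
  mapLaw f = List.map (λ (w , a) → w , f a)

  -- The law d conditioned on the event E; conditioning on an event of
  -- probability 0, which the mathematics leaves undefined, has no effect.
  condition : ∀ {A : Set} → (A → Bool) → Law A → Law A
  condition E d with Pr d E ≟ 0#
  ... | yes _ = d
  ... | no  _ = List.map (λ (w , a) → (if E a then w / Pr d E else 0#) , a) d

  independently : ∀ {A : Set} {k} → (Node k → Law A) → Law (Labels A k)
  independently {k = zero}  f = pure ∅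
  independently {k = suc k} f =
    f root                           >>= λ a →
    independently (f ∘ below left)   >>= λ l →
    independently (f ∘ below right)  >>= λ r →
    pure (node a l r)

  MassFunction : ℕ → Set
  MassFunction n = Fin n → ℝ

  IsDistribution : ∀ {n} → MassFunction n → Set
  IsDistribution μ = (∀ i → 0# ≤ μ i) × sum μ ≡ 1#

  sample : ∀ {n} → MassFunction n → Law (Fin n)
  sample {n} μ = List.map (λ i → μ i , i) (List.allFin n)

  samples : ∀ {n} (s : ℕ) → MassFunction n → Law (Vec (Fin n) s)
  samples zero    μ = pure []
  samples (suc s) μ =
    sample μ >>= λ i → samples s μ >>= λ is → pure (i ∷ is)

  mass : ∀ {n} → MassFunction n → Subset n → ℝ
  mass μ A = sum (λ i → if ⌊ i ∈? A ⌋ then μ i else 0#)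

  conditionalMass : ∀ {n} → MassFunction n → Subset n → MassFunction n
  conditionalMass μ A i with i ∈? A | mass μ A ≤? 0#
  ... | no  _ | _     = 0#
  ... | yes _ | no  _ = μ i / mass μ A
  ... | yes _ | yes _ = 1# / fromℕ ∣ A ∣

  data Alg (n : ℕ) (A : Set) : Set where
    return     : A → Alg n A
    condSample : (S : Subset n) → Nonempty S → (Fin n → Alg n A) → Alg n A
    -- left with probability p, right with probability 1 - p, from internal
    -- randomness
    toss       : (p : ℝ) → (Side → Alg n A) → Alg n A

  bind : ∀ {n} {A B : Set} → Alg n A → (A → Alg n B) → Alg n B
  bind (return a)         f = f a
  bind (condSample S z g) f = condSample S z (λ i → bind (g i) f)
  bind (toss p g)         f = toss p (λ d → bind (g d) f)

  ⟦_⟧ : ∀ {n} {A : Set} → Alg n A → MassFunction n → Law A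
  ⟦ return a ⟧         μ = pure a
  ⟦ condSample S _ g ⟧ μ = sample (conditionalMass μ S) >>= λ i → ⟦ g i ⟧ μ
  ⟦ toss p g ⟧         μ =
    ((p , left) ∷ (1# - p , right) ∷ []) >>= λ d → ⟦ g d ⟧ μ

  -- P Uses m: some execution of P draws exactly m conditional samples.
  data _Uses_ {n : ℕ} {A : Set} : Alg n A → ℕ → Set where
    return     : ∀ {a} → return a Uses 0
    condSample : ∀ {S z g i m} → i ∈ S → g i Uses m →
                 condSample S z g Uses suc m
    toss       : ∀ {p g d m} → g d Uses m → toss p g Uses m

  record PersistentAlgorithm (n : ℕ) : Set₁ where
    field
      State   : Set
      initial : State
      run     : State → Alg n (State × (Fin n × ℝ))

    runsFrom : ∀ s → State → Alg n (Vec (Fin n × ℝ) s)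
    runsFrom zero    σ = return []
    runsFrom (suc s) σ =
      bind (run σ)         λ (σ′ , o) →
      bind (runsFrom s σ′) λ os →
      return (o ∷ os)

    runs : ∀ s → Alg n (Vec (Fin n × ℝ) s)
    runs s = runsFrom s initial

  -- The joint law of a distribution μ̃ drawn from 𝓜 and of s pairs (i , μ̃ i),
  -- where the i's are independent samples of μ̃.
  explicitSamples : ∀ {n} (s : ℕ) → Law (MassFunction n) →
                    Law (MassFunction n × Vec (Fin n × ℝ) s)
  explicitSamples s 𝓜 =
    𝓜            >>= λ μ̃ →
    samples s μ̃  >>= λ is →
    pure (μ̃ , Vec.map (λ i → i , μ̃ i) is)

  -- There are an event of probability at least 1 - δ and a random
  -- distribution μ̃, both defined jointly with the outputs of the s runs, such
  -- that conditioned on the event μ̃ is drawn according to 𝓜, the i's are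
  -- independent samples of μ̃, and every η is μ̃ i.
  IsExplicitPersistentSampler :
    ∀ {n} → MassFunction n → ℝ → ℕ → Law (MassFunction n) →
    PersistentAlgorithm n → Set
  IsExplicitPersistentSampler {n} μ δ s 𝓜 P =
    Σ (Law (Bool × (MassFunction n × Vec (Fin n × ℝ) s))) λ J →
      IsProbability J
      × mapLaw (proj₂ ∘ proj₂) J ≈ ⟦ PersistentAlgorithm.runs P s ⟧ μ
      × 1# - δ ≤ Pr J proj₁
      × mapLaw proj₂ (condition proj₁ J) ≈ explicitSamples s 𝓜

  accuracy : ℝ → ℕ → ℝ
  accuracy ε k = (ε / (fromℕ 2 * fromℕ k)) ^ 2

  module _ {k n : ℕ} (T : BalancedTree k n) where
    open Inverse T

    ratio : MassFunction n → Node k → ℝ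
    ratio μ u with mass μ (L T u) + mass μ (R T u) ≟ 0#
    ... | yes _ = 1# / fromℕ 2
    ... | no  _ = mass μ (L T u) / (mass μ (L T u) + mass μ (R T u))

    pathProduct : ∀ {m} → Labels ℝ m → Leaf m → ℝ
    pathProduct ∅            []          = 1#
    pathProduct (node a l r) (left ∷ w)  = a * pathProduct l w
    pathProduct (node a l r) (right ∷ w) = (1# - a) * pathProduct r w

    reconstituted : Labels ℝ k → MassFunction n
    reconstituted α i = pathProduct α (from i)

    countLeft : Node k → ℕ → Alg n ℕ
    countLeft u zero    = return 0
    countLeft u (suc t) =
      condSample (L T u ∪ R T u) (L∪R-nonempty T u) λ i →
      bind (countLeft u t) λ h →
      return (if ⌊ i ∈? L T u ⌋ then suc h else h)

    -- The prescribed number of samples need not be an integer: round it up.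
    sampleSize : ℝ → ℝ → ℕ
    sampleSize ε′ δ′ = ⌈ fromℕ 2 * (ε′ ⁻¹) ^ 2 * log (δ′ ⁻¹) ⌉

    ratioEstimator : ℝ → ℝ → Node k → Alg n ℝ
    ratioEstimator ε′ δ′ u =
      bind (countLeft u t) λ h → return (fromℕ h / fromℕ t)
      where t = sampleSize ε′ δ′

    condensation : MassFunction n → ℝ → ℝ → Law (MassFunction n)
    condensation μ ε δ′ = mapLaw reconstituted (independently λ u →
      condition (λ x → within ε′ x (ratio μ u))
                (⟦ ratioEstimator ε′ δ′ u ⟧ μ))
      where ε′ = accuracy ε k

    recall : Maybe ℝ → Alg n ℝ → Alg n ℝ
    recall (just a) _ = return a
    recall nothing  e = e

    -- The walk from the root of a subtree to a leaf, where `estimate`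
    -- estimates the ratios of the nodes of the subtree and the labels are the
    -- values of α that are already set; returns their updated values, the leaf
    -- and the product of the p's.
    walk : ∀ {m} → (Node m → Alg n ℝ) → Labels (Maybe ℝ) m →
           Alg n (Labels (Maybe ℝ) m × Leaf m × ℝ)
    walk estimate ∅            = return (∅ , [] , 1#)
    walk estimate (node v l r) =
      bind (recall v (estimate root)) λ a → toss a λ where
        left  → bind (walk (estimate ∘ below left) l) λ (l′ , w , η) →
                return (node (just a) l′ r , left ∷ w , a * η)
        right → bind (walk (estimate ∘ below right) r) λ (r′ , w , η) →
                return (node (just a) l r′ , right ∷ w , (1# - a) * η)

    persistentSampler : ℝ → ℝ → ℕ → PersistentAlgorithm n
    persistentSampler ε δ s = record
      { State   = Labels (Maybe ℝ) k
      ; initial = fill nothing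
      ; run     = λ α →
          bind (walk (ratioEstimator (accuracy ε k)
                                     (δ / (fromℕ s * fromℕ k))) α)
               λ (α′ , w , η) → return (α′ , to w , η)
      }

{-# OPTIONS --safe #-}
module Submission where

-- The sampler is compared with the same algorithm run on estimates that are
-- conditioned to be accurate.
--
-- With the conditioned estimates the outputs have exactly the law of the
-- explicit samples of the condensation: the estimates of the nodes that a walk
-- does not visit commute with the walk (`walk-complete`), so it is immaterial
-- whether a node is estimated when it is first visited or in advance
-- (`explicit-runs`).
--
-- Conditioning on an event of probability at least 1 - δ′ multiplies no
-- probability by more than 1 / (1 - δ′), and s runs visit at most s k nodes, for
-- trees of depth k. So an output of the sampler is at least (1 - δ′) ^ (s k)
-- times as likely as with conditioned estimates (`runs-dominates`), and this
-- factor is at least 1 - δ when δ′ = δ / (s k). The required event is then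
-- obtained by splitting the law of the outputs: with probability 1 - δ they are
-- explicit samples of the condensation, and otherwise they follow the normalised
-- difference of the two laws (`coupling`). The event that all visited nodes have
-- accurate estimates would not do, because conditioning on it favours the runs
-- that visit few nodes.
--
-- An estimate is accurate with probability at least 1 - δ′, or with probability
-- 0, in which case conditioning has no effect. To see this, note that an
-- estimate is h / t for a binomial variable h with success probability r
-- (`𝔼-conditional-sample`), and that exp (- t e² / 2) ≤ δ′ by the choice of t,
-- for the accuracy e. If t e² ≥ 2 then Chernoff's bound 2 exp (- t e²) on the
-- failure probability suffices. For smaller t e², which occurs when δ′ is close
-- to 1, one needs a lower bound on the probability of the window
-- |h - t r| ≤ t e. It comes from Stein's identity: the expected value of
-- r (t - h) f (h + 1) - (1 - r) h f h is 0 for every f. If f decreases across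
-- the window and is constant on both sides of it, then this expression is
-- at least a multiple of the distance from the mean off the window, and cannot
-- be very negative on it; its vanishing on average makes the window likely. When
-- the window is wide, f is the signed distance to the mean truncated at the ends of
-- the window (`wide`); when it is narrow, f changes its sign at a single
-- integer (`narrow`).
--
-- A run samples t times at each of the at most k nodes that it is the first to
-- visit, and k times the unrounded value of t is the stated number of samples
-- (`total-size`).

open import Defs
open import Algebra.Bundles using (CommutativeRing; RawRing)
import Algebra.Properties.Ring
import Algebra.Properties.Semiring.Exp
import Algebra.Properties.Semiring.Mult
import Algebra.Properties.Semiring.Sum
import Algebra.Solver.Ring
open import Algebra.Solver.Ring.AlmostCommutativeRing
  using (AlmostCommutativeRing; fromCommutativeRing; _-Raw-AlmostCommutative⟶_)
open import Data.Bool.Base using (Bool; true; false; if_then_else_; _∧_; _∨_)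
open import Data.Empty using (⊥-elim)
open import Data.Fin.Base as Fin using (Fin)
import Data.Fin.Properties as Fin
open import Data.Fin.Subset using (Subset; ∣_∣; _∪_)
open import Data.Fin.Subset.Properties using (_∈?_)
open import Data.Integer.Base as ℤ using (ℤ; _⊖_)
  renaming (+_ to pos; -[1+_] to negsuc)
import Data.Integer.Properties as ℤ
open import Data.List.Base as List using (List; []; _∷_; _++_)
open import Data.List.Membership.Propositional using (_∈_)
open import Data.List.Membership.Propositional.Properties
  using (∈-map⁺; ∈-map⁻; ∈-++⁺ˡ; ∈-++⁺ʳ; ∈-allFin; ∈-deduplicate⁺)
open import Data.List.Relation.Unary.All as All using (All; []; _∷_)
import Data.List.Relation.Unary.All.Properties as All
open import Data.List.Relation.Unary.AllPairs using ([]; _∷_)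
open import Data.List.Relation.Unary.Any using (here; there)
open import Data.List.Relation.Unary.Unique.DecPropositional.Properties
  using (deduplicate-!)
open import Data.List.Relation.Unary.Unique.Propositional using (Unique)
open import Data.List.Relation.Unary.Unique.Propositional.Properties
  using (map⁺; ++⁺; allFin⁺)
open import Data.Maybe.Base using (Maybe; just; nothing)
open import Data.Nat.Base as ℕ using (ℕ; zero; suc)
import Data.Nat.Properties as ℕ
open import Data.Product.Base using (∃; _×_; _,_; proj₁; proj₂)
import Data.Product.Properties as Product
open import Data.Sum.Base using (_⊎_; inj₁; inj₂)
open import Data.Unit.Base using (⊤; tt)
open import Data.Vec.Base as Vec using (Vec; []; _∷_)
open import Data.Vec.Properties as Vec
  using (lookup∘tabulate; lookup-zipWith; []=⇒lookup; lookup⇒[]=)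
open import Function.Base using (_∘_; id)
open import Function.Bundles using (Inverse)
open import Relation.Binary.Bundles using (Poset)
open import Relation.Binary.Definitions using (DecidableEquality; tri<; tri≈; tri>)
open import Relation.Binary.PropositionalEquality
import Relation.Binary.Reasoning.PartialOrder
open import Relation.Binary.Structures using (IsDecTotalOrder)
open import Relation.Nullary.Decidable using (yes; no; ⌊_⌋)
open import Relation.Nullary.Negation using (¬_)

-- Ordered fields

module OrderedFieldProperties (F : OrderedField) where
  open OrderedField F
  open CommutativeRing commutativeRing public
    using (+-comm; +-assoc; +-identityˡ; +-identityʳ; *-comm; *-assoc;
           *-identityˡ; *-identityʳ; distribˡ; distribʳ; zeroˡ; zeroʳ;
           -‿inverseʳ; ring)
  open IsDecTotalOrder isDecTotalOrder public
    using () renaming (refl to ≤-refl; reflexive to ≤-reflexive;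
                       trans to ≤-trans; antisym to ≤-antisym; total to ≤-total;
                       isPartialOrder to ≤-isPartialOrder)
  private
    module ×ₚ = Algebra.Properties.Semiring.Mult semiring
    module Ringₚ = Algebra.Properties.Ring ring

  ≤-poset : Poset _ _ _
  ≤-poset = record { isPartialOrder = ≤-isPartialOrder }

  module ≤-Reasoning = Relation.Binary.Reasoning.PartialOrder ≤-poset
    hiding (step-<; begin-strict_)

  fromℕ-+ : ∀ m n → fromℕ (m ℕ.+ n) ≡ fromℕ m + fromℕ n
  fromℕ-+ = ×ₚ.×-homo-+ 1#

  fromℕ-* : ∀ m n → fromℕ (m ℕ.* n) ≡ fromℕ m * fromℕ n
  fromℕ-* = ×ₚ.×1-homo-*

  -- The canonical map from the integers, arranged so that the numerals of
  -- the solver below denote `fromℕ n`, except that 1 denotes `1#`.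
  fromℤ : ℤ → ℝ
  fromℤ (pos 1)                = 1#
  fromℤ (pos n)                = fromℕ n
  fromℤ (negsuc n)             = - fromℕ (suc n)

  private
    fromℤ-+ⁿ : ∀ n → fromℤ (pos n) ≡ fromℕ n
    fromℤ-+ⁿ 0             = refl
    fromℤ-+ⁿ 1             = sym (+-identityʳ 1#)
    fromℤ-+ⁿ (suc (suc n)) = refl

    fromℤ-neg : ∀ i → fromℤ (ℤ.- i) ≡ - fromℤ i
    fromℤ-neg (pos 0)             = sym Ringₚ.-0#≈0#
    fromℤ-neg (pos 1)             = cong -_ (+-identityʳ 1#)
    fromℤ-neg (pos (suc (suc n)))   = refl
    fromℤ-neg (negsuc n)          =
      trans (fromℤ-+ⁿ (suc n)) (sym (Ringₚ.-‿involutive _))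

    cancel-one : ∀ a b → (1# + a) + - (1# + b) ≡ a + - b
    cancel-one a b = begin
      (1# + a) + - (1# + b)       ≡⟨ cong₂ _+_ (+-comm 1# a) (sym (Ringₚ.-‿+-comm 1# b)) ⟩
      (a + 1#) + (- 1# + - b)     ≡⟨ +-assoc a 1# _ ⟩
      a + (1# + (- 1# + - b))     ≡⟨ cong (a +_) (sym (+-assoc 1# (- 1#) (- b))) ⟩
      a + ((1# + - 1#) + - b)     ≡⟨ cong (λ z → a + (z + - b)) (-‿inverseʳ 1#) ⟩
      a + (0# + - b)              ≡⟨ cong (a +_) (+-identityˡ _) ⟩
      a + - b                     ∎
      where open ≡-Reasoning

    fromℤ-⊖ : ∀ m n → fromℤ (m ⊖ n) ≡ fromℕ m + - fromℕ n
    fromℤ-⊖ m zero = begin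
      fromℤ (pos m)        ≡⟨ fromℤ-+ⁿ m ⟩
      fromℕ m            ≡⟨ sym (+-identityʳ _) ⟩
      fromℕ m + 0#       ≡⟨ cong (fromℕ m +_) (sym Ringₚ.-0#≈0#) ⟩
      fromℕ m + - 0#     ∎
      where open ≡-Reasoning
    fromℤ-⊖ zero    (suc n) = sym (+-identityˡ _)
    fromℤ-⊖ (suc m) (suc n) = begin
      fromℤ (suc m ⊖ suc n)            ≡⟨ cong fromℤ (ℤ.[1+m]⊖[1+n]≡m⊖n m n) ⟩
      fromℤ (m ⊖ n)                    ≡⟨ fromℤ-⊖ m n ⟩
      fromℕ m + - fromℕ n              ≡⟨ sym (cancel-one _ _) ⟩
      fromℕ (suc m) + - fromℕ (suc n)  ∎
      where open ≡-Reasoning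

    fromℤ-+ : ∀ i j → fromℤ (i ℤ.+ j) ≡ fromℤ i + fromℤ j
    fromℤ-+ (pos m) (pos n) = trans (fromℤ-+ⁿ (m ℕ.+ n)) (trans (fromℕ-+ m n)
      (sym (cong₂ _+_ (fromℤ-+ⁿ m) (fromℤ-+ⁿ n))))
    fromℤ-+ (pos m) (negsuc n) = trans (fromℤ-⊖ m (suc n))
      (cong (_+ - fromℕ (suc n)) (sym (fromℤ-+ⁿ m)))
    fromℤ-+ (negsuc m) (pos n) = trans (fromℤ-⊖ n (suc m)) (trans (+-comm _ _)
      (cong (- fromℕ (suc m) +_) (sym (fromℤ-+ⁿ n))))
    fromℤ-+ (negsuc m) (negsuc n) = begin
      - fromℕ (suc (suc (m ℕ.+ n)))         ≡⟨ cong (λ k → - fromℕ k) (sym (ℕ.+-suc (suc m) n)) ⟩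
      - fromℕ (suc m ℕ.+ suc n)             ≡⟨ cong -_ (fromℕ-+ (suc m) (suc n)) ⟩
      - (fromℕ (suc m) + fromℕ (suc n))     ≡⟨ sym (Ringₚ.-‿+-comm _ _) ⟩
      - fromℕ (suc m) + - fromℕ (suc n)     ∎
      where open ≡-Reasoning

    fromℤ-pos-* : ∀ m j → fromℤ (pos m ℤ.* j) ≡ fromℕ m * fromℤ j
    fromℤ-pos-* zero    j = sym (zeroˡ _)
    fromℤ-pos-* (suc m) j = begin
      fromℤ (pos (suc m) ℤ.* j)          ≡⟨ cong fromℤ (ℤ.suc-* (pos m) j) ⟩
      fromℤ (j ℤ.+ pos m ℤ.* j)        ≡⟨ fromℤ-+ j (pos m ℤ.* j) ⟩
      fromℤ j + fromℤ (pos m ℤ.* j)    ≡⟨ cong₂ _+_ (sym (*-identityˡ _)) (fromℤ-pos-* m j) ⟩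
      1# * fromℤ j + fromℕ m * fromℤ j ≡⟨ sym (distribʳ _ 1# _) ⟩
      (1# + fromℕ m) * fromℤ j       ∎
      where open ≡-Reasoning

    fromℤ-* : ∀ i j → fromℤ (i ℤ.* j) ≡ fromℤ i * fromℤ j
    fromℤ-* (pos m) j = trans (fromℤ-pos-* m j) (cong (_* fromℤ j) (sym (fromℤ-+ⁿ m)))
    fromℤ-* (negsuc m) j = begin
      fromℤ (negsuc m ℤ.* j)             ≡⟨ cong fromℤ (sym (ℤ.neg-distribˡ-* (pos (suc m)) j)) ⟩
      fromℤ (ℤ.- (pos (suc m) ℤ.* j))        ≡⟨ fromℤ-neg (pos (suc m) ℤ.* j) ⟩
      - fromℤ (pos (suc m) ℤ.* j)            ≡⟨ cong -_ (fromℤ-pos-* (suc m) j) ⟩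
      - (fromℕ (suc m) * fromℤ j)        ≡⟨ Ringₚ.-‿distribˡ-* _ _ ⟩
      - fromℕ (suc m) * fromℤ j          ∎
      where open ≡-Reasoning

    almostCommutativeRing : AlmostCommutativeRing _ _
    almostCommutativeRing = fromCommutativeRing commutativeRing

    ℤ-rawRing : RawRing _ _
    ℤ-rawRing = record
      { Carrier = ℤ ; _≈_ = _≡_ ; _+_ = ℤ._+_ ; _*_ = ℤ._*_ ; -_ = ℤ.-_
      ; 0# = pos 0 ; 1# = pos 1 }

    fromℤ-morphism : ℤ-rawRing -Raw-AlmostCommutative⟶ almostCommutativeRing
    fromℤ-morphism = record
      { ⟦_⟧ = fromℤ ; +-homo = fromℤ-+ ; *-homo = fromℤ-* ; -‿homo = fromℤ-neg
      ; 0-homo = refl ; 1-homo = refl }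

    fromℤ-≟ : ∀ i j → Maybe (fromℤ i ≡ fromℤ j)
    fromℤ-≟ i j with i ℤ.≟ j
    ... | yes i≡j = just (cong fromℤ i≡j)
    ... | no  _   = nothing

  module RingSolver = Algebra.Solver.Ring
    ℤ-rawRing almostCommutativeRing fromℤ-morphism fromℤ-≟
  open RingSolver using (solve; _:+_; _:*_; _:-_; :-_; _:=_; con; Polynomial)

  -- The numerals of the solver.
  κ : ∀ {m} → ℕ → Polynomial m
  κ n = con (pos n)

  x≤y⇒0≤y-x : ∀ {x y} → x ≤ y → 0# ≤ y - x
  x≤y⇒0≤y-x {x} {y} x≤y = subst₂ _≤_
    (solve 1 (λ x → :- x :+ x := κ 0) refl x)
    (solve 2 (λ x y → :- x :+ y := y :- x) refl x y)
    (+-monoʳ-≤ (- x) x≤y)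

  -- Most inequalities below are proved by writing the difference of their
  -- sides as an evidently nonnegative expression.
  ≤-by : ∀ {x y d} → 0# ≤ d → d ≡ y - x → x ≤ y
  ≤-by {x} {y} 0≤d refl = subst₂ _≤_
    (+-identityʳ x)
    (solve 2 (λ x y → x :+ (y :- x) := y) refl x y)
    (+-monoʳ-≤ x 0≤d)

  +-mono-≤ : ∀ {x y u v} → x ≤ y → u ≤ v → x + u ≤ y + v
  +-mono-≤ {x} {y} {u} {v} x≤y u≤v = ≤-trans (+-monoʳ-≤ x u≤v)
    (subst₂ _≤_ (+-comm v x) (+-comm v y) (+-monoʳ-≤ v x≤y))

  +-nonNegative : ∀ {x y} → 0# ≤ x → 0# ≤ y → 0# ≤ x + y
  +-nonNegative 0≤x 0≤y = subst (_≤ _) (+-identityˡ 0#) (+-mono-≤ 0≤x 0≤y)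

  *-monoʳ-≤ : ∀ {c x y} → 0# ≤ c → x ≤ y → c * x ≤ c * y
  *-monoʳ-≤ {c} {x} {y} 0≤c x≤y =
    ≤-by (*-nonNegative 0≤c (x≤y⇒0≤y-x x≤y))
      (solve 3 (λ c x y → c :* (y :- x) := c :* y :- c :* x) refl c x y)

  *-monoˡ-≤ : ∀ {c x y} → 0# ≤ c → x ≤ y → x * c ≤ y * c
  *-monoˡ-≤ {c} {x} {y} 0≤c x≤y =
    subst₂ _≤_ (*-comm c x) (*-comm c y) (*-monoʳ-≤ 0≤c x≤y)

  neg-mono-≤ : ∀ {x y} → x ≤ y → - y ≤ - x
  neg-mono-≤ {x} {y} x≤y = ≤-by (x≤y⇒0≤y-x x≤y)
    (solve 2 (λ x y → y :- x := :- x :- (:- y)) refl x y)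

  square-nonNegative : ∀ x → 0# ≤ x * x
  square-nonNegative x with ≤-total 0# x
  ... | inj₁ 0≤x = *-nonNegative 0≤x 0≤x
  ... | inj₂ x≤0 = subst (0# ≤_)
    (solve 1 (λ x → (κ 0 :- x) :* (κ 0 :- x) := x :* x) refl x)
    (*-nonNegative (x≤y⇒0≤y-x x≤0) (x≤y⇒0≤y-x x≤0))

  0≤1 : 0# ≤ 1#
  0≤1 = subst (0# ≤_) (*-identityˡ 1#) (square-nonNegative 1#)

  1≰0 : ¬ (1# ≤ 0#)
  1≰0 1≤0 = 0≢1 (≤-antisym 0≤1 1≤0)

  0<1 : 0# < 1#
  0<1 = 0≤1 , 0≢1

  0≤fromℕ : ∀ n → 0# ≤ fromℕ n
  0≤fromℕ zero    = ≤-refl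
  0≤fromℕ (suc n) = +-nonNegative 0≤1 (0≤fromℕ n)

  fromℕ-mono-≤ : ∀ {m n} → m ℕ.≤ n → fromℕ m ≤ fromℕ n
  fromℕ-mono-≤ {n = n} ℕ.z≤n = 0≤fromℕ n
  fromℕ-mono-≤ (ℕ.s≤s m≤n)  = +-monoʳ-≤ 1# (fromℕ-mono-≤ m≤n)

  1≤⇒0< : ∀ {x} → 1# ≤ x → 0# < x
  1≤⇒0< 1≤x = ≤-trans 0≤1 1≤x , λ { refl → 1≰0 1≤x }

  0<fromℕ : ∀ n → 0# < fromℕ (suc n)
  0<fromℕ n = 1≤⇒0< (subst (_≤ fromℕ (suc n)) (+-identityʳ 1#)
    (+-monoʳ-≤ 1# (0≤fromℕ n)))

  ≰⇒> : ∀ {x y} → ¬ (x ≤ y) → y < x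
  ≰⇒> {x} {y} x≰y with ≤-total x y
  ... | inj₁ x≤y = ⊥-elim (x≰y x≤y)
  ... | inj₂ y≤x = y≤x , λ { refl → x≰y ≤-refl }

  ≰⇒≥ : ∀ {x y} → ¬ (x ≤ y) → y ≤ x
  ≰⇒≥ x≰y = proj₁ (≰⇒> x≰y)

  <⇒≱ : ∀ {x y} → x < y → ¬ (y ≤ x)
  <⇒≱ (x≤y , x≢y) y≤x = x≢y (≤-antisym x≤y y≤x)

  <-≤-trans : ∀ {x y z} → x < y → y ≤ z → x < z
  <-≤-trans x<y y≤z = ≤-trans (proj₁ x<y) y≤z , λ { refl → <⇒≱ x<y y≤z }

  >⇒≢ : ∀ {x y} → x < y → y ≢ x
  >⇒≢ (_ , x≢y) y≡x = x≢y (sym y≡x)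

  *-inverseˡ : ∀ {x} → x ≢ 0# → x ⁻¹ * x ≡ 1#
  *-inverseˡ {x} x≢0 = trans (*-comm _ x) (*-inverse x x≢0)

  0≤x⁻¹ : ∀ {x} → 0# < x → 0# ≤ x ⁻¹
  0≤x⁻¹ {x} 0<x = subst (0# ≤_)
    (trans (solve 2 (λ x y → x :* (y :* y) := y :* (x :* y)) refl x (x ⁻¹))
    (trans (cong (x ⁻¹ *_) (*-inverse x (>⇒≢ 0<x))) (*-identityʳ _)))
    (*-nonNegative (proj₁ 0<x) (square-nonNegative (x ⁻¹)))

  *-cancelˡ-≡ : ∀ {c x y} → c ≢ 0# → c * x ≡ c * y → x ≡ y
  *-cancelˡ-≡ {c} {x} {y} c≢0 cx≡cy = trans (undo x) (trans (cong (c ⁻¹ *_) cx≡cy) (sym (undo y)))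
    where
    undo : ∀ z → z ≡ c ⁻¹ * (c * z)
    undo z = trans (sym (*-identityˡ z))
      (trans (cong (_* z) (sym (*-inverseˡ c≢0))) (*-assoc _ c z))

  *-cancelˡ-≤ : ∀ {c x y} → 0# < c → c * x ≤ c * y → x ≤ y
  *-cancelˡ-≤ {c} {x} {y} 0<c cx≤cy = subst₂ _≤_ (undo x) (undo y) (*-monoʳ-≤ (0≤x⁻¹ 0<c) cx≤cy)
    where
    undo : ∀ z → c ⁻¹ * (c * z) ≡ z
    undo z = trans (sym (*-assoc _ c z))
      (trans (cong (_* z) (*-inverseˡ (>⇒≢ 0<c))) (*-identityˡ z))

  *-nonZero : ∀ {x y} → x ≢ 0# → y ≢ 0# → x * y ≢ 0#
  *-nonZero {x} x≢0 y≢0 xy≡0 = y≢0 (*-cancelˡ-≡ x≢0 (trans xy≡0 (sym (zeroʳ x))))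

  *-positive : ∀ {x y} → 0# < x → 0# < y → 0# < x * y
  *-positive (0≤x , 0≢x) (0≤y , 0≢y) =
    *-nonNegative 0≤x 0≤y , λ 0≡xy → *-nonZero (≢-sym 0≢x) (≢-sym 0≢y) (sym 0≡xy)

  ⁻¹-unique : ∀ {x y} → x * y ≡ 1# → y ≡ x ⁻¹
  ⁻¹-unique {x} {y} xy≡1 = *-cancelˡ-≡ x≢0 (trans xy≡1 (sym (*-inverse x x≢0)))
    where
    x≢0 : x ≢ 0#
    x≢0 refl = 0≢1 (trans (sym (zeroˡ y)) xy≡1)

  0<x⁻¹ : ∀ {x} → 0# < x → 0# < x ⁻¹
  0<x⁻¹ {x} 0<x = 0≤x⁻¹ 0<x , λ 0≡x⁻¹ → 0≢1 (begin
    0#        ≡⟨ sym (zeroʳ x) ⟩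
    x * 0#    ≡⟨ cong (x *_) 0≡x⁻¹ ⟩
    x * x ⁻¹  ≡⟨ *-inverse x (>⇒≢ 0<x) ⟩
    1#        ∎)
    where open ≡-Reasoning

  ⁻¹-distrib-* : ∀ {x y} → x ≢ 0# → y ≢ 0# → (x * y) ⁻¹ ≡ x ⁻¹ * y ⁻¹
  ⁻¹-distrib-* {x} {y} x≢0 y≢0 = sym (⁻¹-unique (begin
    (x * y) * (x ⁻¹ * y ⁻¹)   ≡⟨ solve 4 (λ x y u v → (x :* y) :* (u :* v) := (x :* u) :* (y :* v)) refl x y (x ⁻¹) (y ⁻¹) ⟩
    (x * x ⁻¹) * (y * y ⁻¹)   ≡⟨ cong₂ _*_ (*-inverse x x≢0) (*-inverse y y≢0) ⟩
    1# * 1#                   ≡⟨ *-identityˡ 1# ⟩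
    1#                        ∎))
    where open ≡-Reasoning

  *-/-cancel : ∀ {c} x → c ≢ 0# → c * (x / c) ≡ x
  *-/-cancel {c} x c≢0 = begin
    c * (x * c ⁻¹)  ≡⟨ solve 3 (λ c x y → c :* (x :* y) := x :* (c :* y)) refl c x (c ⁻¹) ⟩
    x * (c * c ⁻¹)  ≡⟨ cong (x *_) (*-inverse c c≢0) ⟩
    x * 1#          ≡⟨ *-identityʳ x ⟩
    x               ∎
    where open ≡-Reasoning

  half : ℝ → ℝ
  half x = x / fromℕ 2

  half+half : ∀ x → half x + half x ≡ x
  half+half x = trans (solve 1 (λ y → y :+ y := κ 2 :* y) refl (half x))
    (*-/-cancel x (>⇒≢ (0<fromℕ 1)))

-- Binomial variables that deviate little from their mean

module Concentration (F : OrderedField) where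
  open OrderedField F
  open OrderedFieldProperties F
  open RingSolver using (solve; _:+_; _:*_; _:-_; :-_; _:=_)

  𝟙 : Bool → ℝ
  𝟙 b = if b then 1# else 0#

  0≤𝟙 : ∀ b → 0# ≤ 𝟙 b
  0≤𝟙 true  = 0≤1
  0≤𝟙 false = ≤-refl

  module Binomial (r : ℝ) (0≤r : 0# ≤ r) (r≤1 : r ≤ 1#) where

    0≤1-r : 0# ≤ 1# - r
    0≤1-r = x≤y⇒0≤y-x r≤1

    -- The expected value of f at the number of successes in t trials, by
    -- cases on the outcome of one of them.
    𝔹 : ℕ → (ℕ → ℝ) → ℝ
    𝔹 zero    f = f 0
    𝔹 (suc t) f = r * 𝔹 t (f ∘ suc) + (1# - r) * 𝔹 t f

    𝔹-cong : ∀ t {f g} → (∀ h → f h ≡ g h) → 𝔹 t f ≡ 𝔹 t g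
    𝔹-cong zero    f≗g = f≗g 0
    𝔹-cong (suc t) f≗g =
      cong₂ (λ a b → r * a + (1# - r) * b) (𝔹-cong t (f≗g ∘ suc)) (𝔹-cong t f≗g)

    𝔹-mono : ∀ t {f g} → (∀ h → f h ≤ g h) → 𝔹 t f ≤ 𝔹 t g
    𝔹-mono zero    f≤g = f≤g 0
    𝔹-mono (suc t) f≤g = +-mono-≤ (*-monoʳ-≤ 0≤r (𝔹-mono t (f≤g ∘ suc)))
                                  (*-monoʳ-≤ 0≤1-r (𝔹-mono t f≤g))

    𝔹-const : ∀ t c → 𝔹 t (λ _ → c) ≡ c
    𝔹-const zero    c = refl
    𝔹-const (suc t) c = trans
      (cong₂ (λ a b → r * a + (1# - r) * b) (𝔹-const t c) (𝔹-const t c))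
      (solve 2 (λ r c → r :* c :+ (κ 1 :- r) :* c := c) refl r c)

    𝔹-+ : ∀ t f g → 𝔹 t (λ h → f h + g h) ≡ 𝔹 t f + 𝔹 t g
    𝔹-+ zero    f g = refl
    𝔹-+ (suc t) f g = trans
      (cong₂ (λ a b → r * a + (1# - r) * b) (𝔹-+ t _ _) (𝔹-+ t f g))
      (solve 5 (λ r a b c d → r :* (a :+ b) :+ (κ 1 :- r) :* (c :+ d)
          := (r :* a :+ (κ 1 :- r) :* c) :+ (r :* b :+ (κ 1 :- r) :* d)) refl
        r (𝔹 t (f ∘ suc)) (𝔹 t (g ∘ suc)) (𝔹 t f) (𝔹 t g))

    𝔹-* : ∀ t c f → 𝔹 t (λ h → c * f h) ≡ c * 𝔹 t f
    𝔹-* zero    c f = refl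
    𝔹-* (suc t) c f = trans
      (cong₂ (λ a b → r * a + (1# - r) * b) (𝔹-* t c _) (𝔹-* t c f))
      (solve 4 (λ r c a b → r :* (c :* a) :+ (κ 1 :- r) :* (c :* b)
          := c :* (r :* a :+ (κ 1 :- r) :* b)) refl
        r c (𝔹 t (f ∘ suc)) (𝔹 t f))

    -- Detailed balance of the binomial weights: gaining a success from h has
    -- the same total rate as losing one from h + 1.
    stein-identity : ∀ t (f : ℕ → ℝ) →
      𝔹 t (λ h → (1# - r) * fromℕ h * f h) ≡
      𝔹 t (λ h → r * (fromℕ t - fromℕ h) * f (suc h))
    stein-identity zero f = solve 3 (λ r a b →
      (κ 1 :- r) :* κ 0 :* a := r :* (κ 0 :- κ 0) :* b) refl r (f 0) (f 1)
    stein-identity (suc t) f = begin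
      r * 𝔹 t (λ h → (1# - r) * fromℕ (suc h) * f (suc h)) +
        (1# - r) * 𝔹 t (λ h → (1# - r) * fromℕ h * f h)
        ≡⟨ cong₂ (λ a b → r * a + (1# - r) * b) losses (stein-identity t f) ⟩
      r * (U′ + (1# - r) * V) + (1# - r) * U
        ≡⟨ solve 4 (λ r x v u →
             r :* (x :+ (κ 1 :- r) :* v) :+ (κ 1 :- r) :* u
             := r :* x :+ (κ 1 :- r) :* (r :* v :+ u)) refl r U′ V U ⟩
      r * U′ + (1# - r) * (r * V + U)
        ≡⟨ cong₂ (λ a b → r * a + (1# - r) * b) (sym gains₁) (sym gains₂) ⟩
      r * 𝔹 t (λ h → r * (fromℕ (suc t) - fromℕ (suc h)) * f (suc (suc h))) +
        (1# - r) * 𝔹 t (λ h → r * (fromℕ (suc t) - fromℕ h) * f (suc h)) ∎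
      where
      open ≡-Reasoning
      U U′ V : ℝ
      U  = 𝔹 t (λ h → r * (fromℕ t - fromℕ h) * f (suc h))
      U′ = 𝔹 t (λ h → r * (fromℕ t - fromℕ h) * f (suc (suc h)))
      V  = 𝔹 t (f ∘ suc)
      losses : 𝔹 t (λ h → (1# - r) * fromℕ (suc h) * f (suc h)) ≡ U′ + (1# - r) * V
      losses = trans (𝔹-cong t λ h → solve 3 (λ r h y →
            (κ 1 :- r) :* (κ 1 :+ h) :* y
            := (κ 1 :- r) :* h :* y :+ (κ 1 :- r) :* y) refl r (fromℕ h) (f (suc h)))
        (trans (𝔹-+ t _ _)
          (cong₂ _+_ (stein-identity t (f ∘ suc)) (𝔹-* t (1# - r) (f ∘ suc))))
      gains₁ : 𝔹 t (λ h → r * (fromℕ (suc t) - fromℕ (suc h)) * f (suc (suc h))) ≡ U′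
      gains₁ = 𝔹-cong t λ h → solve 4 (λ r t h y →
        r :* ((κ 1 :+ t) :- (κ 1 :+ h)) :* y := r :* (t :- h) :* y) refl
        r (fromℕ t) (fromℕ h) (f (suc (suc h)))
      gains₂ : 𝔹 t (λ h → r * (fromℕ (suc t) - fromℕ h) * f (suc h)) ≡ r * V + U
      gains₂ = trans (𝔹-cong t λ h → solve 4 (λ r t h y →
          r :* ((κ 1 :+ t) :- h) :* y := r :* y :+ r :* (t :- h) :* y) refl
          r (fromℕ t) (fromℕ h) (f (suc h)))
        (trans (𝔹-+ t _ _) (cong (_+ U) (𝔹-* t r (f ∘ suc))))

    -- By the identity above the terms in f have expected value 0.
    stein-bound : ∀ t (W : ℕ → Bool) (f : ℕ → ℝ) c d →
      (∀ h → c ≤ d * 𝟙 (W h) + (r * (fromℕ t - fromℕ h) * f (suc h)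
                                - (1# - r) * fromℕ h * f h)) →
      c ≤ d * 𝔹 t (𝟙 ∘ W)
    stein-bound t W f c d pointwise = begin
      c                                       ≡⟨ sym (𝔹-const t c) ⟩
      𝔹 t (λ _ → c)                           ≤⟨ 𝔹-mono t pointwise ⟩
      𝔹 t (λ h → d * 𝟙 (W h) + (u h - v h))   ≡⟨ 𝔹-+ t _ _ ⟩
      𝔹 t (λ h → d * 𝟙 (W h)) + 𝔹 t (λ h → u h - v h)
        ≡⟨ cong₂ _+_ (𝔹-* t d (𝟙 ∘ W)) cancel ⟩
      d * 𝔹 t (𝟙 ∘ W) + 0#                  ≡⟨ +-identityʳ _ ⟩
      d * 𝔹 t (𝟙 ∘ W)                       ∎
      where
      open ≤-Reasoning
      u v : ℕ → ℝ
      u h = r * (fromℕ t - fromℕ h) * f (suc h)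
      v h = (1# - r) * fromℕ h * f h
      cancel : 𝔹 t (λ h → u h - v h) ≡ 0#
      cancel = trans
        (𝔹-cong t λ h → solve 2 (λ u v → u :- v := u :+ (κ 0 :- κ 1) :* v) refl (u h) (v h))
        (trans (𝔹-+ t u _) (trans (cong₂ _+_ (sym (stein-identity t f)) (𝔹-* t (0# - 1#) v))
          (solve 1 (λ v → v :+ (κ 0 :- κ 1) :* v := κ 0) refl (𝔹 t v))))

    𝔹-witness : ∀ t (W : ℕ → Bool) →
      (∃ λ h → W h ≡ true) ⊎ 𝔹 t (𝟙 ∘ W) ≡ 0#
    𝔹-witness zero W with W 0 in eq
    ... | true  = inj₁ (0 , eq)
    ... | false = inj₂ refl
    𝔹-witness (suc t) W with 𝔹-witness t (W ∘ suc) | 𝔹-witness t W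
    ... | inj₁ (h , Wh) | _             = inj₁ (suc h , Wh)
    ... | inj₂ _        | inj₁ witness  = inj₁ witness
    ... | inj₂ none     | inj₂ none′    = inj₂ (trans
      (cong₂ (λ a b → r * a + (1# - r) * b) none none′)
      (solve 1 (λ r → r :* κ 0 :+ (κ 1 :- r) :* κ 0 := κ 0) refl r))

    module Window (t : ℕ) (e : ℝ) (0≤e : 0# ≤ e) (e≤¼ : fromℕ 4 * e ≤ 1#)
      (W : ℕ → Bool)
      (inside  : ∀ h → W h ≡ true →
        fromℕ t * r - fromℕ h ≤ fromℕ t * e × fromℕ h - fromℕ t * r ≤ fromℕ t * e)
      (outside : ∀ h → W h ≡ false →
        fromℕ t * e ≤ fromℕ t * r - fromℕ h ⊎ fromℕ t * e ≤ fromℕ h - fromℕ t * r)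
      where

      -- W is the event that h / t is within e of r. Its complement may be taken
      -- closed because the boundary is harmless in every estimate.

      τ w S : ℝ
      τ = fromℕ t
      w = τ * e
      S = 𝔹 t (𝟙 ∘ W)

      0≤τ : 0# ≤ τ
      0≤τ = 0≤fromℕ t

      0≤w : 0# ≤ w
      0≤w = *-nonNegative 0≤τ 0≤e

      w≤τ¼ : fromℕ 4 * w ≤ τ
      w≤τ¼ = ≤-by (*-nonNegative 0≤τ (x≤y⇒0≤y-x e≤¼))
        (solve 2 (λ τ e → τ :* (κ 1 :- κ 4 :* e) := τ :- κ 4 :* (τ :* e)) refl τ e)

      -- Here f is e up to some element h₀ of the window and - e beyond it. That
      -- element exists unless the window has probability 0.
      module Narrow (w≤2 : w ≤ fromℕ 2) (h₀ : ℕ) (Wh₀ : W h₀ ≡ true) where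

        f : ℕ → ℝ
        f h with h ℕ.≤? h₀
        ... | yes _ = e
        ... | no  _ = - e

        f-below : ∀ {h} → h ℕ.≤ h₀ → f h ≡ e
        f-below {h} h≤h₀ with h ℕ.≤? h₀
        ... | yes _    = refl
        ... | no h≰h₀  = ⊥-elim (h≰h₀ h≤h₀)

        f-above : ∀ {h} → h₀ ℕ.< h → f h ≡ - e
        f-above {h} h₀<h with h ℕ.≤? h₀
        ... | yes h≤h₀ = ⊥-elim (ℕ.<⇒≱ h₀<h h≤h₀)
        ... | no  _    = refl

        ew≤½ : fromℕ 4 * (e * w) ≤ fromℕ 2
        ew≤½ = ≤-trans (≤-by (*-nonNegative 0≤w (x≤y⇒0≤y-x e≤¼))
          (solve 2 (λ w e → w :* (κ 1 :- κ 4 :* e) := w :- κ 4 :* (e :* w)) refl w e)) w≤2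

        ew≤1 : fromℕ 2 * (e * w) ≤ fromℕ 2
        ew≤1 = ≤-trans (≤-by (*-nonNegative (0≤fromℕ 2) (*-nonNegative 0≤e 0≤w))
          (solve 2 (λ e w → κ 2 :* (e :* w) := κ 4 :* (e :* w) :- κ 2 :* (e :* w)) refl e w)) ew≤½

        -- Off the switching point, f contributes e times the signed distance
        -- to the mean, which is at least w except within the window.
        off-switch : ∀ h b → e * w ≤ e * b ⊎ (W h ≡ true × e * - w ≤ e * b) →
          e * w ≤ fromℕ 2 * 𝟙 (W h) + e * b
        off-switch h b (inj₁ far) = ≤-trans far
          (≤-by (*-nonNegative (0≤fromℕ 2) (0≤𝟙 (W h)))
            (solve 2 (λ u v → u := u :+ v :- v) refl (fromℕ 2 * 𝟙 (W h)) (e * b)))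
        off-switch h b (inj₂ (Wh , near)) rewrite Wh = ≤-by
          (+-nonNegative (x≤y⇒0≤y-x ew≤1) (x≤y⇒0≤y-x near))
          (solve 3 (λ e w b → (κ 2 :- κ 2 :* (e :* w)) :+ (e :* b :- e :* (:- w))
            := (κ 2 :* κ 1 :+ e :* b) :- e :* w) refl e w b)

        -- Left of h₀ only the left side of the window can be missed, and
        -- symmetrically on the right.
        not-far-above : ∀ {h} → h ℕ.< h₀ → ¬ (w ≤ fromℕ h - τ * r)
        not-far-above {h} h<h₀ far = 1≰0 (≤-by
          (+-nonNegative (x≤y⇒0≤y-x far)
            (+-nonNegative (x≤y⇒0≤y-x (proj₂ (inside h₀ Wh₀)))
                           (x≤y⇒0≤y-x (fromℕ-mono-≤ h<h₀))))
          (solve 4 (λ h m w k → (h :- m :- w) :+ ((w :- (k :- m)) :+ (k :- (κ 1 :+ h)))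
            := κ 0 :- κ 1) refl (fromℕ h) (τ * r) w (fromℕ h₀)))

        not-far-below : ∀ {h} → h₀ ℕ.< h → ¬ (w ≤ τ * r - fromℕ h)
        not-far-below {h} h₀<h far = 1≰0 (≤-by
          (+-nonNegative (x≤y⇒0≤y-x far)
            (+-nonNegative (x≤y⇒0≤y-x (proj₁ (inside h₀ Wh₀)))
                           (x≤y⇒0≤y-x (fromℕ-mono-≤ h₀<h))))
          (solve 4 (λ h m w k → (m :- h :- w) :+ ((w :- (m :- k)) :+ (h :- (κ 1 :+ k)))
            := κ 0 :- κ 1) refl (fromℕ h) (τ * r) w (fromℕ h₀)))

        flip : ∀ {a b} → a ≤ b → e * - b ≤ e * - a
        flip a≤b = *-monoʳ-≤ 0≤e (neg-mono-≤ a≤b)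

        at-below : ∀ {h} → h ℕ.< h₀ → e * w ≤ e * (τ * r - fromℕ h) ⊎
                (W h ≡ true × e * - w ≤ e * (τ * r - fromℕ h))
        at-below {h} h<h₀ with W h in eq
        ... | true  = inj₂ (refl , subst (e * - w ≤_)
          (cong (e *_) (solve 2 (λ h m → :- (h :- m) := m :- h) refl (fromℕ h) (τ * r)))
          (flip (proj₂ (inside h eq))))
        ... | false with outside h eq
        ...   | inj₁ far = inj₁ (*-monoʳ-≤ 0≤e far)
        ...   | inj₂ far = ⊥-elim (not-far-above h<h₀ far)

        at-above : ∀ {h} → h₀ ℕ.< h → e * w ≤ e * (fromℕ h - τ * r) ⊎
                (W h ≡ true × e * - w ≤ e * (fromℕ h - τ * r))
        at-above {h} h₀<h with W h in eq
        ... | true  = inj₂ (refl , subst (e * - w ≤_)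
          (cong (e *_) (solve 2 (λ h m → :- (m :- h) := h :- m) refl (fromℕ h) (τ * r)))
          (flip (proj₁ (inside h eq))))
        ... | false with outside h eq
        ...   | inj₂ far = inj₁ (*-monoʳ-≤ 0≤e far)
        ...   | inj₁ far = ⊥-elim (not-far-below h₀<h far)

        -- The only step of f costs e (r (t - h₀) + (1 - r) h₀), which is at most
        -- e (t / 2 + w) because h₀ is within w of t r.
        at-switch : e * w ≤ fromℕ 2 * 1# + (r * (τ - fromℕ h₀) * - e - (1# - r) * fromℕ h₀ * e)
        at-switch = *-cancelˡ-≤ (0<fromℕ 1) (≤-by
          (+-nonNegative (x≤y⇒0≤y-x (+-mono-≤ ew≤½ (subst (_≤ fromℕ 2) (*-comm τ e) w≤2)))
            (*-nonNegative 0≤e (+-nonNegative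
              (*-nonNegative 0≤τ (square-nonNegative (1# - fromℕ 2 * r)))
              (+-nonNegative
                (*-nonNegative (*-nonNegative (0≤fromℕ 2) 0≤1-r) (x≤y⇒0≤y-x (proj₂ (inside h₀ Wh₀))))
                (*-nonNegative (*-nonNegative (0≤fromℕ 2) 0≤r) (x≤y⇒0≤y-x (proj₁ (inside h₀ Wh₀))))))))
          (solve 4 (λ e τ r h →
            ((κ 2 :+ κ 2) :- (κ 4 :* (e :* (τ :* e)) :+ e :* τ)) :+
            e :* (τ :* ((κ 1 :- κ 2 :* r) :* (κ 1 :- κ 2 :* r)) :+
              (κ 2 :* (κ 1 :- r) :* (τ :* e :- (h :- τ :* r)) :+
               κ 2 :* r :* (τ :* e :- (τ :* r :- h))))
            := κ 2 :* (κ 2 :* κ 1 :+ (r :* (τ :- h) :* (:- e) :- (κ 1 :- r) :* h :* e))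
               :- κ 2 :* (e :* (τ :* e))) refl e τ r (fromℕ h₀)))

        narrow : τ * e * e ≤ fromℕ 2 * S
        narrow = subst (_≤ fromℕ 2 * S) (solve 2 (λ τ e → e :* (τ :* e) := τ :* e :* e) refl τ e)
          (stein-bound t W f (e * w) (fromℕ 2) pointwise)
          where
          pointwise : ∀ h → e * w ≤ fromℕ 2 * 𝟙 (W h) +
            (r * (τ - fromℕ h) * f (suc h) - (1# - r) * fromℕ h * f h)
          pointwise h with ℕ.<-cmp h h₀
          ... | tri< h<h₀ _ _ rewrite f-below (ℕ.<⇒≤ h<h₀) | f-below h<h₀ =
            subst (λ z → e * w ≤ fromℕ 2 * 𝟙 (W h) + z)
              (solve 4 (λ e τ r h → e :* (τ :* r :- h)
                := r :* (τ :- h) :* e :- (κ 1 :- r) :* h :* e) refl e τ r (fromℕ h))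
              (off-switch h _ (at-below h<h₀))
          ... | tri≈ _ refl _ rewrite f-below (ℕ.≤-refl {h}) | f-above (ℕ.≤-refl {suc h}) | Wh₀ =
            at-switch
          ... | tri> _ _ h₀<h rewrite f-above h₀<h | f-above (ℕ.<-trans h₀<h (ℕ.n<1+n h)) =
            subst (λ z → e * w ≤ fromℕ 2 * 𝟙 (W h) + z)
              (solve 4 (λ e τ r h → e :* (h :- τ :* r)
                := r :* (τ :- h) :* (:- e) :- (κ 1 :- r) :* h :* (:- e)) refl e τ r (fromℕ h))
              (off-switch h _ (at-above h₀<h))

      -- Here f decreases with constant slope across the window, so that each of
      -- its steps is small: on the window f costs at most τ in total, while off
      -- the window it gains β times the distance from the mean.
      module Wide (2≤w : fromℕ 2 ≤ w) where

        -- The levels of f are ± β for the largest β at which f, as a function of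
        -- y below, is constant on both sides of the window.
        β : ℝ
        β = fromℕ 2 * w - 1#

        3≤β : fromℕ 3 ≤ β
        3≤β = ≤-by (*-nonNegative (0≤fromℕ 2) (x≤y⇒0≤y-x 2≤w))
          (solve 1 (λ w → κ 2 :* (w :- κ 2) := κ 2 :* w :- κ 1 :- κ 3) refl w)

        1≤β : 1# ≤ β
        1≤β = ≤-trans (≤-by (0≤fromℕ 2) (solve 0 (κ 2 := κ 3 :- κ 1) refl)) 3≤β

        0≤β : 0# ≤ β
        0≤β = ≤-trans 0≤1 1≤β

        -β≤β : - β ≤ β
        -β≤β = ≤-by (+-nonNegative 0≤β 0≤β) (solve 1 (λ β → β :+ β := β :- (:- β)) refl β)

        clamp : ℝ → ℝ
        clamp y with y ≤? - β | β ≤? y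
        ... | yes _ | _     = - β
        ... | no  _ | yes _ = β
        ... | no  _ | no  _ = y

        clamp-low : ∀ {y} → y ≤ - β → clamp y ≡ - β
        clamp-low {y} y≤-β with y ≤? - β | β ≤? y
        ... | yes _   | _ = refl
        ... | no y≰-β | _ = ⊥-elim (y≰-β y≤-β)

        clamp-high : ∀ {y} → β ≤ y → clamp y ≡ β
        clamp-high {y} β≤y with y ≤? - β | β ≤? y
        ... | yes y≤-β | _       = ≤-antisym -β≤β (≤-trans β≤y y≤-β)
        ... | no _     | yes _   = refl
        ... | no _     | no β≰y  = ⊥-elim (β≰y β≤y)

        clamp-bounds : ∀ y → (- β ≤ clamp y) × (clamp y ≤ β)
        clamp-bounds y with y ≤? - β | β ≤? y
        ... | yes _   | _      = ≤-refl , -β≤β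
        ... | no _    | yes _  = -β≤β , ≤-refl
        ... | no y≰-β | no β≰y = ≰⇒≥ y≰-β , ≰⇒≥ β≰y

        clamp-drop : ∀ y → clamp (y - fromℕ 2) ≤ clamp y × clamp y ≤ clamp (y - fromℕ 2) + fromℕ 2
        clamp-drop y = mono , lip
          where
          y-2≤y : y - fromℕ 2 ≤ y
          y-2≤y = ≤-by (0≤fromℕ 2) (solve 1 (λ y → κ 2 := y :- (y :- κ 2)) refl y)
          x≤x+2 : ∀ x → x ≤ x + fromℕ 2
          x≤x+2 x = ≤-by (0≤fromℕ 2) (solve 1 (λ x → κ 2 := x :+ κ 2 :- x) refl x)
          y≤y-2+2 : y ≤ y - fromℕ 2 + fromℕ 2
          y≤y-2+2 = ≤-reflexive (solve 1 (λ y → y := y :- κ 2 :+ κ 2) refl y)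
          mono : clamp (y - fromℕ 2) ≤ clamp y
          mono with y - fromℕ 2 ≤? - β | β ≤? y - fromℕ 2
          ... | yes _   | _         = proj₁ (clamp-bounds y)
          ... | no _    | yes β≤y-2 = ≤-reflexive (sym (clamp-high (≤-trans β≤y-2 y-2≤y)))
          ... | no y-2≰-β | no β≰y-2 with y ≤? - β | β ≤? y
          ...   | yes y≤-β | _     = ⊥-elim (y-2≰-β (≤-trans y-2≤y y≤-β))
          ...   | no _     | yes _ = ≰⇒≥ β≰y-2
          ...   | no _     | no _  = y-2≤y
          lip : clamp y ≤ clamp (y - fromℕ 2) + fromℕ 2
          lip with y ≤? - β | β ≤? y
          ... | yes _   | _       = ≤-trans (proj₁ (clamp-bounds (y - fromℕ 2))) (x≤x+2 _)
          ... | no y≰-β | yes β≤y with y - fromℕ 2 ≤? - β | β ≤? y - fromℕ 2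
          ...   | yes y-2≤-β | _     = ≤-trans β≤y (≤-trans y≤y-2+2 (+-mono-≤ y-2≤-β ≤-refl))
          ...   | no _       | yes _ = x≤x+2 β
          ...   | no _       | no _  = ≤-trans β≤y y≤y-2+2
          lip | no y≰-β | no β≰y with y - fromℕ 2 ≤? - β | β ≤? y - fromℕ 2
          ...   | yes y-2≤-β | _     = ≤-trans y≤y-2+2 (+-mono-≤ y-2≤-β ≤-refl)
          ...   | no _       | yes _ = ≤-trans (≰⇒≥ β≰y) (x≤x+2 β)
          ...   | no _       | no _  = y≤y-2+2

        -- The drift of f towards the mean has the right sign except between the
        -- mean and the centre of f, where it is negligible.
        clamp-sign : ∀ y → 0# ≤ fromℕ 4 * (clamp y * (y - 1#)) + 1#
        clamp-sign y with y ≤? - β | β ≤? y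
        ... | yes y≤-β | _ = +-nonNegative (*-nonNegative (0≤fromℕ 4) (subst (0# ≤_)
                (solve 2 (λ β y → β :* (κ 1 :- y) := (:- β) :* (y :- κ 1)) refl β y)
                (*-nonNegative 0≤β (x≤y⇒0≤y-x (≤-trans y≤-β (≤-trans -β≤0 0≤1)))))) 0≤1
          where
          -β≤0 : - β ≤ 0#
          -β≤0 = ≤-by 0≤β (solve 1 (λ β → β := κ 0 :- (:- β)) refl β)
        ... | no _ | yes β≤y = +-nonNegative (*-nonNegative (0≤fromℕ 4)
                (*-nonNegative 0≤β (x≤y⇒0≤y-x (≤-trans 1≤β β≤y)))) 0≤1
        ... | no _ | no _ = subst (0# ≤_)
                (solve 1 (λ y → (κ 2 :* y :- κ 1) :* (κ 2 :* y :- κ 1)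
                  := κ 4 :* (y :* (y :- κ 1)) :+ κ 1) refl y)
                (square-nonNegative (fromℕ 2 * y - 1#))

        -- Twice the distance below t r + 1/2. The shift by half a step lets f be
        -- flat at both h and h + 1 as soon as h is outside the window on either
        -- side.
        y : ℕ → ℝ
        y h = fromℕ 2 * (τ * r - fromℕ h) + 1#

        y-suc : ∀ h → y (suc h) ≡ y h - fromℕ 2
        y-suc h = solve 2 (λ m h → κ 2 :* (m :- (κ 1 :+ h)) :+ κ 1
          := κ 2 :* (m :- h) :+ κ 1 :- κ 2) refl (τ * r) (fromℕ h)

        8≤τ : fromℕ 8 ≤ τ
        8≤τ = ≤-trans (≤-by (*-nonNegative (0≤fromℕ 4) (x≤y⇒0≤y-x 2≤w))
          (solve 1 (λ w → κ 4 :* (w :- κ 2) := κ 4 :* w :- κ 8) refl w)) w≤τ¼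

        wide : β * w ≤ (β * w + τ) * S
        wide = stein-bound t W (clamp ∘ y) (β * w) (β * w + τ) pointwise
          where
          pointwise : ∀ h → β * w ≤ (β * w + τ) * 𝟙 (W h) +
            (r * (τ - fromℕ h) * clamp (y (suc h)) - (1# - r) * fromℕ h * clamp (y h))
          pointwise h with W h in eq
          ... | false with outside h eq
          ...   | inj₁ far = subst₂
            (λ a b → β * w ≤ (β * w + τ) * 0# + (r * (τ - fromℕ h) * a - (1# - r) * fromℕ h * b))
            (sym (clamp-high high)) (sym (clamp-high high′)) (≤-by
            (*-nonNegative 0≤β (x≤y⇒0≤y-x far))
            (solve 6 (λ β w τ r h k → β :* (τ :* r :- h :- w) :=
              (k :* κ 0 :+ (r :* (τ :- h) :* β :- (κ 1 :- r) :* h :* β)) :- β :* w) refl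
              β w τ r (fromℕ h) (β * w + τ)))
            where
            high′ : β ≤ y h
            high′ = ≤-by (+-nonNegative (*-nonNegative (0≤fromℕ 2) (x≤y⇒0≤y-x far)) (0≤fromℕ 2))
              (solve 3 (λ w m h → κ 2 :* (m :- h :- w) :+ κ 2 :=
                (κ 2 :* (m :- h) :+ κ 1) :- (κ 2 :* w :- κ 1)) refl w (τ * r) (fromℕ h))
            high : β ≤ y (suc h)
            high = ≤-by (*-nonNegative (0≤fromℕ 2) (x≤y⇒0≤y-x far))
              (solve 3 (λ w m h → κ 2 :* (m :- h :- w) :=
                (κ 2 :* (m :- (κ 1 :+ h)) :+ κ 1) :- (κ 2 :* w :- κ 1)) refl w (τ * r) (fromℕ h))
          ...   | inj₂ far = subst₂
            (λ a b → β * w ≤ (β * w + τ) * 0# + (r * (τ - fromℕ h) * a - (1# - r) * fromℕ h * b))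
            (sym (clamp-low low)) (sym (clamp-low low′)) (≤-by
            (*-nonNegative 0≤β (x≤y⇒0≤y-x far))
            (solve 6 (λ β w τ r h k → β :* (h :- τ :* r :- w) :=
              (k :* κ 0 :+ (r :* (τ :- h) :* (:- β) :- (κ 1 :- r) :* h :* (:- β))) :- β :* w) refl
              β w τ r (fromℕ h) (β * w + τ)))
            where
            low′ : y h ≤ - β
            low′ = ≤-by (*-nonNegative (0≤fromℕ 2) (x≤y⇒0≤y-x far))
              (solve 3 (λ w m h → κ 2 :* (h :- m :- w) :=
                (:- (κ 2 :* w :- κ 1)) :- (κ 2 :* (m :- h) :+ κ 1)) refl w (τ * r) (fromℕ h))
            low : y (suc h) ≤ - β
            low = ≤-by (+-nonNegative (*-nonNegative (0≤fromℕ 2) (x≤y⇒0≤y-x far)) (0≤fromℕ 2))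
              (solve 3 (λ w m h → κ 2 :* (h :- m :- w) :+ κ 2 :=
                (:- (κ 2 :* w :- κ 1)) :- (κ 2 :* (m :- (κ 1 :+ h)) :+ κ 1)) refl w (τ * r) (fromℕ h))
          pointwise h | true = *-cancelˡ-≤ (0<fromℕ 63) (≤-by
            (+-nonNegative
              (*-nonNegative (0≤fromℕ 8) (clamp-sign (y h)))
              (+-nonNegative
                (*-nonNegative drop≥0 rate)
                (+-nonNegative
                  (*-nonNegative (*-nonNegative (0≤fromℕ 25) 0≤τ) drop≤2)
                  (x≤y⇒0≤y-x 8≤14τ))))
            (solve 7 (λ g g′ τ r h β w →
              κ 8 :* (κ 4 :* (g :* (κ 2 :* (τ :* r :- h) :+ κ 1 :- κ 1)) :+ κ 1) :+
              ((g :- g′) :* (κ 25 :* τ :- κ 64 :* (r :* (τ :- h))) :+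
              (κ 25 :* τ :* (g′ :+ κ 2 :- g) :+ (κ 14 :* τ :- κ 8)))
              := κ 64 :* ((β :* w :+ τ) :* κ 1 :+ (r :* (τ :- h) :* g′ :- (κ 1 :- r) :* h :* g))
                 :- κ 64 :* (β :* w)) refl
              (clamp (y h)) (clamp (y (suc h))) τ r (fromℕ h) β w))
            where
            drop≥0 : 0# ≤ clamp (y h) - clamp (y (suc h))
            drop≥0 rewrite y-suc h = x≤y⇒0≤y-x (proj₁ (clamp-drop (y h)))
            drop≤2 : 0# ≤ clamp (y (suc h)) + fromℕ 2 - clamp (y h)
            drop≤2 rewrite y-suc h = x≤y⇒0≤y-x (proj₂ (clamp-drop (y h)))
            8≤14τ : fromℕ 8 ≤ fromℕ 14 * τ
            8≤14τ = ≤-trans 8≤τ (≤-by (*-nonNegative (0≤fromℕ 13) 0≤τ)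
              (solve 1 (λ τ → κ 13 :* τ := κ 14 :* τ :- τ) refl τ))
            -- r (t - h) ≤ t r (1 - r + e) ≤ t r (5/4 - r) ≤ 25 t / 64.
            rate : 0# ≤ fromℕ 25 * τ - fromℕ 64 * (r * (τ - fromℕ h))
            rate = subst (0# ≤_)
              (solve 4 (λ τ w r h →
                τ :* ((κ 8 :* r :- κ 5) :* (κ 8 :* r :- κ 5)) :+
                (κ 16 :* r :* (τ :- κ 4 :* w) :+ κ 64 :* r :* (w :- (τ :* r :- h)))
                := κ 25 :* τ :- κ 64 :* (r :* (τ :- h))) refl τ w r (fromℕ h))
              (+-nonNegative (*-nonNegative 0≤τ (square-nonNegative (fromℕ 8 * r - fromℕ 5)))
                (+-nonNegative
                  (*-nonNegative (*-nonNegative (0≤fromℕ 16) 0≤r) (x≤y⇒0≤y-x w≤τ¼))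
                  (*-nonNegative (*-nonNegative (0≤fromℕ 64) 0≤r) (x≤y⇒0≤y-x (proj₁ (inside h eq))))))

-- The ceiling

module Ceiling (𝓡 : RealNumbers) where
  open RealNumbers 𝓡
  open OrderedFieldProperties orderedField
  open RingSolver using (solve; _:+_; _:*_; _:-_; :-_; _:=_)

  -- The equations of the linear search that defines ⌈_⌉.
  record IsSearch (x : ℝ) (search : ℕ → ℕ → ℕ) : Set where
    field
      search-zero : ∀ m → search zero m ≡ m
      search-suc  : ∀ f m →
        search (suc f) m ≡ (if ⌊ x ≤? fromℕ m ⌋ then m else search f (suc m))

  search-upper : ∀ {x search} → IsSearch x search →
    ∀ f m → x ≤ fromℕ (f ℕ.+ m) → x ≤ fromℕ (search f m)
  search-upper s zero    m x≤ rewrite IsSearch.search-zero s m = x≤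
  search-upper {x} s (suc f) m x≤ rewrite IsSearch.search-suc s f m with x ≤? fromℕ m
  ... | yes x≤m = x≤m
  ... | no  _   = search-upper s f (suc m) (subst (λ n → x ≤ fromℕ n) (sym (ℕ.+-suc f m)) x≤)

  search-lower : ∀ {x search} → IsSearch x search →
    ∀ f m → fromℕ m ≤ x + 1# → fromℕ (search f m) ≤ x + 1#
  search-lower s zero    m m≤ rewrite IsSearch.search-zero s m = m≤
  search-lower {x} s (suc f) m m≤ rewrite IsSearch.search-suc s f m with x ≤? fromℕ m
  ... | yes _   = m≤
  ... | no  x≰m = search-lower s f (suc m)
    (≤-by (x≤y⇒0≤y-x (≰⇒≥ x≰m)) (solve 2 (λ x m → x :- m := x :+ κ 1 :- (κ 1 :+ m)) refl x (fromℕ m)))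

  -- The search is local to the definition of ⌈_⌉, and can only be obtained
  -- by unification. For this its arguments are made variables.
  ⌈⌉-search : ∀ x → ∃ λ search → IsSearch x search × ⌈ x ⌉ ≡ search (proj₁ (archimedean x)) 0
  ⌈⌉-search x =
    search , record { search-zero = λ _ → refl ; search-suc = λ _ _ → refl } , found
    where
    search : ℕ → ℕ → ℕ
    search = _
    found : ⌈ x ⌉ ≡ search (proj₁ (archimedean x)) 0
    found with proj₁ (archimedean x) | 0
    ... | fuel | start = refl

  ≤⌈⌉ : ∀ x → x ≤ fromℕ ⌈ x ⌉
  ≤⌈⌉ x with ⌈⌉-search x
  ... | search , s , found = subst (λ c → x ≤ fromℕ c) (sym found)
    (search-upper s (proj₁ (archimedean x)) 0
      (subst (λ n → x ≤ fromℕ n) (sym (ℕ.+-identityʳ (proj₁ (archimedean x)))) (proj₂ (archimedean x))))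

  ⌈⌉≤ : ∀ {x} → 0# ≤ x + 1# → fromℕ ⌈ x ⌉ ≤ x + 1#
  ⌈⌉≤ {x} 0≤x+1 with ⌈⌉-search x
  ... | search , s , found = subst (λ c → fromℕ c ≤ x + 1#) (sym found)
    (search-lower s (proj₁ (archimedean x)) 0 0≤x+1)

-- The exponential function and Chernoff's bound

module ExponentialTail (𝓡 : RealNumbers) where
  open RealNumbers 𝓡
  open OrderedFieldProperties orderedField
  open RingSolver using (solve; _:+_; _:*_; _:-_; :-_; _:=_)
  open Concentration orderedField

  0≤exp : ∀ x → 0# ≤ exp x
  0≤exp x = subst (0# ≤_)
    (trans (sym (exp-+ (half x) (half x))) (cong exp (half+half x)))
    (square-nonNegative (exp (half x)))

  1≤exp : ∀ {x} → 0# ≤ x → 1# ≤ exp x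
  1≤exp {x} 0≤x = ≤-trans (≤-by 0≤x (solve 1 (λ x → x := κ 1 :+ x :- κ 1) refl x)) (1+x≤exp x)

  exp-0 : exp 0# ≡ 1#
  exp-0 = *-cancelˡ-≡ (>⇒≢ (1≤⇒0< (1≤exp ≤-refl)))
    (trans (sym (exp-+ 0# 0#)) (trans (cong exp (+-identityʳ 0#)) (sym (*-identityʳ _))))

  exp-inverse : ∀ x → exp x * exp (- x) ≡ 1#
  exp-inverse x = trans (sym (exp-+ x (- x))) (trans (cong exp (-‿inverseʳ x)) exp-0)

  exp-mono : ∀ {x y} → x ≤ y → exp x ≤ exp y
  exp-mono {x} {y} x≤y = subst₂ _≤_ (*-identityʳ _)
    (trans (sym (exp-+ x (y - x))) (cong exp (solve 2 (λ x y → x :+ (y :- x) := y) refl x y)))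
    (*-monoʳ-≤ (0≤exp x) (1≤exp (x≤y⇒0≤y-x x≤y)))

  -- The bound 1 + x ≤ exp x at negative x gives upper bounds at - x.
  exp-upper : ∀ {y p q} → p ≤ exp (- y) → 1# ≤ p * q → 0# ≤ q → exp y ≤ q
  exp-upper {y} {p} {q} p≤ 1≤pq 0≤q = begin
    exp y                    ≡⟨ sym (*-identityʳ _) ⟩
    exp y * 1#               ≤⟨ *-monoʳ-≤ (0≤exp y) 1≤pq ⟩
    exp y * (p * q)          ≤⟨ *-monoʳ-≤ (0≤exp y) (*-monoˡ-≤ 0≤q p≤) ⟩
    exp y * (exp (- y) * q)  ≡⟨ sym (*-assoc _ _ q) ⟩
    exp y * exp (- y) * q    ≡⟨ cong (_* q) (exp-inverse y) ⟩
    1# * q                   ≡⟨ *-identityˡ q ⟩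
    q                        ∎
    where open ≤-Reasoning

  1-x≤exp : ∀ x → 1# - x ≤ exp (- x)
  1-x≤exp x = 1+x≤exp (- x)

  *-mono-≤ : ∀ {a b c d} → 0# ≤ a → 0# ≤ d → a ≤ b → c ≤ d → a * c ≤ b * d
  *-mono-≤ 0≤a 0≤d a≤b c≤d = ≤-trans (*-monoʳ-≤ 0≤a c≤d) (*-monoˡ-≤ 0≤d a≤b)

  third : ∀ y → ∃ λ z → y ≡ fromℕ 3 * z
  third y = y / fromℕ 3 , sym (*-/-cancel y (>⇒≢ (0<fromℕ 2)))

  -- exp (- y) ≥ (1 - y / 3)³, and the cube times 1 + y + y² is at least 1.
  exp≤1+y+y² : ∀ {y} → fromℕ 2 * y ≤ 1# → - 1# ≤ fromℕ 2 * y → exp y ≤ 1# + y + y * y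
  exp≤1+y+y² {y} 2y≤1 -1≤2y with third y
  ... | z , refl = exp-upper {p = (1# - z) * ((1# - z) * (1# - z))} cube poly quad
    where
    u≥0 : 0# ≤ 1# - fromℕ 6 * z
    u≥0 = subst (0# ≤_) (solve 1 (λ z → κ 1 :- κ 2 :* (κ 3 :* z) := κ 1 :- κ 6 :* z) refl z) (x≤y⇒0≤y-x 2y≤1)
    1-z≥0 : 0# ≤ 1# - z
    1-z≥0 = *-cancelˡ-≤ (0<fromℕ 5) (≤-by (+-nonNegative u≥0 (0≤fromℕ 5))
      (solve 1 (λ z → κ 1 :- κ 6 :* z :+ κ 5 := κ 6 :* (κ 1 :- z) :- κ 6 :* κ 0) refl z))
    cube : (1# - z) * ((1# - z) * (1# - z)) ≤ exp (- (fromℕ 3 * z))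
    cube = subst ((1# - z) * ((1# - z) * (1# - z)) ≤_)
      (trans (cong (exp (- z) *_) (sym (exp-+ (- z) (- z)))) (trans (sym (exp-+ (- z) _))
        (cong exp (solve 1 (λ z → :- z :+ (:- z :+ :- z) := :- (κ 3 :* z)) refl z))))
      (*-mono-≤ 1-z≥0 (*-nonNegative (0≤exp _) (0≤exp _)) (1-x≤exp z)
        (*-mono-≤ 1-z≥0 (0≤exp _) (1-x≤exp z) (1-x≤exp z)))
    poly : 1# ≤ (1# - z) * ((1# - z) * (1# - z)) * (1# + fromℕ 3 * z + fromℕ 3 * z * (fromℕ 3 * z))
    poly = *-cancelˡ-≤ (0<fromℕ 23) (≤-by
      (*-nonNegative (square-nonNegative z)
        (+-nonNegative (*-nonNegative (*-nonNegative (0≤fromℕ 36) (square-nonNegative z)) u≥0)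
        (+-nonNegative (*-nonNegative (0≤fromℕ 15) (square-nonNegative (1# - fromℕ 6 * z)))
        (+-nonNegative (*-nonNegative (0≤fromℕ 46) u≥0) (0≤fromℕ 11)))))
      (solve 1 (λ z → z :* z :* (κ 36 :* (z :* z) :* (κ 1 :- κ 6 :* z) :+
        (κ 15 :* ((κ 1 :- κ 6 :* z) :* (κ 1 :- κ 6 :* z)) :+
        (κ 46 :* (κ 1 :- κ 6 :* z) :+ κ 11))) :=
        κ 24 :* ((κ 1 :- z) :* ((κ 1 :- z) :* (κ 1 :- z)) :* (κ 1 :+ κ 3 :* z :+ κ 3 :* z :* (κ 3 :* z)))
        :- κ 24 :* κ 1) refl z))
    quad : 0# ≤ 1# + fromℕ 3 * z + fromℕ 3 * z * (fromℕ 3 * z)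
    quad = *-cancelˡ-≤ (0<fromℕ 3) (≤-by
      (+-nonNegative (square-nonNegative (fromℕ 6 * z + 1#)) (0≤fromℕ 3))
      (solve 1 (λ z → (κ 6 :* z :+ κ 1) :* (κ 6 :* z :+ κ 1) :+ κ 3 :=
        κ 4 :* (κ 1 :+ κ 3 :* z :+ κ 3 :* z :* (κ 3 :* z)) :- κ 4 :* κ 0) refl z))

  -- exp (- y) ≥ (1 - y / 2)², and the square times 1 + 3 y is at least 1.
  exp≤1+3y : ∀ {y} → 0# ≤ y → y ≤ 1# → exp y ≤ 1# + fromℕ 3 * y
  exp≤1+3y {y} 0≤y y≤1 = subst (λ y → exp y ≤ 1# + fromℕ 3 * y) (half+half y)
    (exp-upper {p = (1# - z) * (1# - z)}
      (subst ((1# - z) * (1# - z) ≤_)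
        (trans (sym (exp-+ (- z) (- z))) (cong exp (solve 1 (λ z → :- z :+ :- z := :- (z :+ z)) refl z)))
        (*-mono-≤ 0≤1-z (0≤exp _) (1-x≤exp z) (1-x≤exp z)))
      (≤-by (*-nonNegative 0≤z (*-nonNegative 0≤1-2z (+-nonNegative 0≤1-2z (+-nonNegative 0≤1-z (0≤fromℕ 2)))))
        (solve 1 (λ z → z :* ((κ 1 :- (z :+ z)) :* (κ 1 :- (z :+ z) :+ (κ 1 :- z :+ κ 2)))
          := (κ 1 :- z) :* (κ 1 :- z) :* (κ 1 :+ κ 3 :* (z :+ z)) :- κ 1) refl z))
      (+-nonNegative 0≤1 (*-nonNegative (0≤fromℕ 3) (+-nonNegative 0≤z 0≤z))))
    where
    z : ℝ
    z = half y
    0≤z : 0# ≤ z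
    0≤z = *-nonNegative 0≤y (0≤x⁻¹ (0<fromℕ 1))
    0≤1-2z : 0# ≤ 1# - (z + z)
    0≤1-2z = subst (λ y → 0# ≤ 1# - y) (sym (half+half y)) (x≤y⇒0≤y-x y≤1)
    0≤1-z : 0# ≤ 1# - z
    0≤1-z = subst (0# ≤_) (solve 1 (λ z → κ 1 :- (z :+ z) :+ z := κ 1 :- z) refl z) (+-nonNegative 0≤1-2z 0≤z)

  module BinomialTail (r : ℝ) (0≤r : 0# ≤ r) (r≤1 : r ≤ 1#) where
    open Binomial r 0≤r r≤1

    -- The linear terms of exp y ≤ 1 + y + y² cancel on average, and the quadratic
    -- ones contribute l² times the variance r (1 - r) ≤ 1/4.
    bernoulli-mgf : ∀ {l v} → l * l ≡ fromℕ 4 * v → fromℕ 2 * l ≤ 1# → - 1# ≤ fromℕ 2 * l →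
      r * exp (l * (1# - r)) + (1# - r) * exp (l * - r) ≤ exp v
    bernoulli-mgf {l} {v} l²≡4v 2l≤1 -1≤2l = begin
      r * exp (l * (1# - r)) + (1# - r) * exp (l * - r)
        ≤⟨ +-mono-≤ (*-monoʳ-≤ 0≤r (exp≤1+y+y² (small₁ 0≤1-r 1-r≤1) (small₂ 0≤1-r 1-r≤1)))
                    (*-monoʳ-≤ 0≤1-r (exp≤1+y+y² small₃ small₄)) ⟩
      r * (1# + l * (1# - r) + l * (1# - r) * (l * (1# - r))) +
        (1# - r) * (1# + l * - r + l * - r * (l * - r))
        ≡⟨ solve 2 (λ l r → r :* (κ 1 :+ l :* (κ 1 :- r) :+ l :* (κ 1 :- r) :* (l :* (κ 1 :- r))) :+
             (κ 1 :- r) :* (κ 1 :+ l :* (:- r) :+ l :* (:- r) :* (l :* (:- r)))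
             := κ 1 :+ (l :* l) :* (r :* (κ 1 :- r))) refl l r ⟩
      1# + (l * l) * (r * (1# - r))
        ≡⟨ cong (λ x → 1# + x * (r * (1# - r))) l²≡4v ⟩
      1# + fromℕ 4 * v * (r * (1# - r))
        ≤⟨ ≤-by (*-nonNegative 0≤v (square-nonNegative (1# - fromℕ 2 * r)))
             (solve 2 (λ v r → v :* ((κ 1 :- κ 2 :* r) :* (κ 1 :- κ 2 :* r))
               := κ 1 :+ v :- (κ 1 :+ κ 4 :* v :* (r :* (κ 1 :- r)))) refl v r) ⟩
      1# + v      ≤⟨ 1+x≤exp v ⟩
      exp v       ∎
      where
      open ≤-Reasoning
      0≤v : 0# ≤ v
      0≤v = *-cancelˡ-≤ (0<fromℕ 3) (subst₂ _≤_ (sym (zeroʳ _)) l²≡4v (square-nonNegative l))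
      1-r≤1 : 1# - r ≤ 1#
      1-r≤1 = ≤-by 0≤r (solve 1 (λ r → r := κ 1 :- (κ 1 :- r)) refl r)
      small₁ : ∀ {a} → 0# ≤ a → a ≤ 1# → fromℕ 2 * (l * a) ≤ 1#
      small₁ {a} 0≤a a≤1 = ≤-by (+-nonNegative (*-nonNegative 0≤a (x≤y⇒0≤y-x 2l≤1)) (x≤y⇒0≤y-x a≤1))
        (solve 2 (λ l a → a :* (κ 1 :- κ 2 :* l) :+ (κ 1 :- a) := κ 1 :- κ 2 :* (l :* a)) refl l a)
      small₂ : ∀ {a} → 0# ≤ a → a ≤ 1# → - 1# ≤ fromℕ 2 * (l * a)
      small₂ {a} 0≤a a≤1 = ≤-by (+-nonNegative (*-nonNegative 0≤a (x≤y⇒0≤y-x -1≤2l)) (x≤y⇒0≤y-x a≤1))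
        (solve 2 (λ l a → a :* (κ 2 :* l :- (:- κ 1)) :+ (κ 1 :- a) := κ 2 :* (l :* a) :- (:- κ 1)) refl l a)
      small₃ : fromℕ 2 * (l * - r) ≤ 1#
      small₃ = ≤-by (x≤y⇒0≤y-x (small₂ 0≤r r≤1))
        (solve 2 (λ l a → κ 2 :* (l :* a) :- (:- κ 1) := κ 1 :- κ 2 :* (l :* (:- a))) refl l r)
      small₄ : - 1# ≤ fromℕ 2 * (l * - r)
      small₄ = ≤-by (x≤y⇒0≤y-x (small₁ 0≤r r≤1))
        (solve 2 (λ l a → κ 1 :- κ 2 :* (l :* a) := κ 2 :* (l :* (:- a)) :- (:- κ 1)) refl l r)

    binomial-mgf : ∀ {l v} → l * l ≡ fromℕ 4 * v → fromℕ 2 * l ≤ 1# → - 1# ≤ fromℕ 2 * l →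
      ∀ t → 𝔹 t (λ h → exp (l * (fromℕ h - fromℕ t * r))) ≤ exp (fromℕ t * v)
    binomial-mgf {l} {v} _ _ _ zero = ≤-reflexive
      (cong exp (solve 3 (λ l r v → l :* (κ 0 :- κ 0 :* r) := κ 0 :* v) refl l r v))
    binomial-mgf {l} {v} l²≡4v 2l≤1 -1≤2l (suc t) = begin
      r * 𝔹 t (λ h → exp (l * (fromℕ (suc h) - fromℕ (suc t) * r))) +
        (1# - r) * 𝔹 t (λ h → exp (l * (fromℕ h - fromℕ (suc t) * r)))
        ≡⟨ cong₂ (λ a b → r * a + (1# - r) * b)
             (factor (1# - r) λ h → solve 4 (λ l r h t → l :* ((κ 1 :+ h) :- (κ 1 :+ t) :* r)
               := l :* (κ 1 :- r) :+ l :* (h :- t :* r)) refl l r (fromℕ h) (fromℕ t))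
             (factor (- r) λ h → solve 4 (λ l r h t → l :* (h :- (κ 1 :+ t) :* r)
               := l :* (:- r) :+ l :* (h :- t :* r)) refl l r (fromℕ h) (fromℕ t)) ⟩
      r * (exp (l * (1# - r)) * M) + (1# - r) * (exp (l * - r) * M)
        ≡⟨ solve 4 (λ r a b m → r :* (a :* m) :+ (κ 1 :- r) :* (b :* m)
             := (r :* a :+ (κ 1 :- r) :* b) :* m) refl r (exp (l * (1# - r))) (exp (l * - r)) M ⟩
      (r * exp (l * (1# - r)) + (1# - r) * exp (l * - r)) * M
        ≤⟨ *-monoˡ-≤ 0≤M (bernoulli-mgf l²≡4v 2l≤1 -1≤2l) ⟩
      exp v * M
        ≤⟨ *-monoʳ-≤ (0≤exp v) (binomial-mgf l²≡4v 2l≤1 -1≤2l t) ⟩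
      exp v * exp (fromℕ t * v)
        ≡⟨ sym (exp-+ v _) ⟩
      exp (v + fromℕ t * v)
        ≡⟨ cong exp (solve 2 (λ t v → v :+ t :* v := (κ 1 :+ t) :* v) refl (fromℕ t) v) ⟩
      exp (fromℕ (suc t) * v) ∎
      where
      open ≤-Reasoning
      M : ℝ
      M = 𝔹 t (λ h → exp (l * (fromℕ h - fromℕ t * r)))
      0≤M : 0# ≤ M
      0≤M = subst (_≤ M) (𝔹-const t 0#) (𝔹-mono t (λ _ → 0≤exp _))
      factor : ∀ a {f : ℕ → ℝ} → (∀ h → f h ≡ l * a + l * (fromℕ h - fromℕ t * r)) →
        𝔹 t (exp ∘ f) ≡ exp (l * a) * M
      factor a f≗ = trans
        (𝔹-cong t (λ h → trans (cong exp (f≗ h)) (exp-+ _ _))) (𝔹-* t (exp (l * a)) _)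

    module _ (t : ℕ) (e : ℝ) (0≤e : 0# ≤ e) (e≤¼ : fromℕ 4 * e ≤ 1#)
      (W : ℕ → Bool)
      (inside  : ∀ h → W h ≡ true →
        fromℕ t * r - fromℕ h ≤ fromℕ t * e × fromℕ h - fromℕ t * r ≤ fromℕ t * e)
      (outside : ∀ h → W h ≡ false →
        fromℕ t * e ≤ fromℕ t * r - fromℕ h ⊎ fromℕ t * e ≤ fromℕ h - fromℕ t * r)
      where
      open Window t e 0≤e e≤¼ W inside outside

      chernoff : 1# - S ≤ fromℕ 2 * exp (- (τ * e * e))
      chernoff = begin
        1# - S
          ≡⟨ cong₂ _-_ (sym (𝔹-const t 1#)) refl ⟩
        𝔹 t (λ _ → 1#) - S
          ≤⟨ ≤-by (x≤y⇒0≤y-x markov) (solve 3 (λ a s b → s :+ b :- a := b :- (a :- s)) refl (𝔹 t (λ _ → 1#)) S _) ⟩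
        𝔹 t up + 𝔹 t down
          ≤⟨ +-mono-≤ (side-bound l up-mgf) (side-bound (- l) down-mgf) ⟩
        exp (τ * (e * e)) * exp (- (l * w)) + exp (τ * (e * e)) * exp (- (l * w))
          ≡⟨ solve 1 (λ a → a :+ a := κ 2 :* a) refl _ ⟩
        fromℕ 2 * (exp (τ * (e * e)) * exp (- (l * w)))
          ≡⟨ cong (fromℕ 2 *_) (trans (sym (exp-+ _ _)) (cong exp
               (solve 2 (λ τ e → τ :* (e :* e) :+ :- (κ 2 :* e :* (τ :* e)) := :- (τ :* e :* e)) refl τ e))) ⟩
        fromℕ 2 * exp (- (τ * e * e)) ∎
        where
        open ≤-Reasoning
        -- Minimises the bound τ l² / 4 - l w on the exponent.
        l : ℝ
        l = fromℕ 2 * e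
        0≤l : 0# ≤ l
        0≤l = *-nonNegative (0≤fromℕ 2) 0≤e
        2l≤1 : fromℕ 2 * l ≤ 1#
        2l≤1 = subst (_≤ 1#) (solve 1 (λ e → κ 4 :* e := κ 2 :* (κ 2 :* e)) refl e) e≤¼
        -1≤2l : - 1# ≤ fromℕ 2 * l
        -1≤2l = ≤-by (+-nonNegative (*-nonNegative (0≤fromℕ 2) 0≤l) 0≤1)
          (solve 1 (λ l → κ 2 :* l :+ κ 1 := κ 2 :* l :- (:- κ 1)) refl l)
        tail : ℝ → ℕ → ℝ
        tail l′ h = exp (l′ * (fromℕ h - τ * r)) * exp (- (l * w))
        up down : ℕ → ℝ
        up   = tail l
        down = tail (- l)
        up-mgf : 𝔹 t (λ h → exp (l * (fromℕ h - τ * r))) ≤ exp (τ * (e * e))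
        up-mgf = binomial-mgf (solve 1 (λ e → κ 2 :* e :* (κ 2 :* e) := κ 4 :* (e :* e)) refl e) 2l≤1 -1≤2l t
        down-mgf : 𝔹 t (λ h → exp (- l * (fromℕ h - τ * r))) ≤ exp (τ * (e * e))
        down-mgf = binomial-mgf
          (solve 1 (λ e → (:- (κ 2 :* e)) :* (:- (κ 2 :* e)) := κ 4 :* (e :* e)) refl e)
          (≤-by (x≤y⇒0≤y-x -1≤2l) (solve 1 (λ l → κ 2 :* l :- (:- κ 1) := κ 1 :- κ 2 :* (:- l)) refl l))
          (≤-by (x≤y⇒0≤y-x 2l≤1) (solve 1 (λ l → κ 1 :- κ 2 :* l := κ 2 :* (:- l) :- (:- κ 1)) refl l)) t
        side-bound : ∀ l′ → 𝔹 t (λ h → exp (l′ * (fromℕ h - τ * r))) ≤ exp (τ * (e * e)) →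
          𝔹 t (tail l′) ≤ exp (τ * (e * e)) * exp (- (l * w))
        side-bound l′ mgf = subst (_≤ exp (τ * (e * e)) * exp (- (l * w)))
          (trans (*-comm _ _) (trans (sym (𝔹-* t (exp (- (l * w))) _)) (𝔹-cong t (λ h → *-comm _ _))))
          (*-monoˡ-≤ (0≤exp _) mgf)
        0≤tail : ∀ l′ h → 0# ≤ tail l′ h
        0≤tail l′ h = *-nonNegative (0≤exp _) (0≤exp _)
        big : ∀ l′ h → l * w ≤ l′ * (fromℕ h - τ * r) → 1# ≤ tail l′ h
        big l′ h le = subst (1# ≤_) (exp-+ _ _) (1≤exp (x≤y⇒0≤y-x le))
        pointwise : ∀ h → 1# ≤ 𝟙 (W h) + (up h + down h)
        pointwise h with W h in eq
        ... | true  = ≤-by (+-nonNegative (0≤tail l h) (0≤tail (- l) h))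
          (solve 1 (λ x → x := κ 1 :+ x :- κ 1) refl (up h + down h))
        ... | false with outside h eq
        ...   | inj₁ far = ≤-trans
          (big (- l) h (subst (l * w ≤_)
            (solve 3 (λ l m h → l :* (m :- h) := (:- l) :* (h :- m)) refl l (τ * r) (fromℕ h))
            (*-monoʳ-≤ 0≤l far)))
          (≤-by (0≤tail l h) (solve 2 (λ u d → u := κ 0 :+ (u :+ d) :- d) refl (up h) (down h)))
        ...   | inj₂ far = ≤-trans (big l h (*-monoʳ-≤ 0≤l far))
          (≤-by (0≤tail (- l) h) (solve 2 (λ u d → d := κ 0 :+ (u :+ d) :- u) refl (up h) (down h)))
        markov : 𝔹 t (λ _ → 1#) ≤ S + (𝔹 t up + 𝔹 t down)
        markov = subst (𝔹 t (λ _ → 1#) ≤_)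
          (trans (𝔹-+ t _ _) (cong (S +_) (𝔹-+ t up down))) (𝔹-mono t pointwise)

      -- With x = τ e² = 2 y: Chernoff's bound is at most exp (- y) if x ≥ 2. For
      -- x ≤ 2 a wide window has S ≥ β w / (β w + τ), where β w ≥ 3 w² / 2 = 3 y τ,
      -- so that 1 - S ≤ 1 / (1 + 3 y); a narrow one has S ≥ y.
      failure-bound : ∀ {y} → y + y ≡ τ * e * e → S ≡ 0# ⊎ 1# - S ≤ exp (- y)
      failure-bound {y} 2y≡ with fromℕ 2 ≤? τ * e * e
      ... | yes 2≤ = inj₂ (≤-trans chernoff (begin
        fromℕ 2 * exp (- (τ * e * e))   ≤⟨ *-monoˡ-≤ (0≤exp _) (≤-trans 2≤1+y (1+x≤exp y)) ⟩
        exp y * exp (- (τ * e * e))     ≡⟨ trans (sym (exp-+ _ _)) (cong exp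
                                             (trans (cong (λ x → y - x) (sym 2y≡))
                                             (solve 1 (λ y → y :- (y :+ y) := :- y) refl y))) ⟩
        exp (- y)                       ∎))
        where
        open ≤-Reasoning
        2≤1+y : fromℕ 2 ≤ 1# + y
        2≤1+y = *-cancelˡ-≤ (0<fromℕ 1) (≤-by (x≤y⇒0≤y-x (subst (fromℕ 2 ≤_) (sym 2y≡) 2≤))
          (solve 1 (λ y → y :+ y :- κ 2 := κ 2 :* (κ 1 :+ y) :- κ 2 :* κ 2) refl y))
      ... | no 2≰ with fromℕ 2 ≤? w
      ...   | yes 2≤w = inj₂ (*-cancelˡ-≤ 0<k (≤-trans wide′ (begin
        τ                               ≡⟨ sym (*-identityˡ τ) ⟩
        1# * τ                          ≡⟨ cong (_* τ) (sym (trans (*-comm _ _) (exp-inverse y))) ⟩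
        exp (- y) * exp y * τ           ≡⟨ *-assoc _ _ _ ⟩
        exp (- y) * (exp y * τ)         ≤⟨ *-monoʳ-≤ (0≤exp _) (*-monoˡ-≤ 0≤τ (exp≤1+3y 0≤y y≤1)) ⟩
        exp (- y) * ((1# + fromℕ 3 * y) * τ)  ≤⟨ *-monoʳ-≤ (0≤exp _) step ⟩
        exp (- y) * (β * w + τ)         ≡⟨ *-comm _ _ ⟩
        (β * w + τ) * exp (- y)         ∎)))
        where
        open Wide 2≤w using (β; 0≤β; 8≤τ; wide)
        open ≤-Reasoning
        0<k : 0# < β * w + τ
        0<k = <-≤-trans (0<fromℕ 7) (≤-trans 8≤τ (≤-by (*-nonNegative 0≤β 0≤w)
          (solve 2 (λ a τ → a := a :+ τ :- τ) refl (β * w) τ)))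
        wide′ : (β * w + τ) * (1# - S) ≤ τ
        wide′ = ≤-by (x≤y⇒0≤y-x wide) (solve 3 (λ b τ s → (b :+ τ) :* s :- b :=
          τ :- (b :+ τ) :* (κ 1 :- s)) refl (β * w) τ S)
        0≤y : 0# ≤ y
        0≤y = *-cancelˡ-≤ (0<fromℕ 1) (≤-by (*-nonNegative 0≤w 0≤e)
          (trans (sym 2y≡) (solve 1 (λ y → y :+ y := κ 2 :* y :- κ 2 :* κ 0) refl y)))
        y≤1 : y ≤ 1#
        y≤1 = *-cancelˡ-≤ (0<fromℕ 1) (≤-by (x≤y⇒0≤y-x (subst (_≤ fromℕ 2) (sym 2y≡) (≰⇒≥ 2≰)))
          (solve 1 (λ y → κ 2 :- (y :+ y) := κ 2 :* κ 1 :- κ 2 :* y) refl y))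
        step : (1# + fromℕ 3 * y) * τ ≤ β * w + τ
        step = *-cancelˡ-≤ (0<fromℕ 1) (≤-by (*-nonNegative 0≤w (x≤y⇒0≤y-x 2≤w))
          (trans (solve 3 (λ τ e w → w :* (w :- κ 2) :=
              κ 2 :* ((κ 2 :* w :- κ 1) :* w :+ τ) :- (κ 2 :* τ :+ κ 3 :* (w :* w))) refl τ e w)
            (cong (λ z → fromℕ 2 * (β * w + τ) - z)
              (trans (trans (solve 2 (λ τ e → κ 2 :* τ :+ κ 3 :* ((τ :* e) :* (τ :* e)) :=
                  κ 2 :* τ :+ κ 3 :* (τ :* e :* e) :* τ) refl τ e)
                (cong (λ x → fromℕ 2 * τ + fromℕ 3 * x * τ) (sym 2y≡)))
                (solve 2 (λ τ y → κ 2 :* τ :+ κ 3 :* (y :+ y) :* τ :=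
                  κ 2 :* ((κ 1 :+ κ 3 :* y) :* τ)) refl τ y)))))
      ...   | no 2≰w with 𝔹-witness t W
      ...     | inj₂ none = inj₁ none
      ...     | inj₁ (h₀ , Wh₀) = inj₂ (≤-trans (≤-by (x≤y⇒0≤y-x y≤S)
                  (solve 2 (λ y s → s :- y := κ 1 :- y :- (κ 1 :- s)) refl y S)) (1-x≤exp y))
        where
        open Narrow (≰⇒≥ 2≰w) h₀ Wh₀ using (narrow)
        y≤S : y ≤ S
        y≤S = *-cancelˡ-≤ (0<fromℕ 1) (≤-trans (≤-reflexive
          (trans (solve 1 (λ y → κ 2 :* y := y :+ y) refl y) 2y≡)) narrow)

-- Laws and their domination

module Laws (𝓡 : RealNumbers) where
  open RealNumbers 𝓡
  open OverReals 𝓡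
  open OrderedFieldProperties orderedField
  open RingSolver using (solve; _:+_; _:*_; _:-_; :-_; _:=_)
  open Concentration orderedField using (𝟙; 0≤𝟙)

  private variable
    A B : Set

  -- Expected values determine a law up to _≈_. They are opaque so that the law
  -- and the test function can be inferred from an expected value.
  opaque

    𝔼 : Law A → (A → ℝ) → ℝ
    𝔼 []            g = 0#
    𝔼 ((w , a) ∷ d) g = w * g a + 𝔼 d g

  total : Law A → ℝ
  total d = 𝔼 d (λ _ → 1#)

  opaque
    unfolding 𝔼

    Pr-𝔼 : ∀ (d : Law A) E → Pr d E ≡ 𝔼 d (𝟙 ∘ E)
    Pr-𝔼 []            E = refl
    Pr-𝔼 ((w , a) ∷ d) E = cong₂ _+_ (weigh (E a)) (Pr-𝔼 d E)
      where
      weigh : ∀ b → (if b then w else 0#) ≡ w * 𝟙 b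
      weigh true  = sym (*-identityʳ w)
      weigh false = sym (zeroʳ w)

    𝔼-cong : ∀ (d : Law A) {g h} → (∀ a → g a ≡ h a) → 𝔼 d g ≡ 𝔼 d h
    𝔼-cong []            g≗h = refl
    𝔼-cong ((w , a) ∷ d) g≗h = cong₂ (λ x y → w * x + y) (g≗h a) (𝔼-cong d g≗h)

    𝔼-++ : ∀ (d e : Law A) g → 𝔼 (d ++ e) g ≡ 𝔼 d g + 𝔼 e g
    𝔼-++ []            e g = sym (+-identityˡ _)
    𝔼-++ ((w , a) ∷ d) e g = trans (cong (w * g a +_) (𝔼-++ d e g)) (sym (+-assoc _ _ _))

    𝔼-scale : ∀ c (d : Law A) g → 𝔼 (scale c d) g ≡ c * 𝔼 d g
    𝔼-scale c []            g = sym (zeroʳ c)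
    𝔼-scale c ((w , a) ∷ d) g = trans (cong₂ _+_ (*-assoc c w (g a)) (𝔼-scale c d g)) (sym (distribˡ c _ _))

    𝔼-mapLaw : ∀ (f : A → B) d g → 𝔼 (mapLaw f d) g ≡ 𝔼 d (g ∘ f)
    𝔼-mapLaw f []            g = refl
    𝔼-mapLaw f ((w , a) ∷ d) g = cong (w * g (f a) +_) (𝔼-mapLaw f d g)

    𝔼-pure : ∀ (a : A) g → 𝔼 (pure a) g ≡ g a
    𝔼-pure a g = trans (+-identityʳ _) (*-identityˡ _)

    𝔼->>= : ∀ (d : Law A) (f : A → Law B) g → 𝔼 (d >>= f) g ≡ 𝔼 d (λ a → 𝔼 (f a) g)
    𝔼->>= []            f g = refl
    𝔼->>= ((w , a) ∷ d) f g = trans (𝔼-++ (scale w (f a)) _ g)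
      (cong₂ _+_ (𝔼-scale w (f a) g) (𝔼->>= d f g))

    𝔼-+ : ∀ (d : Law A) g h → 𝔼 d (λ a → g a + h a) ≡ 𝔼 d g + 𝔼 d h
    𝔼-+ []            g h = sym (+-identityˡ 0#)
    𝔼-+ ((w , a) ∷ d) g h = trans (cong (w * (g a + h a) +_) (𝔼-+ d g h))
      (solve 5 (λ w x y p q → w :* (x :+ y) :+ (p :+ q) := (w :* x :+ p) :+ (w :* y :+ q)) refl
        w (g a) (h a) (𝔼 d g) (𝔼 d h))

    𝔼-* : ∀ (d : Law A) c g → 𝔼 d (λ a → c * g a) ≡ c * 𝔼 d g
    𝔼-* []            c g = sym (zeroʳ c)
    𝔼-* ((w , a) ∷ d) c g = trans (cong (w * (c * g a) +_) (𝔼-* d c g))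
      (solve 4 (λ w c x p → w :* (c :* x) :+ c :* p := c :* (w :* x :+ p)) refl w c (g a) (𝔼 d g))

  𝔼-const : ∀ (d : Law A) c → total d ≡ 1# → 𝔼 d (λ _ → c) ≡ c
  𝔼-const d c total≡1 = begin
    𝔼 d (λ _ → c)        ≡⟨ 𝔼-cong d (λ _ → sym (*-identityʳ c)) ⟩
    𝔼 d (λ _ → c * 1#)   ≡⟨ 𝔼-* d c (λ _ → 1#) ⟩
    c * total d          ≡⟨ cong (c *_) total≡1 ⟩
    c * 1#               ≡⟨ *-identityʳ c ⟩
    c                    ∎
    where open ≡-Reasoning

  opaque
    unfolding 𝔼

    𝔼-swap : ∀ (d : Law A) (e : Law B) (g : A → B → ℝ) →
      𝔼 d (λ a → 𝔼 e (g a)) ≡ 𝔼 e (λ b → 𝔼 d (λ a → g a b))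
    𝔼-swap []            e g = sym (trans (𝔼-cong e (λ _ → sym (zeroʳ 0#))) (trans (𝔼-* e 0# (λ _ → 0#)) (zeroˡ _)))
    𝔼-swap ((w , a) ∷ d) e g = trans
      (cong₂ _+_ (sym (𝔼-* e w (g a))) (𝔼-swap d e g)) (sym (𝔼-+ e _ _))

  ≈-from-𝔼 : ∀ {d e : Law A} → (∀ g → 𝔼 d g ≡ 𝔼 e g) → d ≈ e
  ≈-from-𝔼 {d = d} {e} eq E = trans (Pr-𝔼 d E) (trans (eq (𝟙 ∘ E)) (sym (Pr-𝔼 e E)))

  -- The weights are included because every use needs both.
  On : (A → Set) → Law A → Set
  On P = All (λ (w , a) → 0# ≤ w × P a)

  opaque
    unfolding 𝔼

    𝔼-mono : ∀ {P : A → Set} {d g h} → On P d → (∀ a → P a → g a ≤ h a) → 𝔼 d g ≤ 𝔼 d h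
    𝔼-mono []                g≤h = ≤-refl
    𝔼-mono ((0≤w , Pa) ∷ on) g≤h = +-mono-≤ (*-monoʳ-≤ 0≤w (g≤h _ Pa)) (𝔼-mono on g≤h)

    0≤𝔼 : ∀ {P : A → Set} {d g} → On P d → (∀ a → P a → 0# ≤ g a) → 0# ≤ 𝔼 d g
    0≤𝔼 []                0≤g = ≤-refl
    0≤𝔼 ((0≤w , Pa) ∷ on) 0≤g = +-nonNegative (*-nonNegative 0≤w (0≤g _ Pa)) (0≤𝔼 on 0≤g)

  On-scale : ∀ {P : A → Set} {c d} → 0# ≤ c → On P d → On P (scale c d)
  On-scale 0≤c = All.map⁺ ∘ All.map (λ (0≤w , Pa) → *-nonNegative 0≤c 0≤w , Pa)

  On-pure : ∀ {P : A → Set} {a} → P a → On P (pure a)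
  On-pure Pa = (0≤1 , Pa) ∷ []

  On->>= : ∀ {P : A → Set} {Q : B → Set} {d f} → On P d → (∀ a → P a → On Q (f a)) → On Q (d >>= f)
  On->>= []                onf = []
  On->>= ((0≤w , Pa) ∷ on) onf = All.++⁺ (On-scale 0≤w (onf _ Pa)) (On->>= on onf)

  On-mapLaw : ∀ {P : A → Set} {Q : B → Set} {f d} → (∀ a → P a → Q (f a)) → On P d → On Q (mapLaw f d)
  On-mapLaw PQ = All.map⁺ ∘ All.map (λ (0≤w , Pa) → 0≤w , PQ _ Pa)

  -- Both laws are supported on P, so that in a composite only the continuations
  -- from outcomes satisfying P need to be compared.
  record Dominates (P : A → Set) (c : ℝ) (d e : Law A) : Set where
    constructor dominates
    field
      onˡ   : On P d
      onʳ   : On P e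
      bound : ∀ g → (∀ a → P a → 0# ≤ g a) → c * 𝔼 e g ≤ 𝔼 d g
  open Dominates public

  dominates-refl : ∀ {P : A → Set} {d} → On P d → Dominates P 1# d d
  dominates-refl on = dominates on on (λ g _ → ≤-reflexive (*-identityˡ _))

  dominates-weaken : ∀ {P : A → Set} {c c′ d e} → c′ ≤ c → Dominates P c d e → Dominates P c′ d e
  dominates-weaken c′≤c (dominates onˡ onʳ bound) = dominates onˡ onʳ
    (λ g 0≤g → ≤-trans (*-monoˡ-≤ (0≤𝔼 onʳ 0≤g) c′≤c) (bound g 0≤g))

  dominates->>= : ∀ {P : A → Set} {Q : B → Set} {c c′ d e f f′} → 0# ≤ c′ →
    Dominates P c d e → (∀ a → P a → Dominates Q c′ (f a) (f′ a)) →
    Dominates Q (c * c′) (d >>= f) (e >>= f′)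
  dominates->>= {c = c} {c′} {d} {e} {f} {f′} 0≤c′ dom domf = dominates
    (On->>= (onˡ dom) (λ a Pa → onˡ (domf a Pa)))
    (On->>= (onʳ dom) (λ a Pa → onʳ (domf a Pa)))
    λ g 0≤g → begin
      c * c′ * 𝔼 (e >>= f′) g                ≡⟨ cong (c * c′ *_) (𝔼->>= e f′ g) ⟩
      c * c′ * 𝔼 e (λ a → 𝔼 (f′ a) g)        ≡⟨ trans (*-assoc c c′ _) (cong (c *_) (sym (𝔼-* e c′ _))) ⟩
      c * 𝔼 e (λ a → c′ * 𝔼 (f′ a) g)
        ≤⟨ bound dom _ (λ a Pa → *-nonNegative 0≤c′ (0≤𝔼 (onʳ (domf a Pa)) 0≤g)) ⟩
      𝔼 d (λ a → c′ * 𝔼 (f′ a) g)            ≤⟨ 𝔼-mono (onˡ dom) (λ a Pa → bound (domf a Pa) g 0≤g) ⟩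
      𝔼 d (λ a → 𝔼 (f a) g)                  ≡⟨ sym (𝔼->>= d f g) ⟩
      𝔼 (d >>= f) g                          ∎
    where open ≤-Reasoning

  counting : List A → Law A
  counting = List.map (1# ,_)

  private
    hit : ∀ w x {y} → y ≡ 0# → w * (1# * x) + y ≡ w * x
    hit w x refl = solve 2 (λ w x → w :* (κ 1 :* x) :+ κ 0 := w :* x) refl w x

    miss : ∀ w x y → w * (0# * x) + y ≡ y
    miss = solve 3 (λ w x y → w :* (κ 0 :* x) :+ y := y) refl

  module _ (_≟ᴬ_ : DecidableEquality A) where

    point : A → A → ℝ
    point a b = 𝟙 ⌊ a ≟ᴬ b ⌋

    opaque
      unfolding 𝔼

      counting-∉ : ∀ {b xs} (g : A → ℝ) → All (b ≢_) xs → 𝔼 (counting xs) (λ a → point b a * g a) ≡ 0#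
      counting-∉ g [] = refl
      counting-∉ {b} g (_∷_ {x = x} b≢x b≢xs) with b ≟ᴬ x
      ... | yes b≡x = ⊥-elim (b≢x b≡x)
      ... | no  _   = trans (miss 1# (g x) _) (counting-∉ g b≢xs)

      counting-∈ : ∀ {b xs} (g : A → ℝ) → Unique xs → b ∈ xs →
        𝔼 (counting xs) (λ a → point b a * g a) ≡ g b
      counting-∈ {b} g (b≢xs ∷ _) (here refl) with b ≟ᴬ b
      ... | yes _   = trans (hit 1# (g b) (counting-∉ g b≢xs)) (*-identityˡ _)
      ... | no  b≢b = ⊥-elim (b≢b refl)
      counting-∈ {b} g (_∷_ {x = x} x≢xs unique) (there b∈xs) with b ≟ᴬ x
      ... | yes refl = ⊥-elim (All.lookup x≢xs b∈xs refl)
      ... | no  _    = trans (miss 1# (g x) _) (counting-∈ g unique b∈xs)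

      𝔼-by-points : ∀ {xs} (d : Law A) g → Unique xs → All (λ (_ , a) → a ∈ xs) d →
        𝔼 d g ≡ 𝔼 (counting xs) (λ a → 𝔼 d (λ b → point b a) * g a)
      𝔼-by-points {xs} d g unique d∈xs = begin
        𝔼 d g
          ≡⟨ reindex d∈xs ⟩
        𝔼 d (λ b → 𝔼 (counting xs) (λ a → point b a * g a))
          ≡⟨ 𝔼-swap d (counting xs) _ ⟩
        𝔼 (counting xs) (λ a → 𝔼 d (λ b → point b a * g a))
          ≡⟨ 𝔼-cong (counting xs) (λ a → trans (𝔼-cong d (λ b → *-comm _ _))
               (trans (𝔼-* d (g a) _) (*-comm _ _))) ⟩
        𝔼 (counting xs) (λ a → 𝔼 d (λ b → point b a) * g a) ∎
        where
        open ≡-Reasoning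
        reindex : ∀ {d′} → All (λ (_ , a) → a ∈ xs) d′ →
          𝔼 d′ g ≡ 𝔼 d′ (λ b → 𝔼 (counting xs) (λ a → point b a * g a))
        reindex []                              = refl
        reindex (_∷_ {x = (w , b)} b∈xs d′∈xs) =
          cong₂ (λ x y → w * x + y) (sym (counting-∈ g unique b∈xs)) (reindex d′∈xs)

      -- The remainder weighs each outcome by the difference of its two
      -- probabilities. The outcomes are deduplicated first, because a law may
      -- spread the probability of an outcome over several entries.
      remainder : ∀ {c} {d e : Law A} → (∀ g → (∀ a → 0# ≤ g a) → c * 𝔼 e g ≤ 𝔼 d g) →
        ∃ λ r → On (λ _ → ⊤) r × (∀ g → 𝔼 d g ≡ c * 𝔼 e g + 𝔼 r g)
      remainder {c} {d} {e} bound = r , r≥0 , split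
        where
        xs : List A
        xs = List.deduplicate _≟ᴬ_ (List.map proj₂ (d ++ e))
        unique : Unique xs
        unique = deduplicate-! _≟ᴬ_ _
        d∈xs : All (λ (_ , a) → a ∈ xs) d
        d∈xs = All.tabulate λ a∈d → ∈-deduplicate⁺ _≟ᴬ_ (∈-map⁺ proj₂ (∈-++⁺ˡ a∈d))
        e∈xs : All (λ (_ , a) → a ∈ xs) e
        e∈xs = All.tabulate λ a∈e → ∈-deduplicate⁺ _≟ᴬ_ (∈-map⁺ proj₂ (∈-++⁺ʳ d a∈e))
        excess : A → ℝ
        excess a = 𝔼 d (λ b → point b a) - c * 𝔼 e (λ b → point b a)
        r : Law A
        r = List.map (λ a → excess a , a) xs
        r≥0 : On (λ _ → ⊤) r
        r≥0 = All.map⁺ (All.universal (λ a →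
          x≤y⇒0≤y-x (bound _ (λ b → 0≤𝟙 ⌊ b ≟ᴬ a ⌋)) , tt) xs)
        𝔼-r : ∀ ys g → 𝔼 (List.map (λ a → excess a , a) ys) g ≡ 𝔼 (counting ys) (λ a → excess a * g a)
        𝔼-r []       g = refl
        𝔼-r (y ∷ ys) g = cong₂ _+_ (sym (*-identityˡ _)) (𝔼-r ys g)
        split : ∀ g → 𝔼 d g ≡ c * 𝔼 e g + 𝔼 r g
        split g = begin
          𝔼 d g
            ≡⟨ 𝔼-by-points d g unique d∈xs ⟩
          𝔼 (counting xs) (λ a → 𝔼 d (λ b → point b a) * g a)
            ≡⟨ 𝔼-cong (counting xs) (λ a → solve 4 (λ x y c z → x :* z := c :* (y :* z) :+ (x :- c :* y) :* z) refl
                 (𝔼 d (λ b → point b a)) (𝔼 e (λ b → point b a)) c (g a)) ⟩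
          𝔼 (counting xs) (λ a → c * (𝔼 e (λ b → point b a) * g a) + excess a * g a)
            ≡⟨ trans (𝔼-+ (counting xs) _ _) (cong₂ _+_ (𝔼-* (counting xs) c _) (sym (𝔼-r xs g))) ⟩
          c * 𝔼 (counting xs) (λ a → 𝔼 e (λ b → point b a) * g a) + 𝔼 r g
            ≡⟨ cong (λ x → c * x + 𝔼 r g) (sym (𝔼-by-points e g unique e∈xs)) ⟩
          c * 𝔼 e g + 𝔼 r g ∎
          where open ≡-Reasoning

  private

    opaque
      unfolding 𝔼

      𝔼-restrict : ∀ (E : A → Bool) p (d : Law A) g →
        𝔼 (List.map (λ (w , a) → (if E a then w / p else 0#) , a) d) g ≡ p ⁻¹ * 𝔼 d (λ a → 𝟙 (E a) * g a)
      𝔼-restrict E p []            g = sym (zeroʳ _)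
      𝔼-restrict E p ((w , a) ∷ d) g = trans (cong₂ _+_ (weigh (E a)) (𝔼-restrict E p d g)) (sym (distribˡ _ _ _))
        where
        weigh : ∀ b → (if b then w / p else 0#) * g a ≡ p ⁻¹ * (w * (𝟙 b * g a))
        weigh true  = solve 3 (λ w p x → w :* p :* x := p :* (w :* (κ 1 :* x))) refl w (p ⁻¹) (g a)
        weigh false = solve 3 (λ w p x → κ 0 :* x := p :* (w :* (κ 0 :* x))) refl w (p ⁻¹) (g a)

  𝔼-condition : ∀ (E : A → Bool) (d : Law A) g → Pr d E ≢ 0# →
    𝔼 (condition E d) g ≡ (Pr d E) ⁻¹ * 𝔼 d (λ a → 𝟙 (E a) * g a)
  𝔼-condition E d g Pr≢0 with Pr d E ≟ 0#
  ... | yes Pr≡0 = ⊥-elim (Pr≢0 Pr≡0)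
  ... | no  _    = 𝔼-restrict E (Pr d E) d g

  total-condition : ∀ (E : A → Bool) (d : Law A) → total d ≡ 1# → total (condition E d) ≡ 1#
  total-condition E d total≡1 with Pr d E ≟ 0#
  ... | yes _    = total≡1
  ... | no  Pr≢0 = trans (𝔼-restrict E (Pr d E) d _) (trans
    (cong ((Pr d E) ⁻¹ *_) (trans (𝔼-cong d (λ a → *-identityʳ _)) (sym (Pr-𝔼 d E))))
    (*-inverseˡ Pr≢0))

  -- Conditioning on an event of probability at least c multiplies no
  -- probability by more than 1 / c.
  dominates-condition : ∀ {P : A → Set} {c} {E : A → Bool} {d : Law A} → On P d → c ≤ 1# →
    Pr d E ≡ 0# ⊎ c ≤ Pr d E → Dominates P c d (condition E d)
  dominates-condition {c = c} {E} {d} on c≤1 likely with Pr d E ≟ 0# | likely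
  ... | yes _    | _         = dominates-weaken c≤1 (dominates-refl on)
  ... | no  Pr≢0 | inj₁ Pr≡0 = ⊥-elim (Pr≢0 Pr≡0)
  ... | no  Pr≢0 | inj₂ c≤p  = dominates on (All.map⁺ (All.map (λ {wa} → keep wa) on)) λ g 0≤g →
    let 0≤restricted = 0≤𝔼 on (λ a Pa → *-nonNegative (0≤𝟙 (E a)) (0≤g a Pa)) in begin
      c * 𝔼 (List.map (λ (w , a) → (if E a then w / p else 0#) , a) d) g
        ≡⟨ cong (c *_) (𝔼-restrict E p d g) ⟩
      c * (p ⁻¹ * 𝔼 d (λ a → 𝟙 (E a) * g a))
        ≤⟨ *-monoˡ-≤ (*-nonNegative (0≤x⁻¹ 0<p) 0≤restricted) c≤p ⟩
      p * (p ⁻¹ * 𝔼 d (λ a → 𝟙 (E a) * g a))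
        ≡⟨ trans (sym (*-assoc _ _ _)) (trans (cong (_* 𝔼 d (λ a → 𝟙 (E a) * g a)) (*-inverse p Pr≢0)) (*-identityˡ _)) ⟩
      𝔼 d (λ a → 𝟙 (E a) * g a)
        ≤⟨ 𝔼-mono on (λ a Pa → shrink (E a) (0≤g a Pa)) ⟩
      𝔼 d g ∎
    where
    open ≤-Reasoning
    p : ℝ
    p = Pr d E
    0<p : 0# < p
    0<p = subst (0# ≤_) (sym (Pr-𝔼 d E)) (0≤𝔼 on (λ a _ → 0≤𝟙 (E a))) , λ 0≡p → Pr≢0 (sym 0≡p)
    keep : ∀ wa → (0# ≤ proj₁ wa × _) → 0# ≤ (if E (proj₂ wa) then proj₁ wa / p else 0#) × _
    keep (w , a) (0≤w , Pa) with E a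
    ... | true  = *-nonNegative 0≤w (0≤x⁻¹ 0<p) , Pa
    ... | false = ≤-refl , Pa
    shrink : ∀ b {x} → 0# ≤ x → 𝟙 b * x ≤ x
    shrink true  0≤x = ≤-reflexive (*-identityˡ _)
    shrink false 0≤x = subst (_≤ _) (sym (zeroˡ _)) 0≤x

-- Leaves and conditional samples

_≟ˢ_ : DecidableEquality Side
left  ≟ˢ left  = yes refl
left  ≟ˢ right = no λ ()
right ≟ˢ left  = no λ ()
right ≟ˢ right = yes refl

_≟ᴸ_ : ∀ {k} → DecidableEquality (Leaf k)
_≟ᴸ_ = Vec.≡-dec _≟ˢ_

leaves : ∀ k → List (Leaf k)
leaves zero    = [] ∷ []
leaves (suc k) = List.map (left ∷_) (leaves k) ++ List.map (right ∷_) (leaves k)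

leaves-unique : ∀ k → Unique (leaves k)
leaves-unique zero    = [] ∷ []
leaves-unique (suc k) = ++⁺ (map⁺ Vec.∷-injectiveʳ (leaves-unique k)) (map⁺ Vec.∷-injectiveʳ (leaves-unique k))
  λ (∈ˡ , ∈ʳ) → clash (proj₂ (proj₂ (∈-map⁻ _ ∈ˡ))) (proj₂ (proj₂ (∈-map⁻ _ ∈ʳ)))
  where
  clash : ∀ {w : Leaf (suc k)} {x y} → w ≡ left ∷ x → w ≢ right ∷ y
  clash refl ()

∈-leaves : ∀ {k} (w : Leaf k) → w ∈ leaves k
∈-leaves []          = here refl
∈-leaves (left ∷ w)  = ∈-++⁺ˡ (∈-map⁺ (left ∷_) (∈-leaves w))
∈-leaves (right ∷ w) = ∈-++⁺ʳ _ (∈-map⁺ (right ∷_) (∈-leaves w))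

⌊∈?⌋ : ∀ {n} (i : Fin n) (A : Subset n) → ⌊ i ∈? A ⌋ ≡ Vec.lookup A i
⌊∈?⌋ i A with i ∈? A
... | yes i∈A = sym ([]=⇒lookup i∈A)
... | no  i∉A with Vec.lookup A i in eq
...   | true  = ⊥-elim (i∉A (lookup⇒[]= i A eq))
...   | false = refl

module Sampling (𝓡 : RealNumbers) where
  open RealNumbers 𝓡
  open OverReals 𝓡
  open OrderedFieldProperties orderedField
  open RingSolver using (solve; _:+_; _:*_; _:-_; :-_; _:=_)
  open Concentration orderedField using (𝟙; 0≤𝟙)
  open Laws 𝓡
  open Algebra.Properties.Semiring.Sum semiring
    using (sum-cong-≗; *-distribˡ-sum; *-distribʳ-sum; ∑-distrib-+)

  sum-≥0 : ∀ {n} {f : Fin n → ℝ} → (∀ i → 0# ≤ f i) → 0# ≤ sum f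
  sum-≥0 {zero}  0≤f = ≤-refl
  sum-≥0 {suc n} 0≤f = +-nonNegative (0≤f Fin.zero) (sum-≥0 (0≤f ∘ Fin.suc))

  term≤sum : ∀ {n} {f : Fin n → ℝ} → (∀ i → 0# ≤ f i) → ∀ i → f i ≤ sum f
  term≤sum {suc n} {f} 0≤f Fin.zero = ≤-by (sum-≥0 (0≤f ∘ Fin.suc))
    (solve 2 (λ x s → s := x :+ s :- x) refl (f Fin.zero) _)
  term≤sum {suc n} {f} 0≤f (Fin.suc i) = ≤-trans (term≤sum (0≤f ∘ Fin.suc) i) (≤-by (0≤f Fin.zero)
    (solve 2 (λ x s → x := x :+ s :- s) refl (f Fin.zero) _))

  opaque
    unfolding 𝔼

    𝔼-counting-tabulate : ∀ {A : Set} {n} (h : Fin n → A) g → 𝔼 (counting (List.tabulate h)) g ≡ sum (g ∘ h)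
    𝔼-counting-tabulate {n = zero}  h g = refl
    𝔼-counting-tabulate {n = suc n} h g = cong₂ _+_ (*-identityˡ _) (𝔼-counting-tabulate (h ∘ Fin.suc) g)

    𝔼-sample : ∀ {n} (μ : MassFunction n) g → 𝔼 (sample μ) g ≡ sum (λ i → μ i * g i)
    𝔼-sample {n} μ g = tabulated id
      where
      tabulated : ∀ {m} (h : Fin m → Fin n) →
        𝔼 (List.map (λ i → μ i , i) (List.tabulate h)) g ≡ sum (λ j → μ (h j) * g (h j))
      tabulated {zero}  h = refl
      tabulated {suc m} h = cong (μ (h Fin.zero) * g (h Fin.zero) +_) (tabulated (h ∘ Fin.suc))

  On-sample : ∀ {n} {μ : MassFunction n} {P : Fin n → Set} → (∀ i → 0# ≤ μ i) → (∀ i → P i) → On P (sample μ)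
  On-sample {n} 0≤μ Pi = All.map⁺ (All.universal (λ i → 0≤μ i , Pi i) (List.allFin n))

  ∑-leaves : ∀ k → (Leaf k → ℝ) → ℝ
  ∑-leaves k = 𝔼 (counting (leaves k))

  opaque
    unfolding 𝔼

    ∑-leaves-suc : ∀ {k} (g : Leaf (suc k) → ℝ) →
      ∑-leaves (suc k) g ≡ ∑-leaves k (g ∘ (left ∷_)) + ∑-leaves k (g ∘ (right ∷_))
    ∑-leaves-suc {k} g = trans (cong (λ d → 𝔼 d g) (map-++ (List.map (left ∷_) (leaves k)) _))
      (trans (𝔼-++ (counting (List.map (left ∷_) (leaves k))) _ g)
        (cong₂ _+_ (counting-map (left ∷_) (leaves k)) (counting-map (right ∷_) (leaves k))))
      where
      map-++ : ∀ {A : Set} (xs ys : List A) → counting (xs ++ ys) ≡ counting xs ++ counting ys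
      map-++ []       ys = refl
      map-++ (x ∷ xs) ys = cong (_ ∷_) (map-++ xs ys)
      counting-map : ∀ (f : Leaf k → Leaf (suc k)) ws →
        𝔼 (counting (List.map f ws)) g ≡ 𝔼 (counting ws) (g ∘ f)
      counting-map f []       = refl
      counting-map f (w ∷ ws) = cong (1# * g (f w) +_) (counting-map f ws)

  -- Both sums count each pair of matching indices once.
  sum-over-leaves : ∀ {k n} (T : BalancedTree k n) (g : Leaf k → ℝ) →
    sum (g ∘ Inverse.from T) ≡ ∑-leaves k g
  sum-over-leaves {k} {n} T g = begin
    sum (g ∘ from)
      ≡⟨ sym (𝔼-counting-tabulate id (g ∘ from)) ⟩
    𝔼 indices (g ∘ from)
      ≡⟨ 𝔼-cong indices (λ i → sym (counting-∈ _≟ᴸ_ g (leaves-unique k) (∈-leaves (from i)))) ⟩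
    𝔼 indices (λ i → ∑-leaves k (λ w → point _≟ᴸ_ (from i) w * g w))
      ≡⟨ 𝔼-swap indices (counting (leaves k)) _ ⟩
    ∑-leaves k (λ w → 𝔼 indices (λ i → point _≟ᴸ_ (from i) w * g w))
      ≡⟨ 𝔼-cong (counting (leaves k)) (λ w → trans
           (𝔼-cong indices (λ i → cong (_* g w) (matching i w)))
           (counting-∈ Fin._≟_ (λ _ → g w) (allFin⁺ n) (∈-allFin (to w)))) ⟩
    ∑-leaves k g ∎
    where
    open Inverse T
    open ≡-Reasoning
    indices : Law (Fin n)
    indices = counting (List.allFin n)
    matching : ∀ i w → point _≟ᴸ_ (from i) w ≡ point Fin._≟_ (to w) i
    matching i w with from i ≟ᴸ w | to w Fin.≟ i
    ... | yes _    | yes _    = refl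
    ... | no  _    | no  _    = refl
    ... | yes refl | no  ≢i   = ⊥-elim (≢i (strictlyInverseˡ i))
    ... | no  ≢w   | yes refl = ⊥-elim (≢w (strictlyInverseʳ w))

  fromℕ-∣∣ : ∀ {n} (A : Subset n) → fromℕ ∣ A ∣ ≡ sum (λ i → 𝟙 (Vec.lookup A i))
  fromℕ-∣∣ []          = refl
  fromℕ-∣∣ (true ∷ A)  = cong (1# +_) (fromℕ-∣∣ A)
  fromℕ-∣∣ (false ∷ A) = trans (fromℕ-∣∣ A) (sym (+-identityˡ _))

  conditionalMass-≥0 : ∀ {n} {μ : MassFunction n} → (∀ i → 0# ≤ μ i) → ∀ A i → 0# ≤ conditionalMass μ A i
  conditionalMass-≥0 {μ = μ} 0≤μ A i with i ∈? A | mass μ A ≤? 0#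
  ... | no  _   | _     = ≤-refl
  ... | yes _   | no ≰0 = *-nonNegative (0≤μ i) (0≤x⁻¹ (≰⇒> ≰0))
  ... | yes i∈A | yes _ = *-nonNegative 0≤1 (0≤x⁻¹ (<-≤-trans 0<1
    (subst₂ _≤_ (cong 𝟙 ([]=⇒lookup i∈A)) (sym (fromℕ-∣∣ A)) (term≤sum (λ j → 0≤𝟙 (Vec.lookup A j)) i))))

  conditionalMass-positive : ∀ {n} (μ : MassFunction n) A → 0# < mass μ A → ∀ i →
    conditionalMass μ A i ≡ 𝟙 ⌊ i ∈? A ⌋ * μ i * mass μ A ⁻¹
  conditionalMass-positive μ A 0<M i with i ∈? A | mass μ A ≤? 0#
  ... | no  _ | _      = sym (trans (cong (_* mass μ A ⁻¹) (zeroˡ _)) (zeroˡ _))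
  ... | yes _ | no  _  = cong (_* mass μ A ⁻¹) (sym (*-identityˡ _))
  ... | yes _ | yes ≤0 = ⊥-elim (<⇒≱ 0<M ≤0)

  conditionalMass-null : ∀ {n} (μ : MassFunction n) A → mass μ A ≤ 0# → ∀ i →
    conditionalMass μ A i ≡ 𝟙 ⌊ i ∈? A ⌋ * 1# * fromℕ ∣ A ∣ ⁻¹
  conditionalMass-null μ A M≤0 i with i ∈? A | mass μ A ≤? 0#
  ... | no  _ | _      = sym (trans (cong (_* fromℕ ∣ A ∣ ⁻¹) (zeroˡ _)) (zeroˡ _))
  ... | yes _ | no  ≰0 = ⊥-elim (≰0 M≤0)
  ... | yes _ | yes _  = cong (_* fromℕ ∣ A ∣ ⁻¹) (sym (*-identityˡ _))

  module _ {k n} (T : BalancedTree k n) (u : Node k) where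
    open Inverse T

    atLeft atRight : Fin n → Bool
    atLeft  i = isLeft  (side u (from i))
    atRight i = isRight (side u (from i))

    ∈?-L : ∀ i → ⌊ i ∈? L T u ⌋ ≡ atLeft i
    ∈?-L i = trans (⌊∈?⌋ i (L T u)) (lookup∘tabulate atLeft i)

    ∈?-R : ∀ i → ⌊ i ∈? R T u ⌋ ≡ atRight i
    ∈?-R i = trans (⌊∈?⌋ i (R T u)) (lookup∘tabulate atRight i)

    𝟙-∈?-L∪R : ∀ i → 𝟙 ⌊ i ∈? (L T u ∪ R T u) ⌋ ≡ 𝟙 (atLeft i) + 𝟙 (atRight i)
    𝟙-∈?-L∪R i = trans (cong 𝟙 (begin
      ⌊ i ∈? (L T u ∪ R T u) ⌋                        ≡⟨ ⌊∈?⌋ i (L T u ∪ R T u) ⟩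
      Vec.lookup (L T u ∪ R T u) i                    ≡⟨ lookup-zipWith _∨_ i (L T u) (R T u) ⟩
      Vec.lookup (L T u) i ∨ Vec.lookup (R T u) i     ≡⟨ cong₂ _∨_ (lookup∘tabulate atLeft i) (lookup∘tabulate atRight i) ⟩
      atLeft i ∨ atRight i                            ∎)) (disjoint (side u (from i)))
      where
      open ≡-Reasoning
      disjoint : ∀ s → 𝟙 (isLeft s ∨ isRight s) ≡ 𝟙 (isLeft s) + 𝟙 (isRight s)
      disjoint (just left)  = sym (+-identityʳ 1#)
      disjoint (just right) = sym (+-identityˡ 1#)
      disjoint nothing      = sym (+-identityˡ 0#)

    massL massR : MassFunction n → ℝ
    massL q = sum (λ i → 𝟙 (atLeft i) * q i)
    massR q = sum (λ i → 𝟙 (atRight i) * q i)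

    select : ∀ b x → (if b then x else 0#) ≡ 𝟙 b * x
    select true  x = sym (*-identityˡ x)
    select false x = sym (zeroˡ x)

    mass-L : ∀ μ → mass μ (L T u) ≡ massL μ
    mass-L μ = sum-cong-≗ λ i → trans (select ⌊ i ∈? L T u ⌋ (μ i)) (cong (λ b → 𝟙 b * μ i) (∈?-L i))

    mass-R : ∀ μ → mass μ (R T u) ≡ massR μ
    mass-R μ = sum-cong-≗ λ i → trans (select ⌊ i ∈? R T u ⌋ (μ i)) (cong (λ b → 𝟙 b * μ i) (∈?-R i))

    mass-L∪R : ∀ μ → mass μ (L T u ∪ R T u) ≡ massL μ + massR μ
    mass-L∪R μ = trans
      (sum-cong-≗ λ i → trans (select ⌊ i ∈? (L T u ∪ R T u) ⌋ (μ i))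
        (trans (cong (_* μ i) (𝟙-∈?-L∪R i)) (distribʳ (μ i) _ _)))
      (∑-distrib-+ (λ i → 𝟙 (atLeft i) * μ i) (λ i → 𝟙 (atRight i) * μ i))

    massL-≥0 : ∀ {q} → (∀ i → 0# ≤ q i) → 0# ≤ massL q
    massL-≥0 0≤q = sum-≥0 λ i → *-nonNegative (0≤𝟙 (atLeft i)) (0≤q i)

    massR-≥0 : ∀ {q} → (∀ i → 0# ≤ q i) → 0# ≤ massR q
    massR-≥0 0≤q = sum-≥0 λ i → *-nonNegative (0≤𝟙 (atRight i)) (0≤q i)

    -- Both subtrees of the node are full of the same depth; this is a symmetry of
    -- the sum at the node itself, and the levels above it only add zeros.
    massL≡massR : massL (λ _ → 1#) ≡ massR (λ _ → 1#)
    massL≡massR = begin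
      massL (λ _ → 1#)
        ≡⟨ sum-over-leaves T (λ w → 𝟙 (isLeft (side u w)) * 1#) ⟩
      ∑-leaves k (λ w → 𝟙 (isLeft (side u w)) * 1#)
        ≡⟨ balanced u ⟩
      ∑-leaves k (λ w → 𝟙 (isRight (side u w)) * 1#)
        ≡⟨ sym (sum-over-leaves T (λ w → 𝟙 (isRight (side u w)) * 1#)) ⟩
      massR (λ _ → 1#) ∎
      where
      open ≡-Reasoning
      balanced : ∀ {m} (v : Node m) → ∑-leaves m (λ w → 𝟙 (isLeft (side v w)) * 1#) ≡
                                      ∑-leaves m (λ w → 𝟙 (isRight (side v w)) * 1#)
      balanced {suc m} v = trans (∑-leaves-suc {m} (λ w → 𝟙 (isLeft (side v w)) * 1#))
        (trans (halves v) (sym (∑-leaves-suc {m} (λ w → 𝟙 (isRight (side v w)) * 1#))))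
        where
        halves : ∀ (v : Node (suc m)) →
          ∑-leaves m (λ w → 𝟙 (isLeft (side v (left ∷ w))) * 1#) +
          ∑-leaves m (λ w → 𝟙 (isLeft (side v (right ∷ w))) * 1#) ≡
          ∑-leaves m (λ w → 𝟙 (isRight (side v (left ∷ w))) * 1#) +
          ∑-leaves m (λ w → 𝟙 (isRight (side v (right ∷ w))) * 1#)
        halves root            = +-comm _ _
        halves (below left v)  = cong (_+ ∑-leaves m (λ _ → 0# * 1#)) (balanced v)
        halves (below right v) = cong (∑-leaves m (λ _ → 0# * 1#) +_) (balanced v)

    0<leaf-count : 0# < massL (λ _ → 1#)
    0<leaf-count = <-≤-trans 0<1 (subst (_≤ massL (λ _ → 1#)) leftmost
      (term≤sum (λ i → *-nonNegative (0≤𝟙 (atLeft i)) 0≤1) (to (proj₁ (leftLeaf u)))))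
      where
      leftmost : 𝟙 (atLeft (to (proj₁ (leftLeaf u)))) * 1# ≡ 1#
      leftmost = trans (*-identityʳ _) (cong 𝟙 (trans
        (cong (isLeft ∘ side u) (strictlyInverseʳ (proj₁ (leftLeaf u))))
        (cong isLeft (proj₂ (leftLeaf u)))))

    module _ (μ : MassFunction n) (0≤μ : ∀ i → 0# ≤ μ i) where

      private
        S : Subset n
        S = L T u ∪ R T u

        split : ∀ q c a b → (∀ i → conditionalMass μ S i ≡ 𝟙 ⌊ i ∈? S ⌋ * q i * c) →
          𝔼 (sample (conditionalMass μ S)) (λ i → if ⌊ i ∈? L T u ⌋ then a else b) ≡
          massL q * c * a + massR q * c * b
        split q c a b cm≡ = begin
          𝔼 (sample (conditionalMass μ S)) (λ i → if ⌊ i ∈? L T u ⌋ then a else b)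
            ≡⟨ 𝔼-sample (conditionalMass μ S) _ ⟩
          sum (λ i → conditionalMass μ S i * (if ⌊ i ∈? L T u ⌋ then a else b))
            ≡⟨ sum-cong-≗ pointwise ⟩
          sum (λ i → (c * a) * (𝟙 (atLeft i) * q i) + (c * b) * (𝟙 (atRight i) * q i))
            ≡⟨ ∑-distrib-+ (λ i → (c * a) * (𝟙 (atLeft i) * q i)) (λ i → (c * b) * (𝟙 (atRight i) * q i)) ⟩
          sum (λ i → (c * a) * (𝟙 (atLeft i) * q i)) + sum (λ i → (c * b) * (𝟙 (atRight i) * q i))
            ≡⟨ cong₂ _+_ (sym (*-distribˡ-sum (c * a) (λ i → 𝟙 (atLeft i) * q i)))
                         (sym (*-distribˡ-sum (c * b) (λ i → 𝟙 (atRight i) * q i))) ⟩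
          (c * a) * massL q + (c * b) * massR q
            ≡⟨ solve 5 (λ c a b l r → (c :* a) :* l :+ (c :* b) :* r := l :* c :* a :+ r :* c :* b) refl
                 c a b (massL q) (massR q) ⟩
          massL q * c * a + massR q * c * b ∎
          where
          open ≡-Reasoning
          cases : ∀ s x → (𝟙 (isLeft s) + 𝟙 (isRight s)) * x * c * (if isLeft s then a else b) ≡
            (c * a) * (𝟙 (isLeft s) * x) + (c * b) * (𝟙 (isRight s) * x)
          cases (just left) x = solve 4 (λ x c a b →
            (κ 1 :+ κ 0) :* x :* c :* a := (c :* a) :* (κ 1 :* x) :+ (c :* b) :* (κ 0 :* x)) refl x c a b
          cases (just right) x = solve 4 (λ x c a b →
            (κ 0 :+ κ 1) :* x :* c :* b := (c :* a) :* (κ 0 :* x) :+ (c :* b) :* (κ 1 :* x)) refl x c a b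
          cases nothing x = solve 4 (λ x c a b →
            (κ 0 :+ κ 0) :* x :* c :* b := (c :* a) :* (κ 0 :* x) :+ (c :* b) :* (κ 0 :* x)) refl x c a b
          pointwise : ∀ i → conditionalMass μ S i * (if ⌊ i ∈? L T u ⌋ then a else b) ≡
            (c * a) * (𝟙 (atLeft i) * q i) + (c * b) * (𝟙 (atRight i) * q i)
          pointwise i = trans (cong₂ _*_
            (trans (cm≡ i) (cong (λ x → x * q i * c) (𝟙-∈?-L∪R i)))
            (cong (λ b′ → if b′ then a else b) (∈?-L i)))
            (cases (side u (from i)) (q i))

      ratio-cases :
        (massL μ + massR μ ≡ 0# × ratio T μ u ≡ 1# / fromℕ 2) ⊎
        (massL μ + massR μ ≢ 0# × ratio T μ u ≡ massL μ / (massL μ + massR μ))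
      ratio-cases with mass μ (L T u) + mass μ (R T u) ≟ 0#
      ... | yes M≡0 = inj₁ (trans (sym (cong₂ _+_ (mass-L μ) (mass-R μ))) M≡0 , refl)
      ... | no  M≢0 = inj₂
        ((λ M≡0 → M≢0 (trans (cong₂ _+_ (mass-L μ) (mass-R μ)) M≡0)) ,
         cong₂ (λ l r → l / (l + r)) (mass-L μ) (mass-R μ))

      ratio-bounds : 0# ≤ ratio T μ u × ratio T μ u ≤ 1#
      ratio-bounds with ratio-cases
      ... | inj₁ (_ , r≡) = subst (λ r → 0# ≤ r × r ≤ 1#) (sym r≡) half-bounds
        where
        half-bounds : 0# ≤ 1# / fromℕ 2 × 1# / fromℕ 2 ≤ 1#
        half-bounds = *-nonNegative 0≤1 (0≤x⁻¹ (0<fromℕ 1)) ,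
          *-cancelˡ-≤ (0<fromℕ 1) (≤-by 0≤1 (trans (solve 0 (κ 1 := κ 2 :* κ 1 :- κ 1) refl)
            (cong (λ x → fromℕ 2 * 1# - x) (sym (*-/-cancel 1# (>⇒≢ (0<fromℕ 1)))))))
      ... | inj₂ (M≢0 , r≡) = subst (λ r → 0# ≤ r × r ≤ 1#) (sym r≡) (
        *-nonNegative (massL-≥0 0≤μ) (0≤x⁻¹ 0<M) ,
        *-cancelˡ-≤ 0<M (≤-by (massR-≥0 0≤μ) (trans
          (solve 2 (λ l r → r := (l :+ r) :* κ 1 :- l) refl (massL μ) (massR μ))
          (cong (λ x → (massL μ + massR μ) * 1# - x) (sym (*-/-cancel (massL μ) M≢0))))))
        where
        0<M : 0# < massL μ + massR μ
        0<M = +-nonNegative (massL-≥0 0≤μ) (massR-≥0 0≤μ) , λ 0≡M → M≢0 (sym 0≡M)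

      -- If L(u) ∪ R(u) has positive mass then this is the definition of r_u.
      -- If it has mass 0 then the sample is uniform, and falls into either half
      -- equally often because L(u) and R(u) have the same size; this agrees with
      -- the value 1/2 that r_u takes.
      𝔼-conditional-sample : ∀ a b →
        𝔼 (sample (conditionalMass μ S)) (λ i → if ⌊ i ∈? L T u ⌋ then a else b) ≡
        ratio T μ u * a + (1# - ratio T μ u) * b
      𝔼-conditional-sample a b with ratio-cases
      ... | inj₂ (M≢0 , r≡) = trans
        (split μ (mass μ S ⁻¹) a b (conditionalMass-positive μ S (subst (0# <_) (sym (mass-L∪R μ)) 0<M)))
        (trans (cong (λ x → massL μ * x ⁻¹ * a + massR μ * x ⁻¹ * b) (mass-L∪R μ))
         (trans (cong (λ x → massL μ * (massL μ + massR μ) ⁻¹ * a + x * b)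
            (trans (solve 3 (λ l r c → r :* c := (l :+ r) :* c :- l :* c) refl
                (massL μ) (massR μ) ((massL μ + massR μ) ⁻¹))
              (cong (_- massL μ / (massL μ + massR μ)) (*-inverse _ M≢0))))
         (cong (λ r → r * a + (1# - r) * b) (sym r≡))))
        where
        0<M : 0# < massL μ + massR μ
        0<M = +-nonNegative (massL-≥0 0≤μ) (massR-≥0 0≤μ) , λ 0≡M → M≢0 (sym 0≡M)
      ... | inj₁ (M≡0 , r≡) = trans
        (split (λ _ → 1#) (fromℕ ∣ S ∣ ⁻¹) a b
          (conditionalMass-null μ S (≤-reflexive (trans (mass-L∪R μ) M≡0))))
        (trans (cong₂ (λ x y → x * a + y * b) half-left
            (trans (cong (_* fromℕ ∣ S ∣ ⁻¹) (sym massL≡massR)) (trans half-left other-half)))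
          (cong (λ r → r * a + (1# - r) * b) (sym r≡)))
        where
        ℓ : ℝ
        ℓ = massL (λ _ → 1#)
        size : fromℕ ∣ S ∣ ≡ fromℕ 2 * ℓ
        size = begin
          fromℕ ∣ S ∣                       ≡⟨ fromℕ-∣∣ S ⟩
          sum (λ i → 𝟙 (Vec.lookup S i))
            ≡⟨ sum-cong-≗ (λ i → trans (cong 𝟙 (sym (⌊∈?⌋ i S))) (trans (𝟙-∈?-L∪R i)
                 (sym (cong₂ _+_ (*-identityʳ _) (*-identityʳ _))))) ⟩
          sum (λ i → 𝟙 (atLeft i) * 1# + 𝟙 (atRight i) * 1#)
            ≡⟨ ∑-distrib-+ (λ i → 𝟙 (atLeft i) * 1#) (λ i → 𝟙 (atRight i) * 1#) ⟩
          ℓ + massR (λ _ → 1#)              ≡⟨ cong (ℓ +_) (sym massL≡massR) ⟩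
          ℓ + ℓ                             ≡⟨ solve 1 (λ l → l :+ l := κ 2 :* l) refl ℓ ⟩
          fromℕ 2 * ℓ                       ∎
          where open ≡-Reasoning
        half-left : ℓ * fromℕ ∣ S ∣ ⁻¹ ≡ 1# / fromℕ 2
        half-left = begin
          ℓ * fromℕ ∣ S ∣ ⁻¹                ≡⟨ cong (λ x → ℓ * x ⁻¹) size ⟩
          ℓ * (fromℕ 2 * ℓ) ⁻¹
            ≡⟨ cong (ℓ *_) (⁻¹-distrib-* (>⇒≢ (0<fromℕ 1)) (>⇒≢ 0<leaf-count)) ⟩
          ℓ * (fromℕ 2 ⁻¹ * ℓ ⁻¹)
            ≡⟨ solve 3 (λ l h m → l :* (h :* m) := (l :* m) :* h) refl ℓ (fromℕ 2 ⁻¹) (ℓ ⁻¹) ⟩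
          (ℓ * ℓ ⁻¹) * fromℕ 2 ⁻¹           ≡⟨ cong (_* fromℕ 2 ⁻¹) (*-inverse ℓ (>⇒≢ 0<leaf-count)) ⟩
          1# / fromℕ 2                      ∎
          where open ≡-Reasoning
        other-half : 1# / fromℕ 2 ≡ 1# - 1# / fromℕ 2
        other-half = trans (solve 1 (λ h → h := (h :+ h) :- h) refl (half 1#))
          (cong (_- half 1#) (half+half 1#))

-- The ratio estimator

module Estimation (𝓡 : RealNumbers) where
  open RealNumbers 𝓡
  open OverReals 𝓡
  open OrderedFieldProperties orderedField
  open RingSolver using (solve; _:+_; _:*_; _:-_; :-_; _:=_)
  open Concentration orderedField using (𝟙; 0≤𝟙; module Binomial)
  open ExponentialTail 𝓡
  open Laws 𝓡
  open Sampling 𝓡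
  open Ceiling 𝓡

  𝔼-bind : ∀ {n} {A B : Set} μ (P : Alg n A) (f : A → Alg n B) g →
    𝔼 (⟦ bind P f ⟧ μ) g ≡ 𝔼 (⟦ P ⟧ μ) (λ a → 𝔼 (⟦ f a ⟧ μ) g)
  𝔼-bind μ (return a)         f g = sym (𝔼-pure a (λ a → 𝔼 (⟦ f a ⟧ μ) g))
  𝔼-bind μ (condSample S z h) f g = trans (𝔼->>= draw (λ i → ⟦ bind (h i) f ⟧ μ) g)
    (trans (𝔼-cong draw (λ i → 𝔼-bind μ (h i) f g))
      (sym (𝔼->>= draw (λ i → ⟦ h i ⟧ μ) (λ a → 𝔼 (⟦ f a ⟧ μ) g))))
    where
    draw : Law (Fin _)
    draw = sample (conditionalMass μ S)
  𝔼-bind μ (toss p h)         f g = trans (𝔼->>= coin (λ d → ⟦ bind (h d) f ⟧ μ) g)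
    (trans (𝔼-cong coin (λ d → 𝔼-bind μ (h d) f g))
      (sym (𝔼->>= coin (λ d → ⟦ h d ⟧ μ) (λ a → 𝔼 (⟦ f a ⟧ μ) g))))
    where
    coin : Law Side
    coin = (p , left) ∷ (1# - p , right) ∷ []

  -- There is no constructor for tosses: estimators do not toss coins, and a toss
  -- gives nonnegative weights only if its bias is a probability.
  data Outcomes {n} {A : Set} (Q : A → Set) : Alg n A → Set where
    return     : ∀ {a} → Q a → Outcomes Q (return a)
    condSample : ∀ {S z g} → (∀ i → Outcomes Q (g i)) → Outcomes Q (condSample S z g)

  Outcomes-bind : ∀ {n} {A B : Set} {Q : A → Set} {Q′ : B → Set} {P : Alg n A} {f : A → Alg n B} →
    Outcomes Q P → (∀ a → Q a → Outcomes Q′ (f a)) → Outcomes Q′ (bind P f)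
  Outcomes-bind (return Qa)    onf = onf _ Qa
  Outcomes-bind (condSample o) onf = condSample (λ i → Outcomes-bind (o i) onf)

  On-⟦⟧ : ∀ {n} {A : Set} {Q : A → Set} {P : Alg n A} {μ} → (∀ i → 0# ≤ μ i) → Outcomes Q P → On Q (⟦ P ⟧ μ)
  On-⟦⟧ 0≤μ (return Qa) = On-pure Qa
  On-⟦⟧ 0≤μ (condSample {S = S} o) =
    On->>= {P = λ i → i ≡ i} (On-sample (conditionalMass-≥0 0≤μ S) (λ _ → refl)) (λ i _ → On-⟦⟧ 0≤μ (o i))

  InUnitInterval : ℝ → Set
  InUnitInterval x = 0# ≤ x × x ≤ 1#

  -- Logarithms occur as log (δ ⁻¹), so bounds on them are bounds on exp (- log).
  exp-log-neg : ∀ {x} → 0# < x → exp (- log (x ⁻¹)) ≡ x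
  exp-log-neg {x} 0<x = *-cancelˡ-≡ (>⇒≢ (0<x⁻¹ 0<x)) (begin
    x ⁻¹ * exp (- log (x ⁻¹))               ≡⟨ cong (_* exp (- log (x ⁻¹))) (sym (exp-log (x ⁻¹) (0<x⁻¹ 0<x))) ⟩
    exp (log (x ⁻¹)) * exp (- log (x ⁻¹))   ≡⟨ exp-inverse _ ⟩
    1#                                      ≡⟨ sym (*-inverseˡ (>⇒≢ 0<x)) ⟩
    x ⁻¹ * x                                ∎)
    where open ≡-Reasoning

  1-x≤log : ∀ {x} → 0# < x → 1# - x ≤ log (x ⁻¹)
  1-x≤log {x} 0<x = ≤-by (x≤y⇒0≤y-x (1-x≤exp (log (x ⁻¹))))
    (trans (cong (_- (1# - log (x ⁻¹))) (exp-log-neg 0<x))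
      (solve 2 (λ x l → x :- (κ 1 :- l) := l :- (κ 1 :- x)) refl x (log (x ⁻¹))))

  0≤log : ∀ {x} → 0# < x → x ≤ 1# → 0# ≤ log (x ⁻¹)
  0≤log 0<x x≤1 = ≤-trans (x≤y⇒0≤y-x x≤1) (1-x≤log 0<x)

  ∧-true : ∀ {a b} → a ∧ b ≡ true → a ≡ true × b ≡ true
  ∧-true {true} {true} refl = refl , refl

  ∧-false : ∀ {a b} → a ∧ b ≡ false → a ≡ false ⊎ b ≡ false
  ∧-false {false}        refl = inj₁ refl
  ∧-false {true} {false} refl = inj₂ refl

  ≤?-true : ∀ {x y} → ⌊ x ≤? y ⌋ ≡ true → x ≤ y
  ≤?-true {x} {y} eq with x ≤? y
  ... | yes x≤y = x≤y

  ≤?-false : ∀ {x y} → ⌊ x ≤? y ⌋ ≡ false → y ≤ x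
  ≤?-false {x} {y} eq with x ≤? y
  ... | no x≰y = ≰⇒≥ x≰y

  module _ {k n : ℕ} (T : BalancedTree k n) (μ : MassFunction n) (0≤μ : ∀ i → 0# ≤ μ i) (u : Node k) where

    private
      r : ℝ
      r = ratio T μ u
      0≤r : 0# ≤ r
      0≤r = proj₁ (ratio-bounds T u μ 0≤μ)
      r≤1 : r ≤ 1#
      r≤1 = proj₂ (ratio-bounds T u μ 0≤μ)
    open Binomial r 0≤r r≤1

    𝔼-countLeft : ∀ t g → 𝔼 (⟦ countLeft T u t ⟧ μ) g ≡ 𝔹 t g
    𝔼-countLeft zero    g = 𝔼-pure 0 g
    𝔼-countLeft (suc t) g = begin
      𝔼 (⟦ countLeft T u (suc t) ⟧ μ) g
        ≡⟨ 𝔼->>= (sample (conditionalMass μ S)) _ g ⟩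
      𝔼 (sample (conditionalMass μ S)) (λ i →
        𝔼 (⟦ bind (countLeft T u t) (λ h → return (if ⌊ i ∈? L T u ⌋ then suc h else h)) ⟧ μ) g)
        ≡⟨ 𝔼-cong (sample (conditionalMass μ S)) (λ i → trans (𝔼-bind μ (countLeft T u t) _ g)
             (trans (𝔼-cong (⟦ countLeft T u t ⟧ μ) (λ h → 𝔼-pure _ g)) (step ⌊ i ∈? L T u ⌋))) ⟩
      𝔼 (sample (conditionalMass μ S)) (λ i → if ⌊ i ∈? L T u ⌋ then 𝔹 t (g ∘ suc) else 𝔹 t g)
        ≡⟨ 𝔼-conditional-sample T u μ 0≤μ _ _ ⟩
      𝔹 (suc t) g ∎
      where
      open ≡-Reasoning
      S : Subset n
      S = L T u ∪ R T u
      step : ∀ b → 𝔼 (⟦ countLeft T u t ⟧ μ) (λ h → g (if b then suc h else h)) ≡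
        (if b then 𝔹 t (g ∘ suc) else 𝔹 t g)
      step true  = 𝔼-countLeft t (g ∘ suc)
      step false = 𝔼-countLeft t g

    countLeft-≤ : ∀ t → Outcomes (ℕ._≤ t) (countLeft T u t)
    countLeft-≤ zero    = return ℕ.z≤n
    countLeft-≤ (suc t) = condSample λ i → Outcomes-bind (countLeft-≤ t) λ h h≤t → return (grow ⌊ i ∈? L T u ⌋ h≤t)
      where
      grow : ∀ b {h} → h ℕ.≤ t → (if b then suc h else h) ℕ.≤ suc t
      grow true  h≤t = ℕ.s≤s h≤t
      grow false h≤t = ℕ.m≤n⇒m≤1+n h≤t

    module _ (e δ′ : ℝ) (0<e : 0# < e) (e≤¼ : fromℕ 4 * e ≤ 1#) (0<δ′ : 0# < δ′) (δ′<1 : δ′ < 1#)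
      (t : ℕ) (enough-samples : fromℕ 2 * log (δ′ ⁻¹) ≤ fromℕ t * e * e) where

      private
        τ : ℝ
        τ = fromℕ t
        estimate : Law ℝ
        estimate = ⟦ bind (countLeft T u t) (λ h → return (fromℕ h / fromℕ t)) ⟧ μ
        W : ℕ → Bool
        W h = within e (fromℕ h / τ) r

        𝔼-estimate : ∀ g → 𝔼 estimate g ≡ 𝔹 t (λ h → g (fromℕ h / τ))
        𝔼-estimate g = trans (𝔼-bind μ (countLeft T u t) _ g)
          (trans (𝔼-cong (⟦ countLeft T u t ⟧ μ) (λ h → 𝔼-pure _ g)) (𝔼-countLeft t _))

        0<log : 0# < log (δ′ ⁻¹)
        0<log = <-≤-trans (x≤y⇒0≤y-x (proj₁ δ′<1) , λ 0≡1-δ′ → proj₂ δ′<1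
          (trans (solve 1 (λ d → d := κ 1 :- (κ 1 :- d)) refl δ′)
            (trans (cong (λ x → 1# - x) (sym 0≡1-δ′)) (solve 0 (κ 1 :- κ 0 := κ 1) refl))))
          (1-x≤log 0<δ′)

        τ≢0 : τ ≢ 0#
        τ≢0 τ≡0 = <⇒≱ (*-positive (0<fromℕ 1) 0<log) (≤-trans enough-samples
          (≤-reflexive (trans (cong (λ x → x * e * e) τ≡0)
            (solve 1 (λ e → κ 0 :* e :* e := κ 0) refl e))))

        0≤τ : 0# ≤ τ
        0≤τ = 0≤fromℕ t

        -- Deviations of the estimate h / τ from r are turned into those of h from
        -- τ r.
        deviation : ∀ h → τ * (fromℕ h / τ - r) ≡ fromℕ h - τ * r
        deviation h = trans (solve 3 (λ t x r → t :* (x :- r) := t :* x :- t :* r) refl τ (fromℕ h / τ) r)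
          (cong (_- τ * r) (*-/-cancel (fromℕ h) τ≢0))

        deviation′ : ∀ h → τ * (r - fromℕ h / τ) ≡ τ * r - fromℕ h
        deviation′ h = trans (solve 3 (λ t x r → t :* (r :- x) := t :* r :- t :* x) refl τ (fromℕ h / τ) r)
          (cong (λ x → τ * r - x) (*-/-cancel (fromℕ h) τ≢0))

        inside : ∀ h → W h ≡ true → τ * r - fromℕ h ≤ τ * e × fromℕ h - τ * r ≤ τ * e
        inside h eq with ∧-true {⌊ fromℕ h / τ - r ≤? e ⌋} eq
        ... | above , under =
          subst (_≤ τ * e) (deviation′ h) (*-monoʳ-≤ 0≤τ (≤?-true under)) ,
          subst (_≤ τ * e) (deviation h) (*-monoʳ-≤ 0≤τ (≤?-true above))

        outside : ∀ h → W h ≡ false → τ * e ≤ τ * r - fromℕ h ⊎ τ * e ≤ fromℕ h - τ * r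
        outside h eq with ∧-false {⌊ fromℕ h / τ - r ≤? e ⌋} eq
        ... | inj₁ above = inj₂ (subst (τ * e ≤_) (deviation h) (*-monoʳ-≤ 0≤τ (≤?-false above)))
        ... | inj₂ under = inj₁ (subst (τ * e ≤_) (deviation′ h) (*-monoʳ-≤ 0≤τ (≤?-false under)))

        y : ℝ
        y = half (τ * e * e)

        exp-y≤δ′ : exp (- y) ≤ δ′
        exp-y≤δ′ = subst (exp (- y) ≤_) (exp-log-neg 0<δ′) (exp-mono (neg-mono-≤
          (*-cancelˡ-≤ (0<fromℕ 1) (≤-trans enough-samples (≤-reflexive
            (trans (sym (half+half _)) (solve 1 (λ y → y :+ y := κ 2 :* y) refl y)))))))

      estimate-On : On InUnitInterval estimate
      estimate-On = On-⟦⟧ 0≤μ (Outcomes-bind (countLeft-≤ t) λ h h≤t → return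
        (*-nonNegative (0≤fromℕ h) (0≤x⁻¹ 0<τ) ,
         *-cancelˡ-≤ 0<τ (subst₂ _≤_ (sym (*-/-cancel (fromℕ h) τ≢0)) (sym (*-identityʳ τ)) (fromℕ-mono-≤ h≤t))))
        where
        0<τ : 0# < τ
        0<τ = 0≤τ , λ 0≡τ → τ≢0 (sym 0≡τ)

      estimate-total : total estimate ≡ 1#
      estimate-total = trans (𝔼-estimate (λ _ → 1#)) (𝔹-const t 1#)

      estimate-accurate : Pr estimate (λ x → within e x r) ≡ 0# ⊎
                          1# - δ′ ≤ Pr estimate (λ x → within e x r)
      estimate-accurate = conclude
        (BinomialTail.failure-bound r 0≤r r≤1 t e (proj₁ 0<e) e≤¼ W inside outside {y} (half+half _))
        where
        S : ℝ
        S = 𝔹 t (𝟙 ∘ W)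
        Pr≡S : Pr estimate (λ x → within e x r) ≡ S
        Pr≡S = trans (Pr-𝔼 estimate (λ x → within e x r)) (𝔼-estimate _)
        conclude : S ≡ 0# ⊎ 1# - S ≤ exp (- y) → Pr estimate (λ x → within e x r) ≡ 0# ⊎
                          1# - δ′ ≤ Pr estimate (λ x → within e x r)
        conclude (inj₁ S≡0)  = inj₁ (trans Pr≡S S≡0)
        conclude (inj₂ 1-S≤) = inj₂ (subst (1# - δ′ ≤_) (sym Pr≡S)
          (≤-by (x≤y⇒0≤y-x (≤-trans 1-S≤ exp-y≤δ′))
            (solve 2 (λ d s → d :- (κ 1 :- s) := s :- (κ 1 :- d)) refl δ′ S)))

  sampleSize-enough : ∀ {k n} (T : BalancedTree k n) {e δ′} → 0# < e →
    fromℕ 2 * log (δ′ ⁻¹) ≤ fromℕ (sampleSize T e δ′) * e * e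
  sampleSize-enough T {e} {δ′} 0<e = ≤-trans (≤-reflexive cancel)
    (*-monoˡ-≤ (proj₁ 0<e) (*-monoˡ-≤ (proj₁ 0<e) (≤⌈⌉ (fromℕ 2 * (e ⁻¹) ^ 2 * log (δ′ ⁻¹)))))
    where
    cancel : fromℕ 2 * log (δ′ ⁻¹) ≡ fromℕ 2 * (e ⁻¹) ^ 2 * log (δ′ ⁻¹) * e * e
    cancel = sym (trans (solve 3 (λ e f l → κ 2 :* (f :* (f :* κ 1)) :* l :* e :* e
        := κ 2 :* l :* ((e :* f) :* (e :* f))) refl e (e ⁻¹) (log (δ′ ⁻¹)))
      (trans (cong (λ x → fromℕ 2 * log (δ′ ⁻¹) * (x * x)) (*-inverse e (>⇒≢ 0<e)))
        (solve 1 (λ l → κ 2 :* l :* (κ 1 :* κ 1) := κ 2 :* l) refl (log (δ′ ⁻¹)))))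

-- Deferred estimation

module LazyLabels (𝓡 : RealNumbers) where
  open RealNumbers 𝓡
  open OverReals 𝓡
  open OrderedFieldProperties orderedField
  open RingSolver using (solve; _:+_; _:*_; _:-_; :-_; _:=_)
  open Laws 𝓡
  open Sampling 𝓡
  open Estimation 𝓡 using (𝔼-bind; InUnitInterval)

  toss-law : ℝ → Law Side
  toss-law p = (p , left) ∷ (1# - p , right) ∷ []

  opaque
    unfolding 𝔼

    𝔼-toss-law : ∀ p g → 𝔼 (toss-law p) g ≡ p * g left + (1# - p) * g right
    𝔼-toss-law p g = cong (p * g left +_) (+-identityʳ _)

  𝔼-toss : ∀ {A : Set} p (f : Side → Law A) g →
    𝔼 (toss-law p >>= f) g ≡ p * 𝔼 (f left) g + (1# - p) * 𝔼 (f right) g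
  𝔼-toss p f g = trans (𝔼->>= (toss-law p) f g) (𝔼-toss-law p (λ d → 𝔼 (f d) g))

  𝔼-bind-toss : ∀ {n} {A B : Set} μ (P : Alg n A) (p : A → ℝ) (h : A → Side → Alg n B) g →
    𝔼 (⟦ bind P (λ a → toss (p a) (h a)) ⟧ μ) g ≡
    𝔼 (⟦ P ⟧ μ) (λ a → p a * 𝔼 (⟦ h a left ⟧ μ) g + (1# - p a) * 𝔼 (⟦ h a right ⟧ μ) g)
  𝔼-bind-toss μ P p h g = trans (𝔼-bind μ P (λ a → toss (p a) (h a)) g)
    (𝔼-cong (⟦ P ⟧ μ) λ a → 𝔼-toss (p a) (λ d → ⟦ h a d ⟧ μ) g)

  recalled : Maybe ℝ → Law ℝ → Law ℝ
  recalled (just a) _ = pure a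
  recalled nothing  d = d

  module _ {k n : ℕ} (T : BalancedTree k n) where
    open Inverse T

    -- Walks and runs are defined for arbitrary laws of the estimates, because
    -- they are needed both for the raw and for the conditioned estimates.
    walkLaw : ∀ {m} → (Node m → Law ℝ) → Labels (Maybe ℝ) m →
      Law (Labels (Maybe ℝ) m × Leaf m × ℝ)
    walkLaw-below : ∀ {m} → (Node (suc m) → Law ℝ) →
      Labels (Maybe ℝ) m → Labels (Maybe ℝ) m → ℝ → Side →
      Law (Labels (Maybe ℝ) (suc m) × Leaf (suc m) × ℝ)
    walkLaw est ∅            = pure (∅ , [] , 1#)
    walkLaw est (node v l r) =
      recalled v (est root) >>= λ a → toss-law a >>= walkLaw-below est l r a
    walkLaw-below est l r a left =
      walkLaw (est ∘ below left) l >>= λ (l′ , w , η) →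
      pure (node (just a) l′ r , left ∷ w , a * η)
    walkLaw-below est l r a right =
      walkLaw (est ∘ below right) r >>= λ (r′ , w , η) →
      pure (node (just a) l r′ , right ∷ w , (1# - a) * η)

    runsLaw : (Node k → Law ℝ) → ∀ s → Labels (Maybe ℝ) k → Law (Vec (Fin n × ℝ) s)
    runsLaw est zero    σ = pure []
    runsLaw est (suc s) σ =
      walkLaw est σ     >>= λ (σ′ , w , η) →
      runsLaw est s σ′  >>= λ os →
      pure ((to w , η) ∷ os)

    𝔼-⟦walk⟧ : ∀ μ {m} (estimate : Node m → Alg n ℝ) σ g →
      𝔼 (⟦ walk T estimate σ ⟧ μ) g ≡ 𝔼 (walkLaw (λ u → ⟦ estimate u ⟧ μ) σ) g
    𝔼-⟦walk⟧ μ estimate ∅ g = refl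
    𝔼-⟦walk⟧ μ {suc m} estimate (node v l r) g = trans (𝔼-bind-toss μ (recall T v (estimate root)) _ _ g)
      (trans (recall-recalled v)
      (trans (𝔼-cong (recalled v est-root) λ a → trans
          (cong₂ (λ x y → a * x + (1# - a) * y)
            (trans (𝔼-bind μ (walk T (estimate ∘ below left) l) _ g)
              (trans (𝔼-⟦walk⟧ μ (estimate ∘ below left) l _) (sym (𝔼->>= (walkLaw _ l) _ g))))
            (trans (𝔼-bind μ (walk T (estimate ∘ below right) r) _ g)
              (trans (𝔼-⟦walk⟧ μ (estimate ∘ below right) r _) (sym (𝔼->>= (walkLaw _ r) _ g)))))
          (sym (𝔼-toss a (walkLaw-below est l r a) g)))
        (sym (𝔼->>= (recalled v est-root) _ g))))
      where
      est : Node (suc m) → Law ℝ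
      est u = ⟦ estimate u ⟧ μ
      est-root : Law ℝ
      est-root = ⟦ estimate root ⟧ μ
      recall-recalled : ∀ v {g} → 𝔼 (⟦ recall T v (estimate root) ⟧ μ) g ≡ 𝔼 (recalled v est-root) g
      recall-recalled (just a) = refl
      recall-recalled nothing  = refl

    𝔼-⟦runs⟧ : ∀ μ ε δ s₀ s σ g →
      𝔼 (⟦ PersistentAlgorithm.runsFrom (persistentSampler T ε δ s₀) s σ ⟧ μ) g ≡
      𝔼 (runsLaw (λ u → ⟦ ratioEstimator T (accuracy ε k) (δ / (fromℕ s₀ * fromℕ k)) u ⟧ μ) s σ) g
    𝔼-⟦runs⟧ μ ε δ s₀ zero    σ g = refl
    𝔼-⟦runs⟧ μ ε δ s₀ (suc s) σ g = begin
      𝔼 (⟦ bind (run σ) _ ⟧ μ) g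
        ≡⟨ 𝔼-bind μ (run σ) _ g ⟩
      𝔼 (⟦ bind (walk T estimator σ) _ ⟧ μ) _
        ≡⟨ 𝔼-bind μ (walk T estimator σ) _ _ ⟩
      𝔼 (⟦ walk T estimator σ ⟧ μ) _
        ≡⟨ 𝔼-⟦walk⟧ μ estimator σ _ ⟩
      𝔼 (walkLaw est σ) _
        ≡⟨ 𝔼-cong (walkLaw est σ) (λ (σ′ , w , η) → trans (𝔼-pure (σ′ , to w , η) _)
             (trans (𝔼-bind μ (runsFrom s σ′) _ g)
             (trans (𝔼-⟦runs⟧ μ ε δ s₀ s σ′ _)
             (sym (𝔼->>= (runsLaw est s σ′) _ g))))) ⟩
      𝔼 (walkLaw est σ) _
        ≡⟨ sym (𝔼->>= (walkLaw est σ) _ g) ⟩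
      𝔼 (runsLaw est (suc s) σ) g ∎
      where
      open ≡-Reasoning
      open PersistentAlgorithm (persistentSampler T ε δ s₀)
      estimator : Node k → Alg n ℝ
      estimator = ratioEstimator T (accuracy ε k) (δ / (fromℕ s₀ * fromℕ k))
      est : Node k → Law ℝ
      est u = ⟦ estimator u ⟧ μ

    -- The labels that would result if all nodes that are still unset were now
    -- estimated at once.
    complete : ∀ {m} → (Node m → Law ℝ) → Labels (Maybe ℝ) m → Law (Labels ℝ m)
    complete est ∅            = pure ∅
    complete est (node v l r) =
      recalled v (est root)           >>= λ a →
      complete (est ∘ below left)  l  >>= λ α →
      complete (est ∘ below right) r  >>= λ β →
      pure (node a α β)

    𝔼-complete-node : ∀ {m} (est : Node (suc m) → Law ℝ) v l r g →
      𝔼 (complete est (node v l r)) g ≡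
      𝔼 (recalled v (est root)) (λ a →
        𝔼 (complete (est ∘ below left) l) (λ α →
          𝔼 (complete (est ∘ below right) r) (λ β → g (node a α β))))
    𝔼-complete-node est v l r g = trans (𝔼->>= (recalled v (est root)) _ g)
      (𝔼-cong (recalled v (est root)) λ a → trans (𝔼->>= (complete _ l) _ g)
        (𝔼-cong (complete _ l) λ α → trans (𝔼->>= (complete _ r) _ g)
          (𝔼-cong (complete _ r) λ β → 𝔼-pure _ g)))

    complete-fill : ∀ {m} (est : Node m → Law ℝ) g →
      𝔼 (complete est (fill nothing)) g ≡ 𝔼 (independently est) g
    complete-fill {zero}  est g = refl
    complete-fill {suc m} est g = trans (𝔼-complete-node est nothing (fill nothing) (fill nothing) g)
      (sym (trans (𝔼->>= (est root) _ g)
        (𝔼-cong (est root) λ a → trans (𝔼->>= (independently _) _ g)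
          (trans (𝔼-cong (independently _) λ α → trans (𝔼->>= (independently _) _ g)
            (trans (𝔼-cong (independently _) λ β → 𝔼-pure _ g)
              (sym (complete-fill (est ∘ below right) _))))
            (sym (complete-fill (est ∘ below left) _))))))

    complete-total : ∀ {m} (est : Node m → Law ℝ) → (∀ u → total (est u) ≡ 1#) → ∀ σ →
      total (complete est σ) ≡ 1#
    complete-total est est-total ∅            = 𝔼-pure ∅ (λ _ → 1#)
    complete-total est est-total (node v l r) = trans (𝔼-complete-node est v l r (λ _ → 1#))
      (trans (𝔼-cong (recalled v (est root)) λ a →
        trans (𝔼-const (complete _ l) _ (complete-total _ (est-total ∘ below left) l))
          (complete-total _ (est-total ∘ below right) r))
        (recalled-total v))
      where
      recalled-total : ∀ v → total (recalled v (est root)) ≡ 1#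
      recalled-total (just a) = 𝔼-pure a (λ _ → 1#)
      recalled-total nothing  = est-total root

    -- The expected value of g at a leaf drawn according to the labels, together
    -- with the probability of that leaf.
    leaf-sample : ∀ {m} → Labels ℝ m → (Leaf m → ℝ → ℝ) → ℝ
    leaf-sample {m} α g = ∑-leaves m (λ w → pathProduct T α w * g w (pathProduct T α w))

    leaf-sample-node : ∀ {m} a (α β : Labels ℝ m) g →
      leaf-sample (node a α β) g ≡
      a * leaf-sample α (λ w η → g (left ∷ w) (a * η)) +
      (1# - a) * leaf-sample β (λ w η → g (right ∷ w) ((1# - a) * η))
    leaf-sample-node {m} a α β g = trans (∑-leaves-suc (λ w → pathProduct T (node a α β) w * g w (pathProduct T (node a α β) w))) (cong₂ _+_
      (trans (𝔼-cong (counting (leaves m)) (λ w → *-assoc a _ _)) (𝔼-* (counting (leaves m)) a _))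
      (trans (𝔼-cong (counting (leaves m)) (λ w → *-assoc (1# - a) _ _)) (𝔼-* (counting (leaves m)) (1# - a) _)))

    leaf-sample-swap : ∀ {m} {A : Set} (α : Labels ℝ m) (d : Law A) (g : Leaf m → ℝ → A → ℝ) →
      leaf-sample α (λ w η → 𝔼 d (g w η)) ≡ 𝔼 d (λ a → leaf-sample α (λ w η → g w η a))
    leaf-sample-swap {m} α d g = trans
      (𝔼-cong (counting (leaves m)) (λ w → sym (𝔼-* d (pathProduct T α w) _)))
      (𝔼-swap (counting (leaves m)) d _)

    -- A walk that estimates on demand, followed by the estimation of all
    -- remaining nodes, is the estimation of all nodes followed by a walk:
    -- the estimates of nodes off the path commute with the walk.
    walk-complete : ∀ {m} (est : Node m → Law ℝ) σ (g : Labels ℝ m → Leaf m → ℝ → ℝ) →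
      𝔼 (walkLaw est σ) (λ (σ′ , w , η) → 𝔼 (complete est σ′) (λ α → g α w η)) ≡
      𝔼 (complete est σ) (λ α → leaf-sample α (g α))
    walk-complete est ∅ g = trans (𝔼-pure (∅ , [] , 1#) _) (𝔼-cong (pure ∅) λ where
      ∅ → sym (trans (𝔼-pure [] _) (*-identityˡ _)))
    walk-complete {suc m} est (node v l r) g = begin
      𝔼 (walkLaw est (node v l r)) G
        ≡⟨ 𝔼->>= (recalled v (est root)) _ G ⟩
      𝔼 (recalled v (est root)) (λ a → 𝔼 (toss-law a >>= walkLaw-below est l r a) G)
        ≡⟨ 𝔼-cong (recalled v (est root)) (λ a → trans (𝔼-toss a (walkLaw-below est l r a) G)
             (trans (cong₂ (λ x y → a * x + (1# - a) * y) (go-left a) (go-right a)) (merge a))) ⟩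
      𝔼 (recalled v (est root)) (λ a → 𝔼 cˡ (λ α → 𝔼 cʳ (λ β → leaf-sample (node a α β) (g (node a α β)))))
        ≡⟨ sym (𝔼-complete-node est v l r _) ⟩
      𝔼 (complete est (node v l r)) (λ α → leaf-sample α (g α)) ∎
      where
      open ≡-Reasoning
      G : Labels (Maybe ℝ) (suc m) × Leaf (suc m) × ℝ → ℝ
      G (σ′ , w , η) = 𝔼 (complete est σ′) (λ α → g α w η)
      cˡ cʳ : Law (Labels ℝ m)
      cˡ = complete (est ∘ below left) l
      cʳ = complete (est ∘ below right) r
      gˡ gʳ : ℝ → Labels ℝ m → Labels ℝ m → Leaf m → ℝ → ℝ
      gˡ a α β w η = g (node a α β) (left ∷ w) (a * η)
      gʳ a α β w η = g (node a α β) (right ∷ w) ((1# - a) * η)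
      complete-set : ∀ a l′ r′ w η → 𝔼 (complete est (node (just a) l′ r′)) (λ α → g α w η) ≡
        𝔼 (complete (est ∘ below left) l′) (λ α → 𝔼 (complete (est ∘ below right) r′) (λ β → g (node a α β) w η))
      complete-set a l′ r′ w η = trans (𝔼-complete-node est (just a) l′ r′ _) (𝔼-pure a _)
      go-left : ∀ a → 𝔼 (walkLaw-below est l r a left) G ≡ 𝔼 cˡ (λ α → 𝔼 cʳ (λ β → leaf-sample α (gˡ a α β)))
      go-left a = begin
        𝔼 (walkLaw-below est l r a left) G
          ≡⟨ 𝔼->>= (walkLaw (est ∘ below left) l) _ G ⟩
        𝔼 (walkLaw (est ∘ below left) l) (λ (l′ , w , η) → 𝔼 (pure (node (just a) l′ r , left ∷ w , a * η)) G)
          ≡⟨ 𝔼-cong (walkLaw (est ∘ below left) l) (λ (l′ , w , η) →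
               trans (𝔼-pure (node (just a) l′ r , left ∷ w , a * η) G) (complete-set a l′ r (left ∷ w) (a * η))) ⟩
        𝔼 (walkLaw (est ∘ below left) l) (λ (l′ , w , η) →
          𝔼 (complete (est ∘ below left) l′) (λ α → 𝔼 cʳ (λ β → gˡ a α β w η)))
          ≡⟨ walk-complete (est ∘ below left) l (λ α w η → 𝔼 cʳ (λ β → gˡ a α β w η)) ⟩
        𝔼 cˡ (λ α → leaf-sample α (λ w η → 𝔼 cʳ (λ β → gˡ a α β w η)))
          ≡⟨ 𝔼-cong cˡ (λ α → leaf-sample-swap α cʳ (λ w η β → gˡ a α β w η)) ⟩
        𝔼 cˡ (λ α → 𝔼 cʳ (λ β → leaf-sample α (gˡ a α β))) ∎
      go-right : ∀ a → 𝔼 (walkLaw-below est l r a right) G ≡ 𝔼 cˡ (λ α → 𝔼 cʳ (λ β → leaf-sample β (gʳ a α β)))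
      go-right a = begin
        𝔼 (walkLaw-below est l r a right) G
          ≡⟨ 𝔼->>= (walkLaw (est ∘ below right) r) _ G ⟩
        𝔼 (walkLaw (est ∘ below right) r) (λ (r′ , w , η) → 𝔼 (pure (node (just a) l r′ , right ∷ w , (1# - a) * η)) G)
          ≡⟨ 𝔼-cong (walkLaw (est ∘ below right) r) (λ (r′ , w , η) →
               trans (𝔼-pure (node (just a) l r′ , right ∷ w , (1# - a) * η) G) (trans (complete-set a l r′ (right ∷ w) ((1# - a) * η))
                 (𝔼-swap cˡ (complete (est ∘ below right) r′) _))) ⟩
        𝔼 (walkLaw (est ∘ below right) r) (λ (r′ , w , η) →
          𝔼 (complete (est ∘ below right) r′) (λ β → 𝔼 cˡ (λ α → gʳ a α β w η)))
          ≡⟨ walk-complete (est ∘ below right) r (λ β w η → 𝔼 cˡ (λ α → gʳ a α β w η)) ⟩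
        𝔼 cʳ (λ β → leaf-sample β (λ w η → 𝔼 cˡ (λ α → gʳ a α β w η)))
          ≡⟨ 𝔼-cong cʳ (λ β → leaf-sample-swap β cˡ (λ w η α → gʳ a α β w η)) ⟩
        𝔼 cʳ (λ β → 𝔼 cˡ (λ α → leaf-sample β (gʳ a α β)))
          ≡⟨ 𝔼-swap cʳ cˡ _ ⟩
        𝔼 cˡ (λ α → 𝔼 cʳ (λ β → leaf-sample β (gʳ a α β))) ∎
      merge : ∀ a →
        a * 𝔼 cˡ (λ α → 𝔼 cʳ (λ β → leaf-sample α (gˡ a α β))) +
        (1# - a) * 𝔼 cˡ (λ α → 𝔼 cʳ (λ β → leaf-sample β (gʳ a α β))) ≡
        𝔼 cˡ (λ α → 𝔼 cʳ (λ β → leaf-sample (node a α β) (g (node a α β))))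
      merge a = sym (trans
        (𝔼-cong cˡ λ α → trans (𝔼-cong cʳ λ β → leaf-sample-node a α β (g (node a α β)))
          (trans (𝔼-+ cʳ _ _) (cong₂ _+_ (𝔼-* cʳ a _) (𝔼-* cʳ (1# - a) _))))
        (trans (𝔼-+ cˡ _ _) (cong₂ _+_ (𝔼-* cˡ a _) (𝔼-* cˡ (1# - a) _))))

    𝔼-sample-reconstituted : ∀ (α : Labels ℝ k) (g : Fin n → ℝ → ℝ) →
      𝔼 (sample (reconstituted T α)) (λ i → g i (reconstituted T α i)) ≡
      leaf-sample α (λ w η → g (to w) η)
    𝔼-sample-reconstituted α g = trans (𝔼-sample (reconstituted T α) _)
      (trans (sum-cong λ i → cong (λ j → reconstituted T α i * g j (reconstituted T α i)) (sym (strictlyInverseˡ i)))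
        (sum-over-leaves T (λ w → pathProduct T α w * g (to w) (pathProduct T α w))))
      where
      sum-cong : ∀ {m} {f h : Fin m → ℝ} → (∀ i → f i ≡ h i) → sum f ≡ sum h
      sum-cong {zero}  f≗h = refl
      sum-cong {suc m} f≗h = cong₂ _+_ (f≗h Fin.zero) (sum-cong (f≗h ∘ Fin.suc))

    outputs : ∀ {s} → MassFunction n → Vec (Fin n) s → Vec (Fin n × ℝ) s
    outputs μ̃ = Vec.map (λ i → i , μ̃ i)

    -- Once all nodes are estimated the runs are independent walks with fixed
    -- labels; `walk-complete` moves the estimation before one run at a time.
    runs-complete : ∀ (est : Node k → Law ℝ) → (∀ u → total (est u) ≡ 1#) → ∀ s σ g →
      𝔼 (runsLaw est s σ) g ≡
      𝔼 (complete est σ) (λ α → 𝔼 (samples s (reconstituted T α)) (g ∘ outputs (reconstituted T α)))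
    runs-complete est est-total zero σ g = trans (𝔼-pure [] g)
      (sym (trans (𝔼-cong (complete est σ) (λ α → 𝔼-pure [] _))
        (𝔼-const (complete est σ) (g []) (complete-total est est-total σ))))
    runs-complete est est-total (suc s) σ g = begin
      𝔼 (runsLaw est (suc s) σ) g
        ≡⟨ 𝔼->>= (walkLaw est σ) _ g ⟩
      𝔼 (walkLaw est σ) (λ (σ′ , w , η) → 𝔼 (runsLaw est s σ′ >>= λ os → pure ((to w , η) ∷ os)) g)
        ≡⟨ 𝔼-cong (walkLaw est σ) (λ (σ′ , w , η) → trans (𝔼->>= (runsLaw est s σ′) _ g)
             (trans (𝔼-cong (runsLaw est s σ′) (λ os → 𝔼-pure _ g))
               (runs-complete est est-total s σ′ _))) ⟩
      𝔼 (walkLaw est σ) (λ (σ′ , w , η) → 𝔼 (complete est σ′) (λ α → later α (to w) η))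
        ≡⟨ walk-complete est σ (λ α w η → later α (to w) η) ⟩
      𝔼 (complete est σ) (λ α → leaf-sample α (λ w η → later α (to w) η))
        ≡⟨ 𝔼-cong (complete est σ) (λ α → sym (𝔼-sample-reconstituted α (later α))) ⟩
      𝔼 (complete est σ) (λ α → 𝔼 (sample (reconstituted T α)) (λ i → later α i (reconstituted T α i)))
        ≡⟨ 𝔼-cong (complete est σ) (λ α → sym (trans (𝔼->>= (sample (reconstituted T α)) _ _)
             (𝔼-cong (sample (reconstituted T α)) λ i → trans (𝔼->>= (samples s (reconstituted T α)) _ _)
               (𝔼-cong (samples s (reconstituted T α)) λ is → 𝔼-pure _ _)))) ⟩
      𝔼 (complete est σ) (λ α → 𝔼 (samples (suc s) (reconstituted T α)) (g ∘ outputs (reconstituted T α))) ∎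
      where
      open ≡-Reasoning
      later : Labels ℝ k → Fin n → ℝ → ℝ
      later α i η = 𝔼 (samples s (reconstituted T α)) (λ is → g ((i , η) ∷ outputs (reconstituted T α) is))

    explicit-runs : ∀ (est : Node k → Law ℝ) → (∀ u → total (est u) ≡ 1#) → ∀ s (g : Vec (Fin n × ℝ) s → ℝ) →
      𝔼 (explicitSamples s (mapLaw (reconstituted T) (independently est))) (g ∘ proj₂) ≡
      𝔼 (runsLaw est s (fill nothing)) g
    explicit-runs est est-total s g = trans (𝔼->>= (mapLaw (reconstituted T) (independently est)) _ _)
      (trans (𝔼-mapLaw (reconstituted T) (independently est) _)
      (trans (𝔼-cong (independently est) λ α → trans (𝔼->>= (samples s (reconstituted T α)) _ _)
          (𝔼-cong (samples s (reconstituted T α)) λ is → 𝔼-pure _ _))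
      (trans (sym (complete-fill est _)) (sym (runs-complete est est-total s (fill nothing) g)))))

    leaf-sample-total : ∀ {m} (α : Labels ℝ m) → leaf-sample α (λ _ _ → 1#) ≡ 1#
    leaf-sample-total ∅            = trans (𝔼-pure [] _) (*-identityˡ 1#)
    leaf-sample-total (node a α β) = trans (leaf-sample-node a α β (λ _ _ → 1#))
      (trans (cong₂ (λ x y → a * x + (1# - a) * y) (leaf-sample-total α) (leaf-sample-total β))
        (solve 1 (λ a → a :* κ 1 :+ (κ 1 :- a) :* κ 1 := κ 1) refl a))

    samples-total : ∀ s (α : Labels ℝ k) → total (samples s (reconstituted T α)) ≡ 1#
    samples-total zero    α = 𝔼-pure [] (λ _ → 1#)
    samples-total (suc s) α = trans (𝔼->>= (sample (reconstituted T α)) _ _)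
      (trans (𝔼-cong (sample (reconstituted T α)) λ i → trans (𝔼->>= (samples s (reconstituted T α)) _ _)
        (trans (𝔼-cong (samples s (reconstituted T α)) (λ is → 𝔼-pure _ _)) (samples-total s α)))
      (trans (𝔼-sample-reconstituted α (λ _ _ → 1#)) (leaf-sample-total α)))

    runs-total : ∀ (est : Node k → Law ℝ) → (∀ u → total (est u) ≡ 1#) → ∀ s σ → total (runsLaw est s σ) ≡ 1#
    runs-total est est-total s σ = trans (runs-complete est est-total s σ (λ _ → 1#))
      (trans (𝔼-cong (complete est σ) (samples-total s)) (complete-total est est-total σ))

    data Valid : ∀ {m} → Labels (Maybe ℝ) m → Set where
      ∅     : Valid ∅
      set   : ∀ {m a} {l r : Labels (Maybe ℝ) m} → InUnitInterval a → Valid l → Valid r → Valid (node (just a) l r)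
      unset : ∀ {m} {l r : Labels (Maybe ℝ) m} → Valid l → Valid r → Valid (node nothing l r)

    Valid-fill : ∀ m → Valid {m} (fill nothing)
    Valid-fill zero    = ∅
    Valid-fill (suc m) = unset (Valid-fill m) (Valid-fill m)

    ^-InUnitInterval : ∀ {c} → InUnitInterval c → ∀ m → InUnitInterval (c ^ m)
    ^-InUnitInterval c∈ zero = 0≤1 , ≤-refl
    ^-InUnitInterval {c} c∈@(0≤c , c≤1) (suc m) with ^-InUnitInterval c∈ m
    ... | 0≤cᵐ , cᵐ≤1 = *-nonNegative 0≤c 0≤cᵐ ,
      ≤-trans (*-monoʳ-≤ 0≤c cᵐ≤1) (subst (_≤ 1#) (sym (*-identityʳ c)) c≤1)

    module _ (c : ℝ) (c∈ : InUnitInterval c) where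

      private
        0≤^ : ∀ m → 0# ≤ c ^ m
        0≤^ m = proj₁ (^-InUnitInterval c∈ m)

      -- A walk visits m nodes, and each visit costs at most a factor c: none if
      -- the node has been estimated before.
      walk-dominates : ∀ {m} (est est′ : Node m → Law ℝ) →
        (∀ u → Dominates InUnitInterval c (est u) (est′ u)) → ∀ {σ} → Valid σ →
        Dominates (Valid ∘ proj₁) (c ^ m) (walkLaw est σ) (walkLaw est′ σ)
      walk-dominates est est′ dom ∅ = dominates-refl (On-pure ∅)
      walk-dominates {suc m} est est′ dom {node v l r} valid =
        dominates->>= {c′ = c ^ m} (0≤^ m) (recalled-dominates valid) λ a a∈ →
          subst (λ c′ → Dominates _ c′ _ _) (*-identityˡ (c ^ m))
            (dominates->>= {P = λ _ → ⊤} {c = 1#} (0≤^ m) (dominates-refl (toss-On a∈)) λ d _ → below-dominates a∈ d)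
        where
        subtrees : ∀ {v} → Valid (node v l r) → Valid l × Valid r
        subtrees (set _ vl vr) = vl , vr
        subtrees (unset vl vr) = vl , vr
        recalled-dominates : ∀ {v} → Valid (node v l r) →
          Dominates InUnitInterval c (recalled v (est root)) (recalled v (est′ root))
        recalled-dominates (set a∈ _ _) = dominates-weaken (proj₂ c∈) (dominates-refl (On-pure a∈))
        recalled-dominates (unset _ _)  = dom root
        toss-On : ∀ {a} → InUnitInterval a → On (λ _ → ⊤) (toss-law a)
        toss-On (0≤a , a≤1) = (0≤a , tt) ∷ (x≤y⇒0≤y-x a≤1 , tt) ∷ []
        below-dominates : ∀ {a} → InUnitInterval a → ∀ d →
          Dominates (Valid ∘ proj₁) (c ^ m) (walkLaw-below est l r a d) (walkLaw-below est′ l r a d)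
        below-dominates a∈ left = subst (λ c′ → Dominates _ c′ _ _) (*-identityʳ (c ^ m))
          (dominates->>= {c′ = 1#} 0≤1 (walk-dominates _ _ (dom ∘ below left) (proj₁ (subtrees valid)))
            λ _ valid-l′ → dominates-refl (On-pure (set a∈ valid-l′ (proj₂ (subtrees valid)))))
        below-dominates a∈ right = subst (λ c′ → Dominates _ c′ _ _) (*-identityʳ (c ^ m))
          (dominates->>= {c′ = 1#} 0≤1 (walk-dominates _ _ (dom ∘ below right) (proj₂ (subtrees valid)))
            λ _ valid-r′ → dominates-refl (On-pure (set a∈ (proj₁ (subtrees valid)) valid-r′)))

      runs-dominates : ∀ (est est′ : Node k → Law ℝ) →
        (∀ u → Dominates InUnitInterval c (est u) (est′ u)) → ∀ s {σ} → Valid σ →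
        Dominates (λ _ → ⊤) ((c ^ k) ^ s) (runsLaw est s σ) (runsLaw est′ s σ)
      runs-dominates est est′ dom zero    valid = dominates-refl (On-pure tt)
      runs-dominates est est′ dom (suc s) valid =
        dominates->>= {c = c ^ k} {c′ = (c ^ k) ^ s} (proj₁ (^-InUnitInterval (^-InUnitInterval c∈ k) s))
          (walk-dominates est est′ dom valid) λ _ valid′ →
          subst (λ c′ → Dominates _ c′ _ _) (*-identityʳ _)
            (dominates->>= {c′ = 1#} 0≤1 (runs-dominates est est′ dom s valid′) λ _ _ → dominates-refl (On-pure tt))

-- The number of samples

module SampleCount (𝓡 : RealNumbers) where
  open RealNumbers 𝓡
  open OverReals 𝓡
  open OrderedFieldProperties orderedField
  open RingSolver using (solve; _:+_; _:*_; _:-_; :-_; _:=_)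
  open Estimation 𝓡 using (0≤log)

  bind-uses : ∀ {n} {A B : Set} (P : Alg n A) (f : A → Alg n B) {m} → bind P f Uses m →
    ∃ λ m₁ → ∃ λ m₂ → ∃ λ a → P Uses m₁ × f a Uses m₂ × m ≡ m₁ ℕ.+ m₂
  bind-uses (return a) f uses = 0 , _ , a , return , uses , refl
  bind-uses (condSample S z g) f (condSample {i = i} i∈S uses) with bind-uses (g i) f uses
  ... | m₁ , m₂ , a , uses₁ , uses₂ , refl = suc m₁ , m₂ , a , condSample i∈S uses₁ , uses₂ , refl
  bind-uses (toss p g) f (toss {d = d} uses) with bind-uses (g d) f uses
  ... | m₁ , m₂ , a , uses₁ , uses₂ , refl = m₁ , m₂ , a , toss uses₁ , uses₂ , refl

  bind-return-uses : ∀ {n} {A B : Set} (P : Alg n A) {f : A → B} {m} →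
    bind P (λ a → return (f a)) Uses m → P Uses m
  bind-return-uses P {f} uses with bind-uses P (λ a → Alg.return (f a)) uses
  ... | m₁ , .0 , a , uses₁ , return , refl = subst (P Uses_) (sym (ℕ.+-identityʳ m₁)) uses₁

  module _ {k n : ℕ} (T : BalancedTree k n) where

    countLeft-uses : ∀ u t {m} → countLeft T u t Uses m → m ≡ t
    countLeft-uses u zero    return                = refl
    countLeft-uses u (suc t) (condSample _ uses) =
      cong suc (countLeft-uses u t (bind-return-uses (countLeft T u t) uses))

    ratioEstimator-uses : ∀ ε′ δ′ u {m} → ratioEstimator T ε′ δ′ u Uses m → m ≡ sampleSize T ε′ δ′
    ratioEstimator-uses ε′ δ′ u uses =
      countLeft-uses u _ (bind-return-uses (countLeft T u (sampleSize T ε′ δ′)) uses)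

    recall-uses : ∀ {t e} v → (∀ {m} → e Uses m → m ≡ t) → ∀ {m} → recall T v e Uses m → m ℕ.≤ t
    recall-uses (just a) e-uses return = ℕ.z≤n
    recall-uses nothing  e-uses uses   = ℕ.≤-reflexive (e-uses uses)

    -- A walk meets one node per level, and samples only at those not yet set.
    walk-uses-≤ : ∀ {t d} (estimate : Node d → Alg n ℝ) → (∀ u {m} → estimate u Uses m → m ≡ t) →
      ∀ σ {m} → walk T estimate σ Uses m → m ℕ.≤ d ℕ.* t
    walk-uses-≤ estimate est-uses ∅ return = ℕ.z≤n
    walk-uses-≤ {t} estimate est-uses (node v l r) uses with bind-uses (recall T v (estimate root)) _ uses
    ... | m₁ , m₂ , a , uses₁ , toss {d = left} uses₂ , refl = ℕ.+-mono-≤ (recall-uses v (est-uses root) uses₁)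
      (walk-uses-≤ (estimate ∘ below left) (est-uses ∘ below left) l (bind-return-uses (walk T (estimate ∘ below left) l) uses₂))
    ... | m₁ , m₂ , a , uses₁ , toss {d = right} uses₂ , refl = ℕ.+-mono-≤ (recall-uses v (est-uses root) uses₁)
      (walk-uses-≤ (estimate ∘ below right) (est-uses ∘ below right) r (bind-return-uses (walk T (estimate ∘ below right) r) uses₂))

    -- Every subtree that the walk enters is as unset as the whole tree.
    walk-uses-≡ : ∀ {t d} (estimate : Node d → Alg n ℝ) → (∀ u {m} → estimate u Uses m → m ≡ t) →
      ∀ {m} → walk T estimate (fill nothing) Uses m → m ≡ d ℕ.* t
    walk-uses-≡ {d = zero}  estimate est-uses return = refl
    walk-uses-≡ {d = suc d} estimate est-uses uses with bind-uses (estimate root) _ uses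
    ... | m₁ , m₂ , a , uses₁ , toss {d = left} uses₂ , refl = cong₂ ℕ._+_ (est-uses root uses₁)
      (walk-uses-≡ (estimate ∘ below left) (est-uses ∘ below left) (bind-return-uses (walk T (estimate ∘ below left) (fill nothing)) uses₂))
    ... | m₁ , m₂ , a , uses₁ , toss {d = right} uses₂ , refl = cong₂ ℕ._+_ (est-uses root uses₁)
      (walk-uses-≡ (estimate ∘ below right) (est-uses ∘ below right) (bind-return-uses (walk T (estimate ∘ below right) (fill nothing)) uses₂))

  -- With e = (ε / 2 k)² and δ′ = δ / (s k), the unrounded sample size
  -- 2 e⁻² log (1 / δ′) of a node is 32 (k / ε)⁴ log (s k / δ).
  module _ {ε δ : ℝ} (0<ε : 0# < ε) (0<δ : 0# < δ) (k′ s′ : ℕ) where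
    private
      k s : ℝ
      k = fromℕ (suc k′)
      s = fromℕ (suc s′)
      0<k : 0# < k
      0<k = 0<fromℕ k′
      0<s : 0# < s
      0<s = 0<fromℕ s′
      e δ′ : ℝ
      e = accuracy ε (suc k′)
      δ′ = δ / (s * k)

    failure-⁻¹ : δ′ ⁻¹ ≡ s * δ ⁻¹ * k
    failure-⁻¹ = sym (⁻¹-unique (begin
      δ / (s * k) * (s * δ ⁻¹ * k)
        ≡⟨ solve 5 (λ d i s f k → d :* i :* (s :* f :* k) := (d :* f) :* ((s :* k) :* i)) refl δ ((s * k) ⁻¹) s (δ ⁻¹) k ⟩
      (δ * δ ⁻¹) * ((s * k) * (s * k) ⁻¹)
        ≡⟨ cong₂ _*_ (*-inverse δ (>⇒≢ 0<δ)) (*-inverse (s * k) (>⇒≢ (*-positive 0<s 0<k))) ⟩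
      1# * 1#  ≡⟨ *-identityˡ 1# ⟩
      1#       ∎))
      where open ≡-Reasoning

    accuracy-⁻¹ : e ⁻¹ ≡ (fromℕ 2 * k * ε ⁻¹) * (fromℕ 2 * k * ε ⁻¹)
    accuracy-⁻¹ = sym (⁻¹-unique (begin
      (ε / (fromℕ 2 * k)) ^ 2 * ((fromℕ 2 * k * ε ⁻¹) * (fromℕ 2 * k * ε ⁻¹))
        ≡⟨ solve 4 (λ x j q y → (x :* j) :* ((x :* j) :* κ 1) :* ((q :* y) :* (q :* y))
             := ((x :* y) :* (q :* j)) :* ((x :* y) :* (q :* j))) refl ε ((fromℕ 2 * k) ⁻¹) (fromℕ 2 * k) (ε ⁻¹) ⟩
      ((ε * ε ⁻¹) * (fromℕ 2 * k * (fromℕ 2 * k) ⁻¹)) * ((ε * ε ⁻¹) * (fromℕ 2 * k * (fromℕ 2 * k) ⁻¹))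
        ≡⟨ cong (λ x → x * x) (cong₂ _*_ (*-inverse ε (>⇒≢ 0<ε)) (*-inverse _ (>⇒≢ (*-positive (0<fromℕ 1) 0<k)))) ⟩
      (1# * 1#) * (1# * 1#)  ≡⟨ solve 0 ((κ 1 :* κ 1) :* (κ 1 :* κ 1) := κ 1) refl ⟩
      1#                     ∎))
      where open ≡-Reasoning

    exact : ℝ
    exact = fromℕ 2 * (e ⁻¹) ^ 2 * log (δ′ ⁻¹)

    total-size : fromℕ 32 * (ε ⁻¹) ^ 4 * k ^ 5 * log (s * δ ⁻¹ * k) ≡ k * exact
    total-size = sym (begin
      k * (fromℕ 2 * (e ⁻¹) ^ 2 * log (δ′ ⁻¹))
        ≡⟨ cong₂ (λ x y → k * (fromℕ 2 * x ^ 2 * log y)) accuracy-⁻¹ failure-⁻¹ ⟩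
      k * (fromℕ 2 * (z * z) ^ 2 * ℓ)
        ≡⟨ solve 3 (λ k y l →
             k :* (κ 2 :* ((κ 2 :* k :* y) :* (κ 2 :* k :* y) :* ((κ 2 :* k :* y) :* (κ 2 :* k :* y) :* κ 1)) :* l)
             := κ 32 :* (y :* (y :* (y :* (y :* κ 1)))) :* (k :* (k :* (k :* (k :* (k :* κ 1))))) :* l) refl k (ε ⁻¹) ℓ ⟩
      fromℕ 32 * (ε ⁻¹) ^ 4 * k ^ 5 * log (s * δ ⁻¹ * k) ∎)
      where
      open ≡-Reasoning
      z ℓ : ℝ
      z = fromℕ 2 * k * ε ⁻¹
      ℓ = log (s * δ ⁻¹ * k)

    0≤exact : 0# < δ′ → δ′ ≤ 1# → 0# ≤ exact
    0≤exact 0<δ′ δ′≤1 = *-nonNegative (*-nonNegative (0≤fromℕ 2) (subst (0# ≤_)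
      (solve 1 (λ f → f :* f := f :* (f :* κ 1)) refl (e ⁻¹)) (square-nonNegative (e ⁻¹)))) (0≤log 0<δ′ δ′≤1)

-- The persistent sampler

module Assembly (𝓡 : RealNumbers) where
  open RealNumbers 𝓡
  open OverReals 𝓡
  open OrderedFieldProperties orderedField
  open RingSolver using (solve; _:+_; _:*_; _:-_; :-_; _:=_)
  open Concentration orderedField using (𝟙)
  open Ceiling 𝓡
  open Laws 𝓡
  open Sampling 𝓡
  open Estimation 𝓡
  open LazyLabels 𝓡
  open SampleCount 𝓡

  bernoulli-inequality : ∀ {d} → 0# ≤ d → d ≤ 1# → ∀ m → 1# - fromℕ m * d ≤ (1# - d) ^ m
  bernoulli-inequality {d} 0≤d d≤1 zero = ≤-reflexive (solve 1 (λ d → κ 1 :- κ 0 :* d := κ 1) refl d)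
  bernoulli-inequality {d} 0≤d d≤1 (suc m) = ≤-trans
    (≤-by (*-nonNegative (0≤fromℕ m) (square-nonNegative d))
      (solve 2 (λ d m → m :* (d :* d) := (κ 1 :- d) :* (κ 1 :- m :* d) :- (κ 1 :- (κ 1 :+ m) :* d)) refl d (fromℕ m)))
    (*-monoʳ-≤ (x≤y⇒0≤y-x d≤1) (bernoulli-inequality 0≤d d≤1 m))

  node-depth : ∀ {k} → Node k → ∃ λ k′ → k ≡ suc k′
  node-depth root        = _ , refl
  node-depth (below _ _) = _ , refl

  module _ {k n : ℕ} (T : BalancedTree k n) where
    open Inverse T using (from)

    data LabelsInUnitInterval : ∀ {m} → Labels ℝ m → Set where
      ∅    : LabelsInUnitInterval ∅
      node : ∀ {m a} {α β : Labels ℝ m} → InUnitInterval a →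
             LabelsInUnitInterval α → LabelsInUnitInterval β → LabelsInUnitInterval (node a α β)

    independently-On : ∀ {m} {est : Node m → Law ℝ} → (∀ u → On InUnitInterval (est u)) →
      On LabelsInUnitInterval (independently est)
    independently-On {zero}  est-On = On-pure ∅
    independently-On {suc m} est-On = On->>= (est-On root) λ a a∈ →
      On->>= (independently-On (est-On ∘ below left)) λ α α∈ →
      On->>= (independently-On (est-On ∘ below right)) λ β β∈ → On-pure (node a∈ α∈ β∈)

    pathProduct-≥0 : ∀ {m} {α : Labels ℝ m} → LabelsInUnitInterval α → ∀ w → 0# ≤ pathProduct T α w
    pathProduct-≥0 ∅                        []          = 0≤1
    pathProduct-≥0 (node (0≤a , _) α∈ _)  (left ∷ w)  = *-nonNegative 0≤a (pathProduct-≥0 α∈ w)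
    pathProduct-≥0 (node (_ , a≤1) _ β∈)  (right ∷ w) = *-nonNegative (x≤y⇒0≤y-x a≤1) (pathProduct-≥0 β∈ w)

    samples-On : ∀ s {μ : MassFunction n} → (∀ i → 0# ≤ μ i) → On (λ _ → ⊤) (samples s μ)
    samples-On zero    0≤μ = On-pure tt
    samples-On (suc s) 0≤μ = On->>= {P = λ _ → ⊤} (On-sample 0≤μ (λ _ → tt)) λ i _ →
      On->>= (samples-On s 0≤μ) λ is _ → On-pure tt

    explicitSamples-On : ∀ s {est : Node k → Law ℝ} → (∀ u → On InUnitInterval (est u)) →
      On (λ _ → ⊤) (explicitSamples s (mapLaw (reconstituted T) (independently est)))
    explicitSamples-On s est-On = On->>= {P = λ μ̃ → ∀ i → 0# ≤ μ̃ i}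
      (On-mapLaw (λ α α∈ i → pathProduct-≥0 α∈ (from i)) (independently-On est-On))
      λ μ̃ 0≤μ̃ → On->>= (samples-On s 0≤μ̃) λ is _ → On-pure tt

  -- The joint law is x with weight c, on the event, and the remainder of d
  -- otherwise. The value o off the event is arbitrary.
  module _ {A B : Set} (_≟ᴮ_ : DecidableEquality B) {c : ℝ} (0<c : 0# < c) (o : A) where

    coupling : ∀ {d : Law B} {x : Law (A × B)} → On (λ _ → ⊤) x → total x ≡ 1# → total d ≡ 1# →
      (∀ g → (∀ b → 0# ≤ g b) → c * 𝔼 x (g ∘ proj₂) ≤ 𝔼 d g) →
      ∃ λ (joint : Law (Bool × (A × B))) →
        IsProbability joint × mapLaw (proj₂ ∘ proj₂) joint ≈ d × c ≤ Pr joint proj₁ ×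
        mapLaw proj₂ (condition proj₁ joint) ≈ x
    coupling {d} {x} x≥0 total-x total-d dom with remainder _≟ᴮ_ {c} {d} {mapLaw proj₂ x}
      (λ g 0≤g → subst (λ z → c * z ≤ 𝔼 d g) (sym (𝔼-mapLaw proj₂ x g)) (dom g 0≤g))
    ... | r , r≥0 , split = joint , (joint≥0 , total-joint) , marginal , ≤-reflexive (sym Pr-event) , conditional
      where
      open ≡-Reasoning
      good bad : Law (Bool × (A × B))
      good = mapLaw (true ,_) (scale c x)
      bad  = mapLaw (λ b → false , (o , b)) r
      joint : Law (Bool × (A × B))
      joint = good ++ bad

      𝔼-joint : ∀ g → 𝔼 joint g ≡ c * 𝔼 x (λ ab → g (true , ab)) + 𝔼 r (λ b → g (false , (o , b)))
      𝔼-joint g = trans (𝔼-++ good bad g) (cong₂ _+_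
        (trans (𝔼-mapLaw (true ,_) (scale c x) g) (𝔼-scale c x _))
        (𝔼-mapLaw (λ b → false , (o , b)) r g))

      joint≥0 : All (λ wa → 0# ≤ proj₁ wa) joint
      joint≥0 = All.map proj₁ (All.++⁺
        (On-mapLaw {Q = λ _ → ⊤} (λ _ _ → tt) (On-scale (proj₁ 0<c) x≥0))
        (On-mapLaw {Q = λ _ → ⊤} (λ _ _ → tt) r≥0))

      𝔼-outputs : ∀ g → 𝔼 joint (g ∘ proj₂ ∘ proj₂) ≡ 𝔼 d g
      𝔼-outputs g = trans (𝔼-joint _) (sym (trans (split g) (cong (λ z → c * z + 𝔼 r g) (𝔼-mapLaw proj₂ x g))))

      marginal : mapLaw (proj₂ ∘ proj₂) joint ≈ d
      marginal = ≈-from-𝔼 λ g → trans (𝔼-mapLaw (proj₂ ∘ proj₂) joint g) (𝔼-outputs g)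

      total-joint : Pr joint (λ _ → true) ≡ 1#
      total-joint = trans (Pr-𝔼 joint _) (trans (𝔼-outputs (λ _ → 1#)) total-d)

      𝔼-event : ∀ g → 𝔼 joint (λ a → 𝟙 (proj₁ a) * g (proj₂ a)) ≡ c * 𝔼 x g
      𝔼-event g = begin
        𝔼 joint (λ a → 𝟙 (proj₁ a) * g (proj₂ a))
          ≡⟨ 𝔼-joint _ ⟩
        c * 𝔼 x (λ ab → 1# * g ab) + 𝔼 r (λ b → 0# * g (o , b))
          ≡⟨ cong₂ (λ y z → c * y + z) (𝔼-cong x (λ ab → *-identityˡ _)) (trans (𝔼-* r 0# _) (zeroˡ _)) ⟩
        c * 𝔼 x g + 0#
          ≡⟨ +-identityʳ _ ⟩
        c * 𝔼 x g ∎

      Pr-event : Pr joint proj₁ ≡ c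
      Pr-event = begin
        Pr joint proj₁                        ≡⟨ Pr-𝔼 joint proj₁ ⟩
        𝔼 joint (𝟙 ∘ proj₁)                   ≡⟨ 𝔼-cong joint (λ _ → sym (*-identityʳ _)) ⟩
        𝔼 joint (λ a → 𝟙 (proj₁ a) * 1#)      ≡⟨ 𝔼-event (λ _ → 1#) ⟩
        c * total x                       ≡⟨ trans (cong (c *_) total-x) (*-identityʳ c) ⟩
        c                                 ∎

      conditional : mapLaw proj₂ (condition proj₁ joint) ≈ x
      conditional = ≈-from-𝔼 λ g → begin
        𝔼 (mapLaw proj₂ (condition proj₁ joint)) g
          ≡⟨ 𝔼-mapLaw proj₂ (condition proj₁ joint) g ⟩
        𝔼 (condition proj₁ joint) (g ∘ proj₂)
          ≡⟨ 𝔼-condition proj₁ joint (g ∘ proj₂) (λ Pr≡0 → >⇒≢ 0<c (trans (sym Pr-event) Pr≡0)) ⟩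
        Pr joint proj₁ ⁻¹ * 𝔼 joint (λ a → 𝟙 (proj₁ a) * g (proj₂ a))
          ≡⟨ cong₂ (λ p y → p ⁻¹ * y) Pr-event (𝔼-event g) ⟩
        c ⁻¹ * (c * 𝔼 x g)
          ≡⟨ trans (sym (*-assoc _ c _)) (trans (cong (_* 𝔼 x g) (*-inverseˡ (>⇒≢ 0<c))) (*-identityˡ _)) ⟩
        𝔼 x g ∎

  module Sampler {k n : ℕ} (T : BalancedTree k n) (μ : MassFunction n) (0≤μ : ∀ i → 0# ≤ μ i)
    (ε δ : ℝ) (0<ε : 0# < ε) (ε≤1 : ε ≤ 1#) (0<δ : 0# < δ) (δ<1 : δ < 1#) (s′ : ℕ) where

    s : ℕ
    s = suc s′
    e δ′ : ℝ
    e = accuracy ε k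
    δ′ = δ / (fromℕ s * fromℕ k)

    t : ℕ
    t = sampleSize T e δ′

    est cond : Node k → Law ℝ
    est u  = ⟦ ratioEstimator T e δ′ u ⟧ μ
    cond u = condition (λ x → within e x (ratio T μ u)) (est u)

    -- A node exists only if k > 0, and then no inverse in δ′ and e is that of 0.
    module Parameters (k′ : ℕ) (k≡ : k ≡ suc k′) where
      0<k : 0# < fromℕ k
      0<k rewrite k≡ = 0<fromℕ k′
      1≤k : 1# ≤ fromℕ k
      1≤k rewrite k≡ = ≤-by (0≤fromℕ k′) (solve 1 (λ k → k := κ 1 :+ k :- κ 1) refl (fromℕ k′))
      1≤s : 1# ≤ fromℕ s
      1≤s = ≤-by (0≤fromℕ s′) (solve 1 (λ k → k := κ 1 :+ k :- κ 1) refl (fromℕ s′))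
      0<sk : 0# < fromℕ s * fromℕ k
      0<sk = *-positive (0<fromℕ s′) 0<k
      sk*δ′ : fromℕ s * fromℕ k * δ′ ≡ δ
      sk*δ′ = *-/-cancel δ (>⇒≢ 0<sk)
      0<δ′ : 0# < δ′
      0<δ′ = *-positive 0<δ (0<x⁻¹ 0<sk)
      1≤sk : 1# ≤ fromℕ s * fromℕ k
      1≤sk = ≤-trans 1≤s (≤-trans (≤-reflexive (sym (*-identityʳ _))) (*-monoʳ-≤ (0≤fromℕ s) 1≤k))
      δ′≤δ : δ′ ≤ δ
      δ′≤δ = subst₂ _≤_ (*-identityˡ δ′) sk*δ′ (*-monoˡ-≤ (proj₁ 0<δ′) 1≤sk)
      δ′≤1 : δ′ ≤ 1#
      δ′≤1 = ≤-trans δ′≤δ (proj₁ δ<1)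
      δ′<1 : δ′ < 1#
      δ′<1 = δ′≤1 , λ δ′≡1 → <⇒≱ δ<1 (subst (_≤ δ) δ′≡1 δ′≤δ)
      x : ℝ
      x = ε / (fromℕ 2 * fromℕ k)
      0<2k : 0# < fromℕ 2 * fromℕ k
      0<2k = *-positive (0<fromℕ 1) 0<k
      0<x : 0# < x
      0<x = *-positive 0<ε (0<x⁻¹ 0<2k)
      2x≤1 : fromℕ 2 * x ≤ 1#
      2x≤1 = ≤-trans (≤-trans
        (subst₂ _≤_ (*-identityˡ _) (solve 2 (λ k x → k :* (κ 2 :* x) := κ 2 :* k :* x) refl (fromℕ k) x)
          (*-monoˡ-≤ (*-nonNegative (0≤fromℕ 2) (proj₁ 0<x)) 1≤k))
        (≤-reflexive (*-/-cancel ε (>⇒≢ 0<2k)))) ε≤1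
      0<e : 0# < e
      0<e = subst (0# <_) (solve 1 (λ x → x :* x := x :* (x :* κ 1)) refl x) (*-positive 0<x 0<x)
      e≤¼ : fromℕ 4 * e ≤ 1#
      e≤¼ = ≤-by (+-nonNegative (x≤y⇒0≤y-x 2x≤1) (*-nonNegative
          (*-nonNegative (0≤fromℕ 2) (proj₁ 0<x)) (x≤y⇒0≤y-x 2x≤1)))
        (solve 1 (λ x → (κ 1 :- κ 2 :* x) :+ κ 2 :* x :* (κ 1 :- κ 2 :* x) := κ 1 :- κ 4 :* (x :* (x :* κ 1))) refl x)

    est-total : ∀ u → total (est u) ≡ 1#
    est-total u = estimate-total T μ 0≤μ u e δ′ 0<e e≤¼ 0<δ′ δ′<1 t (sampleSize-enough T 0<e)
      where open Parameters (proj₁ (node-depth u)) (proj₂ (node-depth u))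

    cond-total : ∀ u → total (cond u) ≡ 1#
    cond-total u = total-condition _ (est u) (est-total u)

    est-dominates : ∀ u → Dominates InUnitInterval (1# - δ′) (est u) (cond u)
    est-dominates u = dominates-condition (estimate-On T μ 0≤μ u e δ′ 0<e e≤¼ 0<δ′ δ′<1 t (sampleSize-enough T 0<e))
      (≤-by (proj₁ 0<δ′) (solve 1 (λ d → d := κ 1 :- (κ 1 :- d)) refl δ′))
      (estimate-accurate T μ 0≤μ u e δ′ 0<e e≤¼ 0<δ′ δ′<1 t (sampleSize-enough T 0<e))
      where open Parameters (proj₁ (node-depth u)) (proj₂ (node-depth u))

    -- Bernoulli's inequality turns the factor (1 - δ′) ^ (k s) into 1 - δ. For
    -- k = 0 there are no nodes, and the factor is 1.
    runs-dominate : Dominates (λ _ → ⊤) (1# - δ) (runsLaw T est s (fill nothing)) (runsLaw T cond s (fill nothing))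
    runs-dominate = by-depth k refl
      where
      open Algebra.Properties.Semiring.Exp semiring using (^-assocʳ)
      by-depth : ∀ k″ → k ≡ k″ →
        Dominates (λ _ → ⊤) (1# - δ) (runsLaw T est s (fill nothing)) (runsLaw T cond s (fill nothing))
      by-depth zero refl = dominates-weaken
        (subst (1# - δ ≤_) (sym (^-assocʳ 1# 0 s)) (≤-by (proj₁ 0<δ) (solve 1 (λ d → d := κ 1 :- (κ 1 :- d)) refl δ)))
        (runs-dominates T 1# (0≤1 , ≤-refl) est cond (λ ()) s ∅)
      by-depth (suc k′) k≡ = dominates-weaken
        (subst₂ _≤_ (cong (λ x → 1# - x) product) (sym (^-assocʳ (1# - δ′) k s))
          (bernoulli-inequality (proj₁ 0<δ′) δ′≤1 (k ℕ.* s)))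
        (runs-dominates T (1# - δ′)
          (x≤y⇒0≤y-x δ′≤1 , ≤-by (proj₁ 0<δ′) (solve 1 (λ d → d := κ 1 :- (κ 1 :- d)) refl δ′))
          est cond est-dominates s (Valid-fill T k))
        where
        open Parameters k′ k≡
        product : fromℕ (k ℕ.* s) * δ′ ≡ δ
        product = trans (cong (_* δ′) (trans (fromℕ-* k s) (*-comm _ _))) sk*δ′

    isExplicitPersistentSampler :
      IsExplicitPersistentSampler μ δ s (condensation T μ ε δ′) (persistentSampler T ε δ s)
    isExplicitPersistentSampler = coupling
      (Vec.≡-dec (Product.≡-dec Fin._≟_ _≟_)) 0<1-δ (λ _ → 0#)
      (explicitSamples-On T s (onʳ ∘ est-dominates))
      (trans (explicit-runs T cond cond-total s (λ _ → 1#)) (runs-total T cond cond-total s (fill nothing)))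
      (trans (𝔼-⟦runs⟧ T μ ε δ s s (fill nothing) (λ _ → 1#)) (runs-total T est est-total s (fill nothing)))
      transported
      where
      0<1-δ : 0# < 1# - δ
      0<1-δ = x≤y⇒0≤y-x (proj₁ δ<1) , λ 0≡1-δ → proj₂ δ<1
        (trans (solve 1 (λ d → d := κ 1 :- (κ 1 :- d)) refl δ)
          (trans (cong (λ x → 1# - x) (sym 0≡1-δ)) (solve 0 (κ 1 :- κ 0 := κ 1) refl)))
      transported : ∀ g → (∀ os → 0# ≤ g os) →
        (1# - δ) * 𝔼 (explicitSamples s (condensation T μ ε δ′)) (g ∘ proj₂) ≤
        𝔼 (⟦ PersistentAlgorithm.runs (persistentSampler T ε δ s) s ⟧ μ) g
      transported g 0≤g = subst₂ (λ x y → (1# - δ) * x ≤ y)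
        (sym (explicit-runs T cond cond-total s g)) (sym (𝔼-⟦runs⟧ T μ ε δ s s (fill nothing) g))
        (bound runs-dominate g (λ os _ → 0≤g os))

    exact-size : ℝ
    exact-size = fromℕ 2 * (e ⁻¹) ^ 2 * log (δ′ ⁻¹)
    N : ℝ
    N = fromℕ (2 ℕ.^ 5) * (ε ⁻¹) ^ 4 * fromℕ k ^ 5 * log (fromℕ s * δ ⁻¹ * fromℕ k)

    -- Rounding adds at most 1 to each of k sample sizes.
    rounding : N ≤ fromℕ (k ℕ.* t) × fromℕ (k ℕ.* t) ≤ N + fromℕ k
    rounding = by-depth k refl
      where
      by-depth : ∀ k″ → k ≡ k″ → N ≤ fromℕ (k ℕ.* t) × fromℕ (k ℕ.* t) ≤ N + fromℕ k
      by-depth zero refl = ≤-reflexive N≡0 , ≤-reflexive (sym (trans (+-identityʳ N) N≡0))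
        where
        N≡0 : N ≡ 0#
        N≡0 = solve 2 (λ f l → κ 32 :* f :* (κ 0 :* (κ 0 :* (κ 0 :* (κ 0 :* (κ 0 :* κ 1))))) :* l := κ 0) refl
          ((ε ⁻¹) ^ 4) (log (fromℕ s * δ ⁻¹ * fromℕ k))
      by-depth (suc k′) k≡@refl = subst₂ (λ x y → x ≤ y × y ≤ x + fromℕ k)
        (sym (total-size 0<ε 0<δ k′ s′)) (sym (fromℕ-* k t))
        ( *-monoʳ-≤ (proj₁ 0<k) (≤⌈⌉ exact-size)
        , ≤-trans (*-monoʳ-≤ (proj₁ 0<k) (⌈⌉≤ {exact-size} (+-nonNegative 0≤size 0≤1)))
            (≤-reflexive (solve 2 (λ k x → k :* (x :+ κ 1) := k :* x :+ k) refl (fromℕ k) exact-size)))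
        where
        open Parameters k′ k≡
        0≤size : 0# ≤ exact-size
        0≤size = 0≤exact 0<ε 0<δ k′ s′ 0<δ′ δ′≤1

    open PersistentAlgorithm (persistentSampler T ε δ s)

    initial-run-uses : ∀ m → run initial Uses m → N ≤ fromℕ m × fromℕ m ≤ N + fromℕ k
    initial-run-uses m uses = subst (λ m → N ≤ fromℕ m × fromℕ m ≤ N + fromℕ k)
      (sym (walk-uses-≡ T (ratioEstimator T e δ′) (ratioEstimator-uses T e δ′)
        (bind-return-uses (walk T (ratioEstimator T e δ′) initial) uses)))
      rounding

    run-uses : ∀ α m → run α Uses m → fromℕ m ≤ N + fromℕ k
    run-uses α m uses = ≤-trans
      (fromℕ-mono-≤ (walk-uses-≤ T (ratioEstimator T e δ′) (ratioEstimator-uses T e δ′) α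
        (bind-return-uses (walk T (ratioEstimator T e δ′) α) uses)))
      (proj₂ rounding)

lemma5p2p3 :
    (𝓡 : RealNumbers) →
    let open RealNumbers 𝓡
        open OverReals 𝓡
        open PersistentAlgorithm in
    ∀ {n k : ℕ} → n ≡ 2 ℕ.^ k → (T : BalancedTree k n) →
    (μ : MassFunction n) → IsDistribution μ →
    (ε δ : ℝ) → 0# < ε → ε < 1# → 0# < δ → δ < 1# →
    (s : ℕ) → 1 ℕ.≤ s →
    let P = persistentSampler T ε δ s
        N = fromℕ (2 ℕ.^ 5) * (ε ⁻¹) ^ 4 * fromℕ k ^ 5
              * log (fromℕ s * δ ⁻¹ * fromℕ k) in
    IsExplicitPersistentSampler μ δ s
      (condensation T μ ε (δ / (fromℕ s * fromℕ k))) P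
    -- N up to rounding the sample size of each of the k nodes on the path;
    -- later runs may reuse estimates and so need fewer samples
    × (∀ m → run P (initial P) Uses m →
         N ≤ fromℕ m × fromℕ m ≤ N + fromℕ k)
    × (∀ α m → run P α Uses m → fromℕ m ≤ N + fromℕ k)
lemma5p2p3 𝓡 _ T μ (0≤μ , _) ε δ 0<ε ε<1 0<δ δ<1 (suc s′) _ =
  isExplicitPersistentSampler , initial-run-uses , run-uses
  where
  open Assembly.Sampler 𝓡 T μ 0≤μ ε δ 0<ε (proj₁ ε<1) 0<δ δ<1 s′
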